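{- Fix an integer $g \geq 2$. Let $f\colon \mathbb{N}\to\mathbb{N}$ be any arithmetic function of the form $f = f_1 \circ f_2 \circ \dots \circ f_j$ for some $j \geq 1$, where each $f_i \in \{\phi, \sigma, \lambda\}$. Then both of the real numbers \[ 0.f(1) f(2) f(3) f(4)\ldots \qquad\text{and}\qquad 0.f(2) f(3) f(5) f(7)\ldots, \] obtained by concatenating the base-$g$ digits of the successive values $f(n)$ for $n=1,2,3,\dots$ (respectively, for $n$ running over the primes $2,3,5,7,\dots$ in increasing order), are $g$-normal.
   Context: $\phi$ is Euler's totient function, $\sigma(n)=\sum_{d\mid n} d$ is the sum-of-divisors function, and $\lambda(n)$ is Carmichael's lambda-function, the exponent of the group $(\mathbb{Z}/n\mathbb{Z})^{\times}$. A real number is $g$-normal if, for every $k\ge1$, every word of length $k$ on the alphabet $\{0,1,\dots,g-1\}$ occurs in its base-$g$ expansion with limiting frequency $g^{ -k}$. -}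

module Defs where

open import Data.Nat using (ℕ; zero; suc; _+_; _*_; _^_; _≤_; _≡ᵇ_; NonZero)
open import Data.Nat.DivMod using (_/_; _%_; _mod_)
open import Data.Nat.GCD using (gcd)
open import Data.Nat.Divisibility using (_∣?_)
open import Data.Nat.Primality using (prime?)
open import Data.Fin using (Fin)
open import Data.Fin.Properties using () renaming (_≟_ to _≟ᶠ_)
open import Data.Bool using (Bool; true; false; if_then_else_; _∧_)
open import Data.List using (List; []; _∷_; reverse; concat; map; filter; length; take; upTo)
open import Data.Nat.ListAction using (sum)
open import Data.Bool.ListAction using (and)
open import Data.List.NonEmpty using (List⁺; _∷_)
open import Data.Integer using (+_)
open import Data.Rational using (ℚ; 0ℚ; ∣_∣; _-_; _<_) renaming (_/_ to _/ℚ_)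
open import Data.Product using (Σ; _×_; ∃)
open import Relation.Nullary using (does)

range1 : ℕ → List ℕ
range1 n = map suc (upTo n)

φ : ℕ → ℕ
φ n = length (filter (λ k → gcd k n Data.Nat.≟ 1) (range1 n))

σ : ℕ → ℕ
σ n = sum (filter (λ d → d ∣? n) (range1 n))

killsUnits : (n : ℕ) → .{{_ : NonZero n}} → ℕ → Bool
killsUnits n m =
  and (map (λ a → if gcd a n ≡ᵇ 1 then (a ^ m) % n ≡ᵇ 1 % n else true) (range1 n))

firstWith : (ℕ → Bool) → List ℕ → ℕ
firstWith p [] = 0
firstWith p (m ∷ ms) = if p m then m else firstWith p ms

-- Carmichael's lambda: the exponent of (Z/nZ)^×, i.e. the least m ≥ 1 with
-- a^m ≡ 1 (mod n) for every unit a.  The search over 1..n suffices since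
-- λ(n) ≤ φ(n) ≤ n.  (Value at 0 is irrelevant.)
λC : ℕ → ℕ
λC zero = 0
λC n@(suc _) = firstWith (killsUnits n) (range1 n)

data Basic : Set where
  phi sigma lam : Basic

⟦_⟧ᵇ : Basic → ℕ → ℕ
⟦ phi ⟧ᵇ = φ
⟦ sigma ⟧ᵇ = σ
⟦ lam ⟧ᵇ = λC

composeL : List Basic → ℕ → ℕ
composeL [] x = x
composeL (b ∷ bs) x = ⟦ b ⟧ᵇ (composeL bs x)

compose : List⁺ Basic → ℕ → ℕ
compose (f ∷ fs) x = ⟦ f ⟧ᵇ (composeL fs x)

-- base-g digits of m, least significant first (fuel-bounded; fuel m suffices for g ≥ 2)
digitsRev : (g : ℕ) → .{{_ : NonZero g}} → ℕ → ℕ → List (Fin g)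
digitsRev g zero m = []
digitsRev g (suc fuel) zero = []
digitsRev g (suc fuel) m@(suc _) = (m mod g) ∷ digitsRev g fuel (m / g)

digits : (g : ℕ) → .{{_ : NonZero g}} → ℕ → List (Fin g)
digits g m = reverse (digitsRev g m m)

champAll : (g : ℕ) → .{{_ : NonZero g}} → (ℕ → ℕ) → ℕ → List (Fin g)
champAll g f N = concat (map (λ n → digits g (f n)) (range1 N))

champPrime : (g : ℕ) → .{{_ : NonZero g}} → (ℕ → ℕ) → ℕ → List (Fin g)
champPrime g f N = concat (map (λ n → digits g (f n)) (filter prime? (range1 N)))

startsWith : {g : ℕ} → List (Fin g) → List (Fin g) → Bool
startsWith [] xs = true
startsWith (w ∷ ws) [] = false
startsWith (w ∷ ws) (x ∷ xs) = does (w ≟ᶠ x) ∧ startsWith ws xs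

occ : {g : ℕ} → List (Fin g) → List (Fin g) → ℕ
occ w [] = 0
occ w (x ∷ xs) = (if startsWith w (x ∷ xs) then 1 else 0) + occ w xs

ratio : ℕ → ℕ → ℚ
ratio c zero = 0ℚ
ratio c (suc m) = (+ c) /ℚ suc m

-- g-normality of the infinite digit sequence whose prefixes are given by the
-- increasing family of finite strings L N (each a prefix of the next):
-- for every nonempty word w (length k), the number of occurrences of w among
-- the first M digits, divided by M, tends to g^{-k} as M → ∞.
Normal : (g : ℕ) → (ℕ → List (Fin g)) → Set
Normal g L =
  (w : List (Fin g)) → 1 ≤ length w →
  (ε : ℚ) → Data.Rational.Positive ε →
  ∃ λ M₀ → (M : ℕ) → M₀ ≤ M → (N : ℕ) → M ≤ length (L N) →
    ∣ ratio (occ w (take M (L N))) M - ratio 1 (g ^ length w) ∣ < ε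

{-# OPTIONS --safe #-}
module Submission where

-- Following Copeland and Erdős, it suffices that f(n) lies in a sparse set of integers for few n ≤ x only: a Chernoff bound
-- shows that the integers whose digits contain a given word too often are a power saving rare, and upper bounds for the
-- frequencies of all words of one length imply lower bounds.
--
-- Let x be about 2 ^ 2 ^ t, so that t is about log log x.  Each prime power p ^ a exactly dividing n has a "local factor"
-- (p - 1 for φ and λ, σ(p ^ a) for σ) which divides f(n) and determines p once a is known.  Hence n is a product of ω(n)
-- numbers from a list of size about τ(f(n)) log x, and if τ(n) and τ(f(n)) are at most 2 ^ poly(t), then f(n) = m has only
-- 2 ^ poly(t) = x ^ o(1) such solutions n.  On the other hand f(n) divides n times the product of its local factors, so
-- τ(f(n)) is that small unless some local factor has very many divisors; as the local factor e belongs to at most ⌊2x/e⌋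
-- integers n ≤ x, and Σ τ(e) ⌊X/e⌋ ≤ X (log X) ^ 2 roughly, this is rare: it happens for at most x / (log x) ^ A integers n,
-- for any A.  Iterating over the composition, the exceptional set remains of size x / (log x) ^ A.  This is negligible
-- even against the number of primes up to x, for which the lower bound log lcm(1, …, x) ≥ c x suffices.

open import Defs
open import Level using (Level; 0ℓ)
open import Data.Nat
open import Data.Nat.Properties
open import Data.Nat.DivMod
open import Data.Nat.Divisibility
open import Data.Nat.GCD using (gcd; gcd[m,n]∣m; gcd[m,n]∣n; gcd-greatest)
open import Data.Nat.Coprimality using (Coprime; coprime-divisor; gcd≡1⇒coprime; coprime⇒gcd≡1)
open import Data.Nat.Primality
open import Data.Nat.Primality.Factorisation using (factorise)
open import Data.Nat.Induction using (<-rec)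
open import Data.Nat.ListAction using (sum; product)
open import Data.Nat.ListAction.Properties using (product-↭)
open import Data.Nat.Tactic.RingSolver using (solve-∀)
open import Data.Bool.ListAction using (and)
open import Data.Bool using (Bool; true; false; if_then_else_)
open import Data.Fin using (Fin; toℕ)
open import Data.List using (List; []; _∷_; _++_; [_]; map; concat; concatMap; filter; length; take; drop; reverse; upTo; allFin; cartesianProductWith; replicate)
open import Data.List.Properties using (length-map; length-++; length-upTo; upTo-∷ʳ; map-++; ++-identityʳ; length-filter; concat-++; filter-++; length-replicate; length-reverse; reverse-involutive; length-take; length-tabulate; drop-drop; take++drop≡id)
open import Data.List.NonEmpty using (List⁺; _∷_)
open import Data.List.Membership.Propositional using (_∈_; _∉_)
open import Data.List.Membership.Propositional.Properties
open import Data.List.Relation.Unary.Any using (here; there)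
open import Data.List.Relation.Unary.All using (All; []; _∷_)
open import Data.List.Relation.Unary.Unique.Propositional using (Unique)
import Data.List.Relation.Unary.Unique.Propositional.Properties as Unique
import Data.List.Relation.Unary.All as All
open import Data.List.Relation.Binary.Permutation.Propositional using (_↭_; ↭-refl; ↭-sym; ↭-trans; prep; swap)
open import Data.List.Relation.Binary.Permutation.Propositional.Properties using (shift; ∈-resp-↭; ↭-length)
open import Data.Product using (Σ; _×_; _,_; proj₁; proj₂; ∃-syntax)
open import Data.Sum using (_⊎_; inj₁; inj₂; [_,_]′)
open import Data.Empty using (⊥-elim)
open import Data.Unit using (tt)
open import Relation.Nullary using (¬_; Dec; yes; no; does; contradiction)
open import Relation.Unary using (Pred; Decidable)
open import Relation.Binary.PropositionalEquality hiding ([_])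
open import Function using (_∘_; id; case_of_)
open import Relation.Binary.Definitions using (tri<; tri≈; tri>)
open import Data.List.Relation.Unary.AllPairs using (AllPairs; []; _∷_)
import Data.List.Relation.Unary.AllPairs.Properties as AllPairs
import Data.Fin.Properties as Fin
import Data.Integer as ℤ
import Data.Integer.Properties as ℤ
import Data.Rational as ℚ
import Data.Rational.Properties as ℚ
import Data.Rational.Unnormalised as ℚᵘ
import Data.Rational.Unnormalised.Properties as ℚᵘ

-- Finite sums and counting in lists

-- Each block is measured against its own length: `Bad` compares the occurrences of the word in the
-- digits of f(n) with the number of these digits. Values with very few digits are simply counted
-- among the bad ones, so short values, which λ can produce, fit the same scheme. The exceptional n
-- ≤ y are counted among all integers, also when n is to be prime. Let T = 2 ^ t, comparable to log
-- y. An exceptional block has at most T digits, and there are at least about y / T primes. If there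
-- are at most 2y / T ^ 3 exceptions, one factor T pays for the block length, one for the density of
-- the primes, and one is left to beat every constant: this is the 3 finally supplied for A. Each
-- function of the composition spends one unit of A on uniting old and new exceptions, which is why
-- `Encoding` is established for every A. Overlapping occurrences of a word are not independent, so
-- positions are separated by their residue modulo the length of the word. All estimates are kept in
-- ℕ with denominators cleared and logarithms replaced by exponents of 2; the comparison of
-- polynomials in t with 2 ^ t is isolated in `poly≤2^`.

private
  variable
    ℓᵃ ℓᵇ : Level
    A : Set ℓᵃ
    B : Set ℓᵇ

∑ : List A → (A → ℕ) → ℕ
∑ [] f = 0
∑ (x ∷ xs) f = f x + ∑ xs f

infix 4 _⊆′_
_⊆′_ : List A → List A → Set _
xs ⊆′ ys = ∀ {z} → z ∈ xs → z ∈ ys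

∑-mono : ∀ (xs : List A) {f g : A → ℕ} → (∀ {x} → x ∈ xs → f x ≤ g x) → ∑ xs f ≤ ∑ xs g
∑-mono [] h = z≤n
∑-mono (x ∷ xs) h = +-mono-≤ (h (here refl)) (∑-mono xs (h ∘ there))

∑-cong : ∀ (xs : List A) {f g : A → ℕ} → (∀ {x} → x ∈ xs → f x ≡ g x) → ∑ xs f ≡ ∑ xs g
∑-cong [] h = refl
∑-cong (x ∷ xs) h = cong₂ _+_ (h (here refl)) (∑-cong xs (h ∘ there))

∑-++ : ∀ (xs ys : List A) (f : A → ℕ) → ∑ (xs ++ ys) f ≡ ∑ xs f + ∑ ys f
∑-++ [] ys f = refl
∑-++ (x ∷ xs) ys f = trans (cong (f x +_) (∑-++ xs ys f)) (sym (+-assoc (f x) _ _))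

∑-map : ∀ (h : A → B) (xs : List A) (f : B → ℕ) → ∑ (map h xs) f ≡ ∑ xs (f ∘ h)
∑-map h [] f = refl
∑-map h (x ∷ xs) f = cong (f (h x) +_) (∑-map h xs f)

*-swapˡ : ∀ x y z → x * (y * z) ≡ y * (x * z)
*-swapˡ = solve-∀

+-interchange : ∀ a b c d → (a + b) + (c + d) ≡ (a + c) + (b + d)
+-interchange = solve-∀

∑-+ : ∀ (xs : List A) (f g : A → ℕ) → ∑ xs (λ x → f x + g x) ≡ ∑ xs f + ∑ xs g
∑-+ [] f g = refl
∑-+ (x ∷ xs) f g = trans (cong (f x + g x +_) (∑-+ xs f g)) (+-interchange (f x) (g x) (∑ xs f) (∑ xs g))

∑-*ˡ : ∀ (xs : List A) c (f : A → ℕ) → ∑ xs (λ x → c * f x) ≡ c * ∑ xs f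
∑-*ˡ [] c f = sym (*-zeroʳ c)
∑-*ˡ (x ∷ xs) c f = trans (cong (c * f x +_) (∑-*ˡ xs c f)) (sym (*-distribˡ-+ c (f x) (∑ xs f)))

∑-*ʳ : ∀ (xs : List A) c (f : A → ℕ) → ∑ xs (λ x → f x * c) ≡ ∑ xs f * c
∑-*ʳ xs c f = trans (∑-cong xs (λ {x} _ → *-comm (f x) c)) (trans (∑-*ˡ xs c f) (*-comm c _))

∑-const : ∀ (xs : List A) c → ∑ xs (λ _ → c) ≡ length xs * c
∑-const [] c = refl
∑-const (x ∷ xs) c = cong (c +_) (∑-const xs c)

∑-swap : ∀ (xs : List A) (ys : List B) (f : A → B → ℕ) →
         ∑ xs (λ x → ∑ ys (f x)) ≡ ∑ ys (λ y → ∑ xs (λ x → f x y))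
∑-swap [] ys f = sym (trans (∑-const ys 0) (*-zeroʳ (length ys)))
∑-swap (x ∷ xs) ys f = trans (cong (∑ ys (f x) +_) (∑-swap xs ys f)) (sym (∑-+ ys (f x) _))

∑-bound : ∀ (xs : List A) {f : A → ℕ} {c} → (∀ {x} → x ∈ xs → f x ≤ c) → ∑ xs f ≤ length xs * c
∑-bound xs {c = c} h = ≤-trans (∑-mono xs h) (≤-reflexive (∑-const xs c))

length≡∑1 : ∀ (xs : List A) → length xs ≡ ∑ xs (λ _ → 1)
length≡∑1 xs = sym (trans (∑-const xs 1) (*-identityʳ _))

length-concatMap : ∀ (f : A → List B) xs → length (concatMap f xs) ≡ ∑ xs (length ∘ f)
length-concatMap f []  = refl
length-concatMap f (x ∷ xs) = trans (length-++ (f x)) (cong (length (f x) +_) (length-concatMap f xs))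

∈-concatMap : ∀ (f : A → List B) {xs x y} → x ∈ xs → y ∈ f x → y ∈ concatMap f xs
∈-concatMap f {x ∷ xs} (here refl) q = ∈-++⁺ˡ q
∈-concatMap f {x ∷ xs} (there p) q = ∈-++⁺ʳ (f x) (∈-concatMap f p q)

ind : ∀ {p} {P : Set p} → Dec P → ℕ
ind (yes _) = 1
ind (no  _) = 0

ind-true : ∀ {p} {P : Set p} (d : Dec P) → P → ind d ≡ 1
ind-true (yes _) p = refl
ind-true (no ¬p) p = contradiction p ¬p

ind-false : ∀ {p} {P : Set p} (d : Dec P) → ¬ P → ind d ≡ 0
ind-false (yes p) ¬p = contradiction p ¬p
ind-false (no  _) ¬p = refl

∑-filter : ∀ {p} {P : Pred A p} (P? : Decidable P) xs (f : A → ℕ) →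
           ∑ (filter P? xs) f ≡ ∑ xs (λ x → ind (P? x) * f x)
∑-filter P? [] f = refl
∑-filter P? (x ∷ xs) f with P? x
... | yes _ = cong₂ _+_ (sym (+-identityʳ (f x))) (∑-filter P? xs f)
... | no  _ = ∑-filter P? xs f

∑-↭ : ∀ {xs ys : List A} (f : A → ℕ) → xs ↭ ys → ∑ xs f ≡ ∑ ys f
∑-↭ f _↭_.refl  = refl
∑-↭ f (prep x p)  = cong (f x +_) (∑-↭ f p)
∑-↭ f (swap x y p)  = trans (cong (λ s → f x + (f y + s)) (∑-↭ f p)) (swap-sum (f x) (f y) _)
  where
  swap-sum : ∀ a b c → a + (b + c) ≡ b + (a + c)
  swap-sum = solve-∀
∑-↭ f (_↭_.trans p q)   = trans (∑-↭ f p) (∑-↭ f q)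

extract : ∀ {x : A} {xs} → x ∈ xs → ∃[ ys ] xs ↭ x ∷ ys
extract {x = x} p with ∈-∃++ p
... | as , bs , refl = as ++ bs , shift x as bs

All≢⇒∉ : ∀ {x : A} {xs} → All (λ y → x ≢ y) xs → x ∉ xs
All≢⇒∉ (p ∷ ps) (here eq) = p eq
All≢⇒∉ (p ∷ ps) (there m) = All≢⇒∉ ps m

complement : ∀ {xs ys : List A} → Unique xs → xs ⊆′ ys → ∃[ zs ] ys ↭ xs ++ zs
complement {xs = []} {ys} [] sub = ys , ↭-refl
complement {xs = x ∷ xs} {ys} (nx ∷ u) sub with extract (sub (here refl))
... | ys′ , p = let zs , q = complement u sub′ in zs , ↭-trans p (prep x q)
  where
  sub′ : xs ⊆′ ys′
  sub′ {z} z∈ with ∈-resp-↭ p (sub (there z∈))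
  ... | here refl = ⊥-elim (All≢⇒∉ nx z∈)
  ... | there z∈′ = z∈′

-- Only the smaller list has to be free of repetitions. The covering list may repeat elements, so
-- lists of images or products can serve as covers as they are.
∑-⊆ : ∀ {xs ys : List A} (f : A → ℕ) → Unique xs → xs ⊆′ ys → ∑ xs f ≤ ∑ ys f
∑-⊆ {xs = xs} {ys} f u sub with complement u sub
... | zs , p = begin
  ∑ xs f ≤⟨ m≤m+n _ _ ⟩
  ∑ xs f + ∑ zs f ≡⟨ ∑-++ xs zs f ⟨
  ∑ (xs ++ zs) f ≡⟨ ∑-↭ f p ⟨
  ∑ ys f ∎
  where open ≤-Reasoning

∑-≈ : ∀ {xs ys : List A} (f : A → ℕ) → Unique xs → Unique ys → xs ⊆′ ys → ys ⊆′ xs → ∑ xs f ≡ ∑ ys f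
∑-≈ f u v s s′ = ≤-antisym (∑-⊆ f u s) (∑-⊆ f v s′)

length-⊆ : ∀ {xs ys : List A} → Unique xs → xs ⊆′ ys → length xs ≤ length ys
length-⊆ {xs = xs} {ys} u s = subst₂ _≤_ (sym (length≡∑1 xs)) (sym (length≡∑1 ys)) (∑-⊆ _ u s)

⊆∧length⇒↭ : ∀ {xs ys : List A} → Unique xs → xs ⊆′ ys → length ys ≤ length xs → ys ↭ xs
⊆∧length⇒↭ {xs = xs} {ys} u s le with complement u s
... | [] , p = subst (ys ↭_) (++-identityʳ xs) p
... | z ∷ zs , p = ⊥-elim (<-irrefl refl (begin-strict
  length xs <⟨ m<m+n (length xs) (s≤s z≤n) ⟩
  length xs + length (z ∷ zs) ≡⟨ length-++ xs ⟨
  length (xs ++ z ∷ zs) ≡⟨ ↭-length p ⟨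
  length ys ≤⟨ le ⟩
  length xs ∎))
  where open ≤-Reasoning

-- Each exceptional x uses up one entry of `bad`, which `extract` removes before the recursion; as
-- the elements of xs are distinct, no entry is charged twice.
∑-exceptional : ∀ {xs bad : List A} {f g : A → ℕ} {c} → Unique xs →
  (∀ {x} → x ∈ xs → f x ≤ g x ⊎ (x ∈ bad × f x ≤ c)) → ∑ xs f ≤ ∑ xs g + length bad * c
∑-exceptional {xs = []} [] h = z≤n
∑-exceptional {xs = x ∷ xs} {bad} {f} {g} {c} (nx ∷ u) h with h (here refl)
... | inj₁ le = ≤-trans (+-mono-≤ le (∑-exceptional {bad = bad} u (h ∘ there))) (≤-reflexive (sym (+-assoc (g x) _ _)))
... | inj₂ (x∈ , le) with extract x∈
... | bad′ , p = begin
  f x + ∑ xs f ≤⟨ +-mono-≤ le (∑-exceptional {bad = bad′} u h′) ⟩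
  c + (∑ xs g + length bad′ * c) ≡⟨ rearrange c (∑ xs g) (length bad′ * c) ⟩
  ∑ xs g + (c + length bad′ * c) ≡⟨ cong (λ l → ∑ xs g + l * c) (↭-length p) ⟨
  ∑ xs g + length bad * c ≤⟨ +-monoˡ-≤ _ (m≤n+m _ (g x)) ⟩
  g x + ∑ xs g + length bad * c ∎
  where
  open ≤-Reasoning
  rearrange : ∀ a b c → a + (b + c) ≡ b + (a + c)
  rearrange = solve-∀
  h′ : ∀ {y} → y ∈ xs → f y ≤ g y ⊎ (y ∈ bad′ × f y ≤ c)
  h′ y∈ with h (there y∈)
  ... | inj₁ q = inj₁ q
  ... | inj₂ (y∈bad , q) with ∈-resp-↭ p y∈bad
  ... | here refl = ⊥-elim (All≢⇒∉ nx y∈)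
  ... | there y∈′ = inj₂ (y∈′ , q)

∈-range1⁺ : ∀ {n i} → 1 ≤ i → i ≤ n → i ∈ range1 n
∈-range1⁺ {n} {suc i} _ le = ∈-map⁺ suc (∈-upTo⁺ le)

∈-range1⁻ : ∀ {n i} → i ∈ range1 n → 1 ≤ i × i ≤ n
∈-range1⁻ p with ∈-map⁻ suc p
... | j , j∈ , refl = s≤s z≤n , ∈-upTo⁻ j∈

range1-unique : ∀ n → Unique (range1 n)
range1-unique n = Unique.map⁺ suc-injective (Unique.upTo⁺ n)

length-range1 : ∀ n → length (range1 n) ≡ n
length-range1 n = trans (length-map suc (upTo n)) (length-upTo n)

range1-suc : ∀ n → range1 (suc n) ≡ range1 n ++ [ suc n ]
range1-suc n = trans (cong (map suc) (sym (upTo-∷ʳ n))) (map-++ suc (upTo n) [ n ])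

∑-range1-suc : ∀ n f → ∑ (range1 (suc n)) f ≡ ∑ (range1 n) f + f (suc n)
∑-range1-suc n f = trans (cong (λ l → ∑ l f) (range1-suc n))
  (trans (∑-++ (range1 n) _ f) (cong (∑ (range1 n) f +_) (+-identityʳ _)))

∑-range1-+ : ∀ m n f → ∑ (range1 (m + n)) f ≡ ∑ (range1 m) f + ∑ (range1 n) (λ i → f (m + i))
∑-range1-+ m zero f = trans (cong (λ k → ∑ (range1 k) f) (+-identityʳ m)) (sym (+-identityʳ _))
∑-range1-+ m (suc n) f = begin
  ∑ (range1 (m + suc n)) f ≡⟨ cong (λ k → ∑ (range1 k) f) (+-suc m n) ⟩
  ∑ (range1 (suc (m + n))) f ≡⟨ ∑-range1-suc (m + n) f ⟩
  ∑ (range1 (m + n)) f + f (suc (m + n)) ≡⟨ cong₂ _+_ (∑-range1-+ m n f) (cong f (sym (+-suc m n))) ⟩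
  ∑ (range1 m) f + ∑ (range1 n) (λ i → f (m + i)) + f (m + suc n) ≡⟨ +-assoc (∑ (range1 m) f) _ _ ⟩
  ∑ (range1 m) f + (∑ (range1 n) (λ i → f (m + i)) + f (m + suc n)) ≡⟨ cong (∑ (range1 m) f +_) (∑-range1-suc n (λ i → f (m + i))) ⟨
  ∑ (range1 m) f + ∑ (range1 (suc n)) (λ i → f (m + i)) ∎
  where open ≡-Reasoning

-- The number of divisors

divisors : ℕ → List ℕ
divisors n = filter (λ d → d ∣? n) (range1 n)

τ : ℕ → ℕ
τ n = length (divisors n)

divisors-unique : ∀ n → Unique (divisors n)
divisors-unique n = Unique.filter⁺ (λ d → d ∣? n) (range1-unique n)

∣⇒1≤ : ∀ {d n} → 1 ≤ n → d ∣ n → 1 ≤ d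
∣⇒1≤ {zero}  1≤n d∣n = contradiction (0∣⇒≡0 d∣n) (>⇒≢ 1≤n)
∣⇒1≤ {suc d} _ _   = s≤s z≤n

∣⇒≤′ : ∀ {d n} → 1 ≤ n → d ∣ n → d ≤ n
∣⇒≤′ {n = suc n} _ d∣n = ∣⇒≤ d∣n

∈-divisors⁺ : ∀ {d n} → 1 ≤ n → d ∣ n → d ∈ divisors n
∈-divisors⁺ {d} {n} 1≤n d∣n = ∈-filter⁺ (λ d → d ∣? n) (∈-range1⁺ (∣⇒1≤ 1≤n d∣n) (∣⇒≤′ 1≤n d∣n)) d∣n

∈-divisors⁻ : ∀ {d n} → d ∈ divisors n → 1 ≤ d × d ∣ n
∈-divisors⁻ {d} {n} p = let q , d∣n = ∈-filter⁻ (λ d → d ∣? n) {xs = range1 n} p in proj₁ (∈-range1⁻ q) , d∣n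

τ-mono-∣ : ∀ {m n} → 1 ≤ n → m ∣ n → τ m ≤ τ n
τ-mono-∣ {m} 1≤n m∣n = length-⊆ (divisors-unique m)
  λ p → ∈-divisors⁺ 1≤n (∣-trans (proj₂ (∈-divisors⁻ {n = m} p)) m∣n)

length-cartesianProductWith : ∀ {a b c} {A : Set a} {B : Set b} {C : Set c} (f : A → B → C) xs ys →
  length (cartesianProductWith f xs ys) ≡ length xs * length ys
length-cartesianProductWith f [] ys = refl
length-cartesianProductWith f (x ∷ xs) ys = trans (length-++ (map (f x) ys))
  (cong₂ _+_ (length-map (f x) ys) (length-cartesianProductWith f xs ys))

1≤* : ∀ {m n} → 1 ≤ m → 1 ≤ n → 1 ≤ m * n
1≤* p q = *-mono-≤ p q

1≤*⇒1≤ˡ : ∀ m {n} → 1 ≤ m * n → 1 ≤ m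
1≤*⇒1≤ˡ (suc m) _ = s≤s z≤n

1≤*⇒1≤ʳ : ∀ m {n} → 1 ≤ m * n → 1 ≤ n
1≤*⇒1≤ʳ m {n} p = 1≤*⇒1≤ˡ n (subst (1 ≤_) (*-comm m n) p)

-- A divisor d of ab is gcd(d,a) times a divisor of b.
τ-submult : ∀ {a b} → 1 ≤ a → 1 ≤ b → τ (a * b) ≤ τ a * τ b
τ-submult {a} {b} 1≤a 1≤b = begin
  τ (a * b) ≤⟨ length-⊆ (divisors-unique (a * b)) sub ⟩
  length (cartesianProductWith _*_ (divisors a) (divisors b)) ≡⟨ length-cartesianProductWith _*_ (divisors a) (divisors b) ⟩
  τ a * τ b ∎
  where
  open ≤-Reasoning
  sub : divisors (a * b) ⊆′ cartesianProductWith _*_ (divisors a) (divisors b)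
  sub {d} d∈ with ∈-divisors⁻ {n = a * b} d∈
  ... | 1≤d , d∣ab with gcd[m,n]∣m d a | gcd[m,n]∣n d a
  ... | divides d′ eqd | divides a′ eqa =
      subst (_∈ cartesianProductWith _*_ (divisors a) (divisors b)) (trans (*-comm g d′) (sym eqd))
        (∈-cartesianProductWith⁺ _*_ (∈-divisors⁺ 1≤a (gcd[m,n]∣n d a)) (∈-divisors⁺ 1≤b d′∣b))
    where
    g = gcd d a
    1≤g : 1 ≤ g
    1≤g = ∣⇒1≤ 1≤d (gcd[m,n]∣m d a)
    instance
      g≢0 : NonZero g
      g≢0 = >-nonZero 1≤g
    cop : Coprime d′ a′
    cop {e} (e∣d′ , e∣a′) = *-cancelʳ-≡ e 1 g (trans
      (∣-antisym (gcd-greatest (subst (e * g ∣_) (sym eqd) (*-monoˡ-∣ g e∣d′)) (subst (e * g ∣_) (sym eqa) (*-monoˡ-∣ g e∣a′))) (n∣m*n e))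
      (sym (*-identityˡ g)))
    d′∣b : d′ ∣ b
    d′∣b = coprime-divisor cop (*-cancelʳ-∣ g (subst₂ _∣_ eqd (trans (cong (_* b) eqa) (rearrange a′ g b)) d∣ab))
      where
      rearrange : ∀ x y z → x * y * z ≡ x * z * y
      rearrange = solve-∀

-- Division with the junk value 0 for the divisor 0.
infixl 7 _÷_
_÷_ : ℕ → ℕ → ℕ
X ÷ zero  = 0
X ÷ suc e = X / suc e

÷-* : ∀ X e → (X ÷ e) * e ≤ X
÷-* X zero  = ≤-trans (≤-reflexive (*-zeroʳ (X ÷ 0))) z≤n
÷-* X (suc e) = m/n*n≤m X (suc e)

÷-greatest : ∀ {X e q} → 1 ≤ e → q * e ≤ X → q ≤ X ÷ e
÷-greatest {X} {suc e} {q} _ le = subst (_≤ X / suc e) (m*n/n≡m q (suc e)) (/-monoˡ-≤ (suc e) le)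

÷-monoʳ : ∀ {X d e} → 1 ≤ d → d ≤ e → X ÷ e ≤ X ÷ d
÷-monoʳ {X} {d} {e} 1≤d d≤e = ÷-greatest 1≤d (≤-trans (*-monoʳ-≤ (X ÷ e) d≤e) (÷-* X e))

÷-assoc : ∀ {X a b} → 1 ≤ a → 1 ≤ b → X ÷ (a * b) ≤ (X ÷ a) ÷ b
÷-assoc {X} {a} {b} 1≤a 1≤b = ÷-greatest 1≤b (÷-greatest 1≤a (subst (_≤ X) (rearrange (X ÷ (a * b)) a b) (÷-* X (a * b))))
  where
  rearrange : ∀ q a b → q * (a * b) ≡ q * b * a
  rearrange = solve-∀

1≤2^ : ∀ k → 1 ≤ 2 ^ k
1≤2^ k = m^n>0 2 k

-- Dyadic blocks: the 2 ^ k integers following 2 ^ k contribute at most X ÷ 2 ^ k each, hence at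
-- most X together.
harmonic-2^ : ∀ X k → ∑ (range1 (2 ^ k)) (X ÷_) ≤ X * suc k
harmonic-2^ X zero = ≤-reflexive (trans (+-identityʳ (X ÷ 1)) (trans (n/1≡n X) (sym (*-identityʳ X))))
harmonic-2^ X (suc k) = begin
  ∑ (range1 (2 ^ k + (2 ^ k + 0))) (X ÷_) ≡⟨ cong (λ l → ∑ (range1 (2 ^ k + l)) (X ÷_)) (+-identityʳ (2 ^ k)) ⟩
  ∑ (range1 (2 ^ k + 2 ^ k)) (X ÷_) ≡⟨ ∑-range1-+ (2 ^ k) (2 ^ k) (X ÷_) ⟩
  ∑ (range1 (2 ^ k)) (X ÷_) + ∑ (range1 (2 ^ k)) (λ i → X ÷ (2 ^ k + i)) ≤⟨ +-mono-≤ (harmonic-2^ X k) tail ⟩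
  X * suc k + X ≡⟨ trans (+-comm _ X) (sym (*-suc X (suc k))) ⟩
  X * suc (suc k) ∎
  where
  open ≤-Reasoning
  tail : ∑ (range1 (2 ^ k)) (λ i → X ÷ (2 ^ k + i)) ≤ X
  tail = begin
    ∑ (range1 (2 ^ k)) (λ i → X ÷ (2 ^ k + i)) ≤⟨ ∑-bound (range1 (2 ^ k)) (λ {i} _ → ÷-monoʳ {X} (1≤2^ k) (m≤m+n (2 ^ k) i)) ⟩
    length (range1 (2 ^ k)) * (X ÷ 2 ^ k) ≡⟨ cong (_* (X ÷ 2 ^ k)) (length-range1 (2 ^ k)) ⟩
    2 ^ k * (X ÷ 2 ^ k) ≡⟨ *-comm (2 ^ k) _ ⟩
    (X ÷ 2 ^ k) * 2 ^ k ≤⟨ ÷-* X (2 ^ k) ⟩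
    X ∎

range1-mono : ∀ {m n} → m ≤ n → range1 m ⊆′ range1 n
range1-mono m≤n p = let 1≤ , ≤m = ∈-range1⁻ p in ∈-range1⁺ 1≤ (≤-trans ≤m m≤n)

harmonic : ∀ X {N k} → N ≤ 2 ^ k → ∑ (range1 N) (X ÷_) ≤ X * suc k
harmonic X {N} {k} le = ≤-trans (∑-⊆ (X ÷_) (range1-unique N) (range1-mono le)) (harmonic-2^ X k)

-- The cofactor b may run up to X instead of X / a; in the application the surplus terms X ÷ (a * b)
-- vanish.
∑-multiples : ∀ {a} → 1 ≤ a → ∀ X (F : ℕ → ℕ) →
  ∑ (range1 X) (λ e → ind (a ∣? e) * F e) ≤ ∑ (range1 X) (λ b → F (a * b))
∑-multiples {a} 1≤a X F = begin
  ∑ (range1 X) (λ e → ind (a ∣? e) * F e) ≡⟨ ∑-filter (a ∣?_) (range1 X) F ⟨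
  ∑ (filter (a ∣?_) (range1 X)) F ≤⟨ ∑-⊆ F (Unique.filter⁺ (a ∣?_) (range1-unique X)) sub ⟩
  ∑ (map (a *_) (range1 X)) F ≡⟨ ∑-map (a *_) (range1 X) F ⟩
  ∑ (range1 X) (λ b → F (a * b)) ∎
  where
  open ≤-Reasoning
  sub : filter (a ∣?_) (range1 X) ⊆′ map (a *_) (range1 X)
  sub {e} p with ∈-filter⁻ (a ∣?_) {xs = range1 X} p
  ... | e∈ , divides b refl with ∈-range1⁻ e∈
  ... | 1≤e , e≤X = subst (_∈ map (a *_) (range1 X)) (*-comm a b)
            (∈-map⁺ (a *_) (∈-range1⁺ (1≤*⇒1≤ˡ b 1≤e) (≤-trans (m≤m*n b a {{>-nonZero 1≤a}}) e≤X)))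

τ≡∑ : ∀ {e X} → 1 ≤ e → e ≤ X → τ e ≤ ∑ (range1 X) (λ a → ind (a ∣? e))
τ≡∑ {e} {X} 1≤e e≤X = begin
  τ e ≡⟨ length≡∑1 (divisors e) ⟩
  ∑ (divisors e) (λ _ → 1) ≤⟨ ∑-⊆ (λ _ → 1) (divisors-unique e) sub ⟩
  ∑ (filter (_∣? e) (range1 X)) (λ _ → 1) ≡⟨ ∑-filter (_∣? e) (range1 X) (λ _ → 1) ⟩
  ∑ (range1 X) (λ a → ind (a ∣? e) * 1) ≡⟨ ∑-cong (range1 X) (λ _ → *-identityʳ _) ⟩
  ∑ (range1 X) (λ a → ind (a ∣? e)) ∎
  where
  open ≤-Reasoning
  sub : divisors e ⊆′ filter (_∣? e) (range1 X)
  sub p = let p′ , d∣e = ∈-filter⁻ (_∣? e) {xs = range1 e} p in ∈-filter⁺ (_∣? e) (range1-mono e≤X p′) d∣e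

-- Σ_{e ≤ X} τ(e) ⌊X/e⌋ counts triples (a,b,c) with abc ≤ X.
∑τ÷ : ∀ {X k} → X ≤ 2 ^ k → ∑ (range1 X) (λ e → τ e * (X ÷ e)) ≤ X * suc k * suc k
∑τ÷ {X} {k} X≤ = begin
  ∑ (range1 X) (λ e → τ e * (X ÷ e))
    ≤⟨ ∑-mono (range1 X) (λ {e} e∈ → *-monoˡ-≤ (X ÷ e) (let 1≤e , e≤X = ∈-range1⁻ e∈ in τ≡∑ 1≤e e≤X)) ⟩
  ∑ (range1 X) (λ e → ∑ (range1 X) (λ a → ind (a ∣? e)) * (X ÷ e))
    ≡⟨ ∑-cong (range1 X) (λ {e} _ → sym (∑-*ʳ (range1 X) (X ÷ e) (λ a → ind (a ∣? e)))) ⟩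
  ∑ (range1 X) (λ e → ∑ (range1 X) (λ a → ind (a ∣? e) * (X ÷ e)))
    ≡⟨ ∑-swap (range1 X) (range1 X) (λ e a → ind (a ∣? e) * (X ÷ e)) ⟩
  ∑ (range1 X) (λ a → ∑ (range1 X) (λ e → ind (a ∣? e) * (X ÷ e)))
    ≤⟨ ∑-mono (range1 X) (λ a∈ → ∑-multiples (proj₁ (∈-range1⁻ a∈)) X (X ÷_)) ⟩
  ∑ (range1 X) (λ a → ∑ (range1 X) (λ b → X ÷ (a * b)))
    ≤⟨ ∑-mono (range1 X) (λ a∈ → ∑-mono (range1 X) (λ b∈ → ÷-assoc {X} (proj₁ (∈-range1⁻ a∈)) (proj₁ (∈-range1⁻ b∈)))) ⟩
  ∑ (range1 X) (λ a → ∑ (range1 X) (λ b → (X ÷ a) ÷ b))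
    ≤⟨ ∑-mono (range1 X) (λ {a} _ → harmonic (X ÷ a) {X} {k} X≤) ⟩
  ∑ (range1 X) (λ a → (X ÷ a) * suc k)
    ≡⟨ ∑-*ʳ (range1 X) (suc k) (X ÷_) ⟩
  ∑ (range1 X) (X ÷_) * suc k
    ≤⟨ *-monoˡ-≤ (suc k) (harmonic X X≤) ⟩
  X * suc k * suc k ∎
  where open ≤-Reasoning

-- Markov's inequality for the weights ⌊X/e⌋.
manyDivisors-weight : ∀ {X k} K → X ≤ 2 ^ k →
  ∑ (filter (λ e → 2 ^ K <? τ e) (range1 X)) (X ÷_) * 2 ^ K ≤ X * suc k * suc k
manyDivisors-weight {X} {k} K X≤ = begin
  ∑ (filter (λ e → 2 ^ K <? τ e) (range1 X)) (X ÷_) * 2 ^ K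
    ≡⟨ ∑-*ʳ (filter (λ e → 2 ^ K <? τ e) (range1 X)) (2 ^ K) (X ÷_) ⟨
  ∑ (filter (λ e → 2 ^ K <? τ e) (range1 X)) (λ e → (X ÷ e) * 2 ^ K)
    ≤⟨ ∑-mono (filter (λ e → 2 ^ K <? τ e) (range1 X)) bound ⟩
  ∑ (filter (λ e → 2 ^ K <? τ e) (range1 X)) (λ e → τ e * (X ÷ e))
    ≤⟨ ∑-⊆ (λ e → τ e * (X ÷ e)) (Unique.filter⁺ _ (range1-unique X)) (proj₁ ∘ ∈-filter⁻ (λ e → 2 ^ K <? τ e) {xs = range1 X}) ⟩
  ∑ (range1 X) (λ e → τ e * (X ÷ e))
    ≤⟨ ∑τ÷ X≤ ⟩
  X * suc k * suc k ∎
  where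
  open ≤-Reasoning
  bound : ∀ {e} → e ∈ filter (λ e → 2 ^ K <? τ e) (range1 X) → (X ÷ e) * 2 ^ K ≤ τ e * (X ÷ e)
  bound {e} p = ≤-trans (*-monoʳ-≤ (X ÷ e) (<⇒≤ (proj₂ (∈-filter⁻ (λ e → 2 ^ K <? τ e) {xs = range1 X} p)))) (≤-reflexive (*-comm (X ÷ e) (τ e)))

-- Factorisation, φ and σ

prime⇒1< : ∀ {p} → Prime p → 1 < p
prime⇒1< pp = nonTrivial⇒n>1 _ {{prime⇒nonTrivial pp}}

prime⇒1≤ : ∀ {p} → Prime p → 1 ≤ p
prime⇒1≤ pp = <⇒≤ (prime⇒1< pp)

-- An inductive form of the factorisation of n into powers p ^ a of distinct primes, listed as pairs (p , a).
data Factored : ℕ → List (ℕ × ℕ) → Set where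
  one : Factored 1 []
  mul : ∀ {p a m l} → Prime p → ¬ p ∣ m → Factored m l → Factored (p ^ suc a * m) ((p , suc a) ∷ l)

primeDivisor : ∀ {n} → 2 ≤ n → ∃[ p ] Prime p × p ∣ n
primeDivisor {n} 2≤n with factorise n {{>-nonZero (<⇒≤ 2≤n)}}
... | record { factors = [] ; isFactorisation = eq } = contradiction eq (>⇒≢ 2≤n)
... | record { factors = p ∷ ps ; isFactorisation = eq ; factorsPrime = pp ∷ _ } =
      p , pp , divides (product ps) (trans eq (*-comm p _))

splitPower : ∀ {p} → 1 < p → ∀ n → 1 ≤ n → ∃[ a ] ∃[ m ] n ≡ p ^ a * m × ¬ p ∣ m
splitPower {p} 1<p = <-rec _ step
  where
  step : ∀ n → (∀ {m} → m < n → 1 ≤ m → ∃[ a ] ∃[ m′ ] m ≡ p ^ a * m′ × ¬ p ∣ m′) →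
         1 ≤ n → ∃[ a ] ∃[ m ] n ≡ p ^ a * m × ¬ p ∣ m
  step n rec 1≤n with p ∣? n
  ... | no p∤n = 0 , n , sym (+-identityʳ n) , p∤n
  ... | yes (divides q refl) =
        let 1≤q = 1≤*⇒1≤ˡ q 1≤n
            a , m , eq , p∤m = rec (m<m*n q p {{>-nonZero 1≤q}} 1<p) 1≤q
        in suc a , m , trans (*-comm q p) (trans (cong (p *_) eq) (sym (*-assoc p (p ^ a) m))) , p∤m

prime-∤1 : ∀ {p} → Prime p → ¬ p ∣ 1
prime-∤1 pp p∣1 = <⇒≢ (prime⇒1< pp) (sym (∣1⇒≡1 p∣1))

factored : ∀ n → 1 ≤ n → ∃[ l ] Factored n l
factored = <-rec _ step
  where
  step : ∀ n → (∀ {m} → m < n → 1 ≤ m → ∃[ l ] Factored m l) → 1 ≤ n → ∃[ l ] Factored n l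
  step 1 rec 1≤n = [] , one
  step n@(suc (suc _)) rec 1≤n with primeDivisor {n} (s≤s (s≤s z≤n))
  ... | p , pp , p∣n with splitPower (prime⇒1< pp) n 1≤n
  ... | zero  , m , eq , p∤m = contradiction (subst (p ∣_) (trans eq (+-identityʳ m)) p∣n) p∤m
  ... | suc a , m , eq , p∤m =
          let 1≤m = 1≤*⇒1≤ʳ (p ^ suc a) (subst (1 ≤_) eq 1≤n)
              l , f = rec (subst (m <_) (trans (*-comm m _) (sym eq)) (m<m*n m (p ^ suc a) {{>-nonZero 1≤m}}
                             (≤-trans (prime⇒1< pp) (m≤m*n p (p ^ a) {{m^n≢0 p a {{prime⇒nonZero pp}}}})))) 1≤m
          in (p , suc a) ∷ l , subst (λ k → Factored k ((p , suc a) ∷ l)) (sym eq) (mul pp p∤m f)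

coprime-* : ∀ {a b m} → Coprime a m → Coprime b m → Coprime (a * b) m
coprime-* ca cb {d} (d∣ab , d∣m) =
  cb (coprime-divisor (λ (e∣d , e∣a) → ca (e∣a , ∣-trans e∣d d∣m)) d∣ab , d∣m)

coprime-sym : ∀ {a b} → Coprime a b → Coprime b a
coprime-sym c (p , q) = c (q , p)

prime∤⇒coprime : ∀ {p m} → Prime p → ¬ p ∣ m → Coprime p m
prime∤⇒coprime pp p∤m (d∣p , d∣m) with prime⇒irreducible pp d∣p
... | inj₁ d≡1 = d≡1
... | inj₂ refl = contradiction d∣m p∤m

coprime-^ : ∀ {p m} a → Coprime p m → Coprime (p ^ a) m
coprime-^ zero c (d∣1 , _) = ∣1⇒≡1 d∣1
coprime-^ (suc a) c = coprime-* c (coprime-^ a c)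

coprime⇒*∣ : ∀ {a b n} → Coprime a b → a ∣ n → b ∣ n → a * b ∣ n
coprime⇒*∣ {a} {b} c a∣n (divides q refl) =
  subst (_∣ q * b) refl (*-monoˡ-∣ b (coprime-divisor c (subst (a ∣_) (*-comm q b) a∣n)))

gcd≡1 : ∀ m n → Coprime m n → gcd m n ≡ 1
gcd≡1 m n = coprime⇒gcd≡1 {m} {n}

gcd≡1⁻ : ∀ m n → gcd m n ≡ 1 → Coprime m n
gcd≡1⁻ m n = gcd≡1⇒coprime {m} {n}

ind-⇔ : ∀ {p q} {P : Set p} {Q : Set q} (d : Dec P) (e : Dec Q) → (P → Q) → (Q → P) → ind d ≡ ind e
ind-⇔ (yes p) e f g = sym (ind-true e (f p))
ind-⇔ (no ¬p) e f g = sym (ind-false e (¬p ∘ g))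

∣-+⁻ : ∀ {d m n} → d ∣ m + n → d ∣ m → d ∣ n
∣-+⁻ p q = ∣m+n∣m⇒∣n p q

gcd-periodic : ∀ n k → gcd (n + k) n ≡ gcd k n
gcd-periodic n k = ∣-antisym
  (gcd-greatest (∣-+⁻ (gcd[m,n]∣m (n + k) n) (gcd[m,n]∣n (n + k) n)) (gcd[m,n]∣n (n + k) n))
  (gcd-greatest (∣m∣n⇒∣m+n (gcd[m,n]∣n k n) (gcd[m,n]∣m k n)) (gcd[m,n]∣n k n))

-- Separating the length N of the range from the modulus n allows units modulo n to be counted over
-- several periods, which is how φ (p * n) is reached.
copIn : ℕ → ℕ → ℕ
copIn N n = ∑ (range1 N) (λ k → ind (gcd k n ≟ 1))

φ≡copIn : ∀ n → φ n ≡ copIn n n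
φ≡copIn n = trans (length≡∑1 (filter (λ k → gcd k n ≟ 1) (range1 n))) (trans (∑-filter (λ k → gcd k n ≟ 1) (range1 n) (λ _ → 1)) (∑-cong (range1 n) (λ _ → *-identityʳ _)))

copIn-multiple : ∀ c n → copIn (c * n) n ≡ c * φ n
copIn-multiple zero n = refl
copIn-multiple (suc c) n = trans (∑-range1-+ n (c * n) _) (cong₂ _+_ (sym (φ≡copIn n))
  (trans (∑-cong (range1 (c * n)) (λ {k} _ → cong (λ g → ind (g ≟ 1)) (gcd-periodic n k))) (copIn-multiple c n)))

-- If p divides n, then being coprime to p n and to n is the same condition, and the range up to p n
-- consists of p periods of length n.
φ-prime-∣ : ∀ {p n} → p ∣ n → φ (p * n) ≡ p * φ n
φ-prime-∣ {p} {n} p∣n = trans (φ≡copIn (p * n)) (trans (∑-cong (range1 (p * n)) pointwise) (copIn-multiple p n))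
  where
  pointwise : ∀ {k} → k ∈ range1 (p * n) → ind (gcd k (p * n) ≟ 1) ≡ ind (gcd k n ≟ 1)
  pointwise {k} _ = ind-⇔ (gcd k (p * n) ≟ 1) (gcd k n ≟ 1)
    (λ e → gcd≡1 k n (λ (d∣k , d∣n) → gcd≡1⁻ k (p * n) e (d∣k , ∣n⇒∣m*n p d∣n)))
    (λ e → let c = gcd≡1⁻ k n e in
      gcd≡1 k (p * n) (coprime-sym (coprime-* (λ (d∣p , d∣k) → c (d∣k , ∣-trans d∣p p∣n)) (coprime-sym c))))

∑-multiples-≡ : ∀ {p} → 1 ≤ p → ∀ n (F : ℕ → ℕ) →
  ∑ (range1 (p * n)) (λ e → ind (p ∣? e) * F e) ≡ ∑ (range1 n) (λ b → F (p * b))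
∑-multiples-≡ {p} 1≤p n F = trans (sym (∑-filter (p ∣?_) (range1 (p * n)) F))
  (trans (∑-≈ F (Unique.filter⁺ (p ∣?_) (range1-unique (p * n)))
               (Unique.map⁺ (λ {x} {y} → *-cancelˡ-≡ x y p {{p≢0}}) (range1-unique n)) sub sup)
         (∑-map (p *_) (range1 n) F))
  where
  p≢0 : NonZero p
  p≢0 = >-nonZero 1≤p
  sub : filter (p ∣?_) (range1 (p * n)) ⊆′ map (p *_) (range1 n)
  sub q with ∈-filter⁻ (p ∣?_) {xs = range1 (p * n)} q
  ... | e∈ , divides b refl with ∈-range1⁻ e∈
  ... | 1≤e , e≤ = subst (_∈ map (p *_) (range1 n)) (*-comm p b)
          (∈-map⁺ (p *_) (∈-range1⁺ (1≤*⇒1≤ˡ b 1≤e) (*-cancelˡ-≤ p {{p≢0}} (subst (_≤ p * n) (*-comm b p) e≤))))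
  sup : map (p *_) (range1 n) ⊆′ filter (p ∣?_) (range1 (p * n))
  sup q with ∈-map⁻ (p *_) q
  ... | b , b∈ , refl with ∈-range1⁻ b∈
  ... | 1≤b , b≤n = ∈-filter⁺ (p ∣?_) (∈-range1⁺ (1≤* 1≤p 1≤b) (*-monoʳ-≤ p b≤n)) (m∣m*n b)

-- Of the p φ(n) integers up to p n that are coprime to n, those divisible by p are the p j with j ≤
-- n coprime to n, and there are φ(n) of them. The summand φ(n) is carried on both sides to avoid
-- subtraction.
φ-prime-∤ : ∀ {p n} → Prime p → ¬ p ∣ n → φ (p * n) ≡ (p ∸ 1) * φ n
φ-prime-∤ {p} {n} pp p∤n = +-cancelʳ-≡ (φ n) (φ (p * n)) ((p ∸ 1) * φ n) (begin
  φ (p * n) + φ n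
    ≡⟨ cong₂ _+_ (φ≡copIn (p * n)) (trans (φ≡copIn n) (∑-cong (range1 n) (λ {j} _ → coprimeIgnores j))) ⟩
  copIn (p * n) (p * n) + ∑ (range1 n) (λ j → ind (gcd (p * j) n ≟ 1))
    ≡⟨ cong (copIn (p * n) (p * n) +_) (∑-multiples-≡ (prime⇒1≤ pp) n (λ k → ind (gcd k n ≟ 1))) ⟨
  copIn (p * n) (p * n) + ∑ (range1 (p * n)) (λ k → ind (p ∣? k) * ind (gcd k n ≟ 1))
    ≡⟨ ∑-+ (range1 (p * n)) _ _ ⟨
  ∑ (range1 (p * n)) (λ k → ind (gcd k (p * n) ≟ 1) + ind (p ∣? k) * ind (gcd k n ≟ 1))
    ≡⟨ ∑-cong (range1 (p * n)) (λ {k} _ → split k) ⟩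
  copIn (p * n) n
    ≡⟨ copIn-multiple p n ⟩
  p * φ n
    ≡⟨ cong (_* φ n) (m∸n+n≡m (prime⇒1≤ pp)) ⟨
  (p ∸ 1 + 1) * φ n
    ≡⟨ trans (*-distribʳ-+ (φ n) (p ∸ 1) 1) (cong ((p ∸ 1) * φ n +_) (+-identityʳ (φ n))) ⟩
  (p ∸ 1) * φ n + φ n ∎)
  where
  open ≡-Reasoning
  cpn : Coprime p n
  cpn = prime∤⇒coprime pp p∤n
  coprimeIgnores : ∀ j → ind (gcd j n ≟ 1) ≡ ind (gcd (p * j) n ≟ 1)
  coprimeIgnores j = ind-⇔ (gcd j n ≟ 1) (gcd (p * j) n ≟ 1)
    (λ e → gcd≡1 (p * j) n (coprime-* cpn (gcd≡1⁻ j n e)))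
    (λ e → gcd≡1 j n (λ (d∣j , d∣n) → gcd≡1⁻ (p * j) n e (∣n⇒∣m*n p d∣j , d∣n)))
  split : ∀ k → ind (gcd k (p * n) ≟ 1) + ind (p ∣? k) * ind (gcd k n ≟ 1) ≡ ind (gcd k n ≟ 1)
  split k with p ∣? k
  ... | yes p∣k = trans (cong (_+ (ind (gcd k n ≟ 1) + 0)) (ind-false (gcd k (p * n) ≟ 1)
                    (λ e → <⇒≢ (prime⇒1< pp) (sym (gcd≡1⁻ k (p * n) e (p∣k , m∣m*n n)))))) (+-identityʳ _)
  ... | no p∤k = trans (+-identityʳ _) (ind-⇔ (gcd k (p * n) ≟ 1) (gcd k n ≟ 1)
    (λ e → gcd≡1 k n (λ (d∣k , d∣n) → gcd≡1⁻ k (p * n) e (d∣k , ∣n⇒∣m*n p d∣n)))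
    (λ e → gcd≡1 k (p * n) (coprime-sym (coprime-* (prime∤⇒coprime pp p∤k) (coprime-sym (gcd≡1⁻ k n e))))))

φ-primePower-* : ∀ {p m} a → Prime p → ¬ p ∣ m → φ (p ^ suc a * m) ≡ p ^ a * ((p ∸ 1) * φ m)
φ-primePower-* {p} {m} zero pp p∤m = trans (cong (λ q → φ (q * m)) (*-identityʳ p))
  (trans (φ-prime-∤ pp p∤m) (sym (+-identityʳ _)))
φ-primePower-* {p} {m} (suc a) pp p∤m = begin
  φ (p * p ^ suc a * m) ≡⟨ cong φ (*-assoc p (p ^ suc a) m) ⟩
  φ (p * (p ^ suc a * m)) ≡⟨ φ-prime-∣ {p} {p ^ suc a * m} (∣m⇒∣m*n m (m∣m*n (p ^ a))) ⟩
  p * φ (p ^ suc a * m) ≡⟨ cong (p *_) (φ-primePower-* a pp p∤m) ⟩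
  p * (p ^ a * ((p ∸ 1) * φ m)) ≡⟨ *-assoc p (p ^ a) _ ⟨
  p * p ^ a * ((p ∸ 1) * φ m) ∎
  where open ≡-Reasoning

∏ : List (ℕ × ℕ) → (ℕ → ℕ → ℕ) → ℕ
∏ [] h = 1
∏ ((p , a) ∷ l) h = h p a * ∏ l h

φ∣ : ∀ {n l} → Factored n l → φ n ∣ n * ∏ l (λ p _ → p ∸ 1)
φ∣ one = ∣-refl
φ∣ (mul {p} {a} {m} {l} pp p∤m f) = subst₂ _∣_ (sym (φ-primePower-* a pp p∤m)) (rearrange (p ^ a) (p ∸ 1) p m _)
  (*-pres-∣ (n∣m*n p {p ^ a}) (*-monoʳ-∣ (p ∸ 1) (φ∣ f)))
  where
  rearrange : ∀ q r p m x → p * q * (r * (m * x)) ≡ p * q * m * (r * x)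
  rearrange = solve-∀

pred∣φ : ∀ {n l p a} → Factored n l → (p , a) ∈ l → p ∸ 1 ∣ φ n
pred∣φ (mul {p} {a} {m} pp p∤m f) (here refl) = subst (p ∸ 1 ∣_) (sym (φ-primePower-* a pp p∤m)) (∣n⇒∣m*n (p ^ a) (m∣m*n (φ m)))
pred∣φ (mul {p} {a} {m} pp p∤m f) (there q) = subst (_ ∣_) (sym (φ-primePower-* a pp p∤m)) (∣n⇒∣m*n (p ^ a) (∣n⇒∣m*n (p ∸ 1) (pred∣φ f q)))

φ≤ : ∀ n → φ n ≤ n
φ≤ n = ≤-trans (length-filter (λ k → gcd k n ≟ 1) (range1 n)) (≤-reflexive (length-range1 n))

φ≥1 : ∀ {n} → 1 ≤ n → 1 ≤ φ n
φ≥1 {n} 1≤n = length-⊆ {xs = 1 ∷ []} ([] ∷ [])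
  λ { (here refl) → ∈-filter⁺ (λ k → gcd k n ≟ 1) (∈-range1⁺ ≤-refl 1≤n) (gcd≡1 1 n (λ (d∣1 , _) → ∣1⇒≡1 d∣1)) }

-- geom p a = 1 + p + … + p ^ a = σ(p ^ a) for p prime
geom : ℕ → ℕ → ℕ
geom p zero  = 1
geom p (suc a) = suc (p * geom p a)

sum≡∑ : ∀ xs → sum xs ≡ ∑ xs id
sum≡∑ []  = refl
sum≡∑ (x ∷ xs) = cong (x +_) (sum≡∑ xs)

-- The divisors of p n that p divides are the p d with d a divisor of n = p ^ a m; the others are
-- coprime to p and are exactly the divisors of m.
σ-step : ∀ {p m} a → Prime p → ¬ p ∣ m → 1 ≤ m → σ (p * (p ^ a * m)) ≡ p * σ (p ^ a * m) + σ m
σ-step {p} {m} a pp p∤m 1≤m = begin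
  σ (p * n) ≡⟨ sum≡∑ (divisors (p * n)) ⟩
  ∑ (divisors (p * n)) id ≡⟨ ∑-≈ id (divisors-unique (p * n)) unique sub sup ⟩
  ∑ (map (p *_) (divisors n) ++ divisors m) id ≡⟨ ∑-++ (map (p *_) (divisors n)) (divisors m) id ⟩
  ∑ (map (p *_) (divisors n)) id + ∑ (divisors m) id ≡⟨ cong₂ _+_ (trans (∑-map (p *_) (divisors n) id) (∑-*ˡ (divisors n) p id)) (sym (sum≡∑ (divisors m))) ⟩
  p * ∑ (divisors n) id + σ m ≡⟨ cong (λ s → p * s + σ m) (sum≡∑ (divisors n)) ⟨
  p * σ n + σ m ∎
  where
  open ≡-Reasoning
  n = p ^ a * m
  p≢0 : NonZero p
  p≢0 = prime⇒nonZero pp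
  1≤n : 1 ≤ n
  1≤n = 1≤* (m^n>0 p {{p≢0}} a) 1≤m
  1≤pn : 1 ≤ p * n
  1≤pn = 1≤* (prime⇒1≤ pp) 1≤n
  unique : Unique (map (p *_) (divisors n) ++ divisors m)
  unique = Unique.++⁺ (Unique.map⁺ (λ {x} {y} → *-cancelˡ-≡ x y p {{p≢0}}) (divisors-unique n)) (divisors-unique m)
    (λ (q , r) → case ∈-map⁻ (p *_) q of λ { (d , _ , refl) → p∤m (∣-trans (m∣m*n d) (proj₂ (∈-divisors⁻ {n = m} r))) })
  sub : divisors (p * n) ⊆′ map (p *_) (divisors n) ++ divisors m
  sub {d} q with ∈-divisors⁻ {n = p * n} q
  ... | 1≤d , d∣pn with p ∣? d
  ... | yes (divides e refl) = ∈-++⁺ˡ (subst (_∈ map (p *_) (divisors n)) (*-comm p e)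
            (∈-map⁺ (p *_) (∈-divisors⁺ 1≤n (*-cancelˡ-∣ p {{p≢0}} (subst (_∣ p * n) (*-comm e p) d∣pn)))))
  ... | no p∤d = ∈-++⁺ʳ (map (p *_) (divisors n)) (∈-divisors⁺ 1≤m
            (coprime-divisor (coprime-sym (coprime-^ (suc a) (prime∤⇒coprime pp p∤d))) (subst (d ∣_) (sym (*-assoc p (p ^ a) m)) d∣pn)))
  sup : map (p *_) (divisors n) ++ divisors m ⊆′ divisors (p * n)
  sup q with ∈-++⁻ (map (p *_) (divisors n)) q
  ... | inj₂ r = ∈-divisors⁺ 1≤pn (∣n⇒∣m*n p (∣n⇒∣m*n (p ^ a) (proj₂ (∈-divisors⁻ {n = m} r))))
  ... | inj₁ r with ∈-map⁻ (p *_) r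
  ... | d , d∈ , refl = ∈-divisors⁺ 1≤pn (*-monoʳ-∣ p (proj₂ (∈-divisors⁻ {n = n} d∈)))

σ-primePower-* : ∀ {p m} a → Prime p → ¬ p ∣ m → 1 ≤ m → σ (p ^ a * m) ≡ geom p a * σ m
σ-primePower-* {p} {m} zero pp p∤m 1≤m = trans (cong σ (+-identityʳ m)) (sym (+-identityʳ _))
σ-primePower-* {p} {m} (suc a) pp p∤m 1≤m = begin
  σ (p * p ^ a * m) ≡⟨ cong σ (*-assoc p (p ^ a) m) ⟩
  σ (p * (p ^ a * m)) ≡⟨ σ-step a pp p∤m 1≤m ⟩
  p * σ (p ^ a * m) + σ m ≡⟨ cong (λ s → p * s + σ m) (σ-primePower-* a pp p∤m 1≤m) ⟩
  p * (geom p a * σ m) + σ m ≡⟨ trans (+-comm _ (σ m)) (cong (σ m +_) (sym (*-assoc p (geom p a) (σ m)))) ⟩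
  geom p (suc a) * σ m ∎
  where open ≡-Reasoning

factored≥1 : ∀ {n l} → Factored n l → 1 ≤ n
factored≥1 one = ≤-refl
factored≥1 (mul {p} {a} pp _ f) = 1≤* (m^n>0 p {{prime⇒nonZero pp}} (suc a)) (factored≥1 f)

σ≡∏ : ∀ {n l} → Factored n l → σ n ≡ ∏ l geom
σ≡∏ one = refl
σ≡∏ (mul {p} {a} pp p∤m f) = trans (σ-primePower-* (suc a) pp p∤m (factored≥1 f)) (cong (geom p (suc a) *_) (σ≡∏ f))

-- The strict form is what the induction carries. It makes the local factor of σ at most 2 p ^ a,
-- the source of the 2 * x in the lists of multiples further on.
geom≤ : ∀ {p} → 2 ≤ p → ∀ a → suc (geom p a) ≤ 2 * p ^ a
geom≤ 2≤p zero = ≤-refl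
geom≤ {p} 2≤p (suc a) = +-cancelʳ-≤ p _ _ (begin
  suc (suc (p * geom p a)) + p ≡⟨ lhs p (geom p a) ⟩
  2 + p * suc (geom p a) ≤⟨ +-mono-≤ 2≤p (*-monoʳ-≤ p (geom≤ 2≤p a)) ⟩
  p + p * (2 * p ^ a) ≡⟨ rhs p (p ^ a) ⟩
  2 * (p * p ^ a) + p ∎)
  where
  open ≤-Reasoning
  lhs : ∀ p g → suc (suc (p * g)) + p ≡ 2 + p * suc g
  lhs = solve-∀
  rhs : ∀ p q → p + p * (2 * q) ≡ 2 * (p * q) + p
  rhs = solve-∀

geom≥1 : ∀ p a → 1 ≤ geom p a
geom≥1 p zero  = ≤-refl
geom≥1 p (suc a) = s≤s z≤n

geom-monoˡ-≤ : ∀ {p q} a → p ≤ q → geom p a ≤ geom q a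
geom-monoˡ-≤ zero le = ≤-refl
geom-monoˡ-≤ (suc a) le = s≤s (*-mono-≤ le (geom-monoˡ-≤ a le))

geom-monoˡ-< : ∀ {p q} a → p < q → geom p (suc a) < geom q (suc a)
geom-monoˡ-< {p} {q} a lt = s≤s (<-≤-trans (*-monoˡ-< (geom p a) {{>-nonZero (geom≥1 p a)}} lt) (*-monoʳ-≤ q (geom-monoˡ-≤ a (<⇒≤ lt))))

geom-injectiveˡ : ∀ {p q} a → geom p (suc a) ≡ geom q (suc a) → p ≡ q
geom-injectiveˡ {p} {q} a eq with <-cmp p q
... | tri< lt _ _ = contradiction eq (<⇒≢ (geom-monoˡ-< a lt))
... | tri≈ _ e _  = e
... | tri> _ _ gt = contradiction (sym eq) (<⇒≢ (geom-monoˡ-< a gt))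

p≤geom : ∀ p a → p ≤ geom p (suc a)
p≤geom p a = ≤-trans (m≤m*n p (geom p a) {{>-nonZero (geom≥1 p a)}}) (n≤1+n _)

σ≥1 : ∀ {n} → 1 ≤ n → 1 ≤ σ n
σ≥1 {n} 1≤n = subst (1 ≤_) (sym (sum≡∑ (divisors n))) (∑-⊆ {xs = 1 ∷ []} id ([] ∷ []) λ { (here refl) → ∈-divisors⁺ 1≤n (1∣ n) })

-- Passing to complementary divisors writes σ(n) as the sum of n / d over the divisors d, a part of
-- the harmonic sum.
σ≤ : ∀ {n k} → 1 ≤ n → n ≤ 2 ^ k → σ n ≤ n * suc k
σ≤ {n} {k} 1≤n n≤ = begin
  σ n ≡⟨ sum≡∑ (divisors n) ⟩
  ∑ (divisors n) id ≤⟨ ∑-⊆ id (divisors-unique n) sub ⟩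
  ∑ (map (n ÷_) (divisors n)) id ≡⟨ ∑-map (n ÷_) (divisors n) id ⟩
  ∑ (divisors n) (n ÷_) ≤⟨ ∑-⊆ (n ÷_) (divisors-unique n) (λ p → proj₁ (∈-filter⁻ (λ d → d ∣? n) {xs = range1 n} p)) ⟩
  ∑ (range1 n) (n ÷_) ≤⟨ harmonic n n≤ ⟩
  n * suc k ∎
  where
  open ≤-Reasoning
  sub : divisors n ⊆′ map (n ÷_) (divisors n)
  sub {d} p with ∈-divisors⁻ {n = n} p
  ... | 1≤d , divides e eq = subst (_∈ map (n ÷_) (divisors n)) n÷e≡d
          (∈-map⁺ (n ÷_) (∈-divisors⁺ 1≤n (divides d (trans eq (*-comm e d)))))
    where
    1≤e : 1 ≤ e
    1≤e = 1≤*⇒1≤ˡ e (subst (1 ≤_) eq 1≤n)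
    n÷e≡d : n ÷ e ≡ d
    n÷e≡d = ≤-antisym
      (*-cancelʳ-≤ (n ÷ e) d e {{>-nonZero 1≤e}} (subst (n ÷ e * e ≤_) (trans eq (*-comm e d)) (÷-* n e)))
      (÷-greatest 1≤e (≤-reflexive (trans (*-comm d e) (sym eq))))

-- Carmichael's function

Cong : (n : ℕ) → .{{_ : NonZero n}} → ℕ → ℕ → Set
Cong n a b = a % n ≡ b % n

module _ {n : ℕ} .{{_ : NonZero n}} where

  cong-* : ∀ {a b c d} → Cong n a b → Cong n c d → Cong n (a * c) (b * d)
  cong-* {a} {b} {c} {d} p q = trans (%-distribˡ-* a c n) (trans (cong₂ (λ x y → (x * y) % n) p q) (sym (%-distribˡ-* b d n)))

  cong-^ : ∀ {a b} m → Cong n a b → Cong n (a ^ m) (b ^ m)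
  cong-^ zero p = refl
  cong-^ {a} {b} (suc m) p = cong-* {a} {b} {a ^ m} {b ^ m} p (cong-^ m p)

  cong-+⇒∣ : ∀ {a d} → Cong n a (a + d) → n ∣ d
  cong-+⇒∣ {a} {d} p = ∣m+n∣m⇒∣n {n} {a / n * n} {d} (divides ((a + d) / n) (+-cancelˡ-≡ (a % n) _ _ (begin
    a % n + (a / n * n + d) ≡⟨ +-assoc (a % n) _ d ⟨
    a % n + a / n * n + d ≡⟨ cong (_+ d) (m≡m%n+[m/n]*n a n) ⟨
    a + d ≡⟨ m≡m%n+[m/n]*n (a + d) n ⟩
    (a + d) % n + (a + d) / n * n ≡⟨ cong (_+ (a + d) / n * n) p ⟨
    a % n + (a + d) / n * n ∎))) (n∣m*n (a / n))
    where open ≡-Reasoning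

  ∣⇒cong-+ : ∀ a {d} → n ∣ d → Cong n a (a + d)
  ∣⇒cong-+ a n∣d = sym (%-remove-+ʳ a n∣d)

  private
    cong-cancel-≤ : ∀ c {a b} → Coprime c n → a ≤ b → Cong n (c * a) (c * b) → Cong n a b
    cong-cancel-≤ c {a} cop a≤b p with m≤n⇒∃[o]m+o≡n a≤b
    ... | d , refl = ∣⇒cong-+ a (coprime-divisor (coprime-sym cop)
                       (cong-+⇒∣ (trans p (cong (_% n) (*-distribˡ-+ c a d)))))

  cong-cancelˡ : ∀ c {a b} → Coprime c n → Cong n (c * a) (c * b) → Cong n a b
  cong-cancelˡ c {a} {b} cop p with ≤-total a b
  ... | inj₁ a≤b = cong-cancel-≤ c cop a≤b p
  ... | inj₂ b≤a = sym (cong-cancel-≤ c cop b≤a (sym p))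

  cong⇒coprime : ∀ {a b} → Cong n a b → Coprime a n → Coprime b n
  cong⇒coprime {a} {b} p c {d} (d∣b , d∣n) =
    c (∣n∣m%n⇒∣m {n} d∣n (subst (d ∣_) (sym p) (%-presˡ-∣ d∣b d∣n)) , d∣n)

  -- The representative modulo n lies in {1, …, n}, like the arguments tested by killsUnits.
  residue : ℕ → ℕ
  residue a with a % n
  ... | zero  = n
  ... | suc r = suc r

  residue-cong : ∀ a → Cong n (residue a) a
  residue-cong a with a % n in eq
  ... | zero  = n%n≡0 n
  ... | suc r = m<n⇒m%n≡m (subst (_< n) eq (m%n<n a n))

  residue∈ : ∀ a → residue a ∈ range1 n
  residue∈ a with a % n in eq
  ... | zero  = ∈-range1⁺ (>-nonZero⁻¹ n) ≤-refl
  ... | suc r = ∈-range1⁺ (s≤s z≤n) (<⇒≤ (subst (_< n) eq (m%n<n a n)))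

  private
    cong⇒≡-≤ : ∀ {u v} → u ∈ range1 n → v ∈ range1 n → u ≤ v → Cong n u v → u ≡ v
    cong⇒≡-≤ {u} u∈ v∈ le p with m≤n⇒∃[o]m+o≡n le
    ... | zero  , refl = sym (+-identityʳ u)
    ... | suc d , refl = contradiction (≤-trans (≤-trans (+-monoˡ-≤ (suc d) (proj₁ (∈-range1⁻ u∈))) (proj₂ (∈-range1⁻ v∈)))
                           (∣⇒≤ (cong-+⇒∣ {u} p))) (<-irrefl refl)

  cong⇒≡ : ∀ {u v} → u ∈ range1 n → v ∈ range1 n → Cong n u v → u ≡ v
  cong⇒≡ {u} {v} u∈ v∈ p with ≤-total u v
  ... | inj₁ le = cong⇒≡-≤ u∈ v∈ le p
  ... | inj₂ le = sym (cong⇒≡-≤ v∈ u∈ le (sym p))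

coprimes : ℕ → List ℕ
coprimes n = filter (λ k → gcd k n ≟ 1) (range1 n)

map-unique : ∀ {a b} {A : Set a} {B : Set b} (f : A → B) {xs} →
  (∀ {x y} → x ∈ xs → y ∈ xs → f x ≡ f y → x ≡ y) → Unique xs → Unique (map f xs)
map-unique f {[]} inj []  = []
map-unique f {x ∷ xs} inj (nx ∷ u) = All.tabulate distinct ∷ map-unique f (λ p q → inj (there p) (there q)) u
  where
  distinct : ∀ {y} → y ∈ map f xs → f x ≢ y
  distinct y∈ eq with ∈-map⁻ f y∈
  ... | z , z∈ , refl = All≢⇒∉ nx (subst (_∈ xs) (sym (inj (here refl) (there z∈) eq)) z∈)

product-coprime : ∀ {xs n} → (∀ {x} → x ∈ xs → Coprime x n) → Coprime (product xs) n
product-coprime {[]} h (d∣1 , _) = ∣1⇒≡1 d∣1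
product-coprime {x ∷ xs} h = coprime-* (h (here refl)) (product-coprime {xs} (h ∘ there))

-- Multiplication by the unit a permutes the units, so a ^ φ(n) times their product is congruent to that product.
euler : ∀ n .{{_ : NonZero n}} a → Coprime a n → Cong n (a ^ φ n) 1
euler n a ca = cong-cancelˡ {n} (product U) (product-coprime unit) (begin
  (product U * a ^ φ n) % n ≡⟨ cong (_% n) (*-comm (product U) _) ⟩
  (a ^ φ n * product U) % n ≡⟨ cong-product U ⟨
  product (map f U) % n ≡⟨ cong (_% n) (product-↭ perm) ⟨
  product U % n ≡⟨ cong (_% n) (*-identityʳ (product U)) ⟨
  (product U * 1) % n ∎)
  where
  open ≡-Reasoning
  U = coprimes n
  f : ℕ → ℕ
  f u = residue {n} (a * u)
  unit : ∀ {u} → u ∈ U → Coprime u n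
  unit {u} u∈ = gcd≡1⁻ u n (proj₂ (∈-filter⁻ (λ k → gcd k n ≟ 1) {xs = range1 n} u∈))
  inRange : ∀ {u} → u ∈ U → u ∈ range1 n
  inRange u∈ = proj₁ (∈-filter⁻ (λ k → gcd k n ≟ 1) {xs = range1 n} u∈)
  cong-product : ∀ l → Cong n (product (map f l)) (a ^ length l * product l)
  cong-product []  = refl
  cong-product (u ∷ l) = trans (cong-* {n} {f u} {a * u} (residue-cong {n} (a * u)) (cong-product l))
    (cong (_% n) (rearrange a u (a ^ length l) (product l)))
    where
    rearrange : ∀ a u x y → a * u * (x * y) ≡ a * x * (u * y)
    rearrange = solve-∀
  U-unique : Unique U
  U-unique = Unique.filter⁺ (λ k → gcd k n ≟ 1) (range1-unique n)
  closed : map f U ⊆′ U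
  closed y∈ with ∈-map⁻ f y∈
  ... | u , u∈ , refl = ∈-filter⁺ (λ k → gcd k n ≟ 1) (residue∈ {n} (a * u))
          (gcd≡1 (f u) n (cong⇒coprime {n} {a * u} (sym (residue-cong {n} (a * u))) (coprime-* ca (unit u∈))))
  injective : ∀ {u v} → u ∈ U → v ∈ U → f u ≡ f v → u ≡ v
  injective {u} {v} u∈ v∈ eq = cong⇒≡ {n} (inRange u∈) (inRange v∈) (cong-cancelˡ {n} a ca
    (trans (sym (residue-cong {n} (a * u))) (trans (cong (_% n) eq) (residue-cong {n} (a * v)))))
  perm : U ↭ map f U
  perm = ⊆∧length⇒↭ (map-unique f injective U-unique) closed (≤-reflexive (sym (length-map f U)))

-- Quantifies over all units a, whereas `killsUnits` tests representatives in 1, ..., n; `residue`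
-- passes between the two.
KillsUnits : (n : ℕ) → .{{_ : NonZero n}} → ℕ → Set
KillsUnits n m = ∀ a → Coprime a n → Cong n (a ^ m) 1

and-map⁺ : ∀ {a} {A : Set a} (p : A → Bool) {xs} → (∀ {x} → x ∈ xs → p x ≡ true) → and (map p xs) ≡ true
and-map⁺ p {[]} h = refl
and-map⁺ p {x ∷ xs} h rewrite h (here refl) = and-map⁺ p (h ∘ there)

and-map⁻ : ∀ {a} {A : Set a} (p : A → Bool) {xs x} → and (map p xs) ≡ true → x ∈ xs → p x ≡ true
and-map⁻ p {x ∷ xs} h q with p x in eq
and-map⁻ p {x ∷ xs} h (here refl) | true = eq
and-map⁻ p {x ∷ xs} h (there q) | true = and-map⁻ p h q

≡ᵇ-true : ∀ m n → m ≡ n → (m ≡ᵇ n) ≡ true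
≡ᵇ-true m n eq with m ≡ᵇ n | ≡⇒≡ᵇ m n eq
... | true | _ = refl

≡ᵇ-true⁻ : ∀ m n → (m ≡ᵇ n) ≡ true → m ≡ n
≡ᵇ-true⁻ m n eq = ≡ᵇ⇒≡ m n (subst Data.Bool.T (sym eq) tt)

killsUnits⁺ : ∀ n .{{_ : NonZero n}} m → KillsUnits n m → killsUnits n m ≡ true
killsUnits⁺ n m kills = and-map⁺ _ {range1 n} λ {a} _ → test a
  where
  test : ∀ a → (if gcd a n ≡ᵇ 1 then (a ^ m) % n ≡ᵇ 1 % n else true) ≡ true
  test a with gcd a n ≡ᵇ 1 in eq
  ... | false = refl
  ... | true  = ≡ᵇ-true _ _ (kills a (gcd≡1⁻ a n (≡ᵇ-true⁻ _ _ eq)))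

killsUnits⁻ : ∀ n .{{_ : NonZero n}} m → killsUnits n m ≡ true → KillsUnits n m
killsUnits⁻ n m h a ca = trans (cong-^ {n} m (sym (residue-cong {n} a)))
  (test (residue {n} a) (and-map⁻ _ h (residue∈ {n} a)) (cong⇒coprime {n} {a} (sym (residue-cong {n} a)) ca))
  where
  test : ∀ r → (if gcd r n ≡ᵇ 1 then (r ^ m) % n ≡ᵇ 1 % n else true) ≡ true → Coprime r n → Cong n (r ^ m) 1
  test r h cr with gcd r n ≡ᵇ 1 in eq
  ... | true  = ≡ᵇ-true⁻ _ _ h
  ... | false = case trans (sym eq) (≡ᵇ-true _ _ (gcd≡1 r n cr)) of λ ()

firstWith-holds : ∀ p {xs m} → m ∈ xs → p m ≡ true → p (firstWith p xs) ≡ true × firstWith p xs ∈ xs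
firstWith-holds p {x ∷ xs} m∈ pm with p x in eq
... | true = eq , here refl
firstWith-holds p {x ∷ xs} (here refl) pm | false = case trans (sym eq) pm of λ ()
firstWith-holds p {x ∷ xs} (there m∈)  pm | false = let h , q = firstWith-holds p m∈ pm in h , there q

firstWith-least : ∀ p {xs m} → AllPairs _<_ xs → m ∈ xs → p m ≡ true → firstWith p xs ≤ m
firstWith-least p {x ∷ xs} (lt ∷ s) m∈ pm with p x in eq
firstWith-least p {x ∷ xs} (lt ∷ s) (here refl) pm | true  = ≤-refl
firstWith-least p {x ∷ xs} (lt ∷ s) (there m∈)  pm | true  = <⇒≤ (All.lookup lt m∈)
firstWith-least p {x ∷ xs} (lt ∷ s) (here refl) pm | false = case trans (sym eq) pm of λ ()
firstWith-least p {x ∷ xs} (lt ∷ s) (there m∈)  pm | false = firstWith-least p s m∈ pm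

range1-sorted : ∀ n → AllPairs _<_ (range1 n)
range1-sorted n = AllPairs.map⁺ (AllPairs.applyUpTo⁺₁ id n (λ i<j _ → s≤s i<j))

module _ (n : ℕ) where

  private
    -- By Euler's theorem φ(n) passes the test, and it lies in the searched range; hence the search
    -- defining `λC` never falls through to the default 0.
    φ-kills : killsUnits (suc n) (φ (suc n)) ≡ true
    φ-kills = killsUnits⁺ (suc n) (φ (suc n)) (euler (suc n))

    φ∈ : φ (suc n) ∈ range1 (suc n)
    φ∈ = ∈-range1⁺ (φ≥1 {suc n} (s≤s z≤n)) (φ≤ (suc n))

  λC-kills : KillsUnits (suc n) (λC (suc n))
  λC-kills = killsUnits⁻ (suc n) (λC (suc n)) (proj₁ (firstWith-holds (killsUnits (suc n)) φ∈ φ-kills))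

  λC∈ : λC (suc n) ∈ range1 (suc n)
  λC∈ = proj₂ (firstWith-holds (killsUnits (suc n)) φ∈ φ-kills)

  λC-least : ∀ {m} → 1 ≤ m → m ≤ suc n → KillsUnits (suc n) m → λC (suc n) ≤ m
  λC-least {m} 1≤m m≤N kills = firstWith-least (killsUnits (suc n)) (range1-sorted (suc n)) (∈-range1⁺ 1≤m m≤N) (killsUnits⁺ (suc n) m kills)

λC≥1 : ∀ {n} → 1 ≤ n → 1 ≤ λC n
λC≥1 {suc n} _ = proj₁ (∈-range1⁻ (λC∈ n))

cong-^-% : ∀ {n} .{{_ : NonZero n}} {a L} .{{_ : NonZero L}} E →
  Cong n (a ^ E) 1 → Cong n (a ^ L) 1 → Cong n (a ^ (E % L)) 1
cong-^-% {n} {a} {L} E aE aL = begin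
  (a ^ (E % L)) % n ≡⟨ cong (_% n) (*-identityʳ (a ^ (E % L))) ⟨
  (a ^ (E % L) * 1) % n ≡⟨ cong (λ k → (a ^ (E % L) * k) % n) (^-zeroˡ (E / L)) ⟨
  (a ^ (E % L) * 1 ^ (E / L)) % n ≡⟨ cong-* {n} {a ^ (E % L)} refl (cong-^ {n} (E / L) aL) ⟨
  (a ^ (E % L) * (a ^ L) ^ (E / L)) % n ≡⟨ cong (λ k → (a ^ (E % L) * k) % n) (^-*-assoc a L (E / L)) ⟩
  (a ^ (E % L) * a ^ (L * (E / L))) % n ≡⟨ cong (_% n) (^-distribˡ-+-* a (E % L) (L * (E / L))) ⟨
  (a ^ (E % L + L * (E / L))) % n ≡⟨ cong (λ k → (a ^ (E % L + k)) % n) (*-comm L (E / L)) ⟩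
  (a ^ (E % L + E / L * L)) % n ≡⟨ cong (λ k → (a ^ k) % n) (m≡m%n+[m/n]*n E L) ⟨
  (a ^ E) % n ≡⟨ aE ⟩
  1 % n ∎
  where open ≡-Reasoning

-- The remainder of φ(n) modulo λ(n) again kills all units, so the minimality of λ(n) forces it to
-- vanish.
λC∣φ : ∀ {n} → 1 ≤ n → λC n ∣ φ n
λC∣φ {suc n} _ = remainder (φ N % L) refl
  where
  N = suc n
  L = λC N
  instance
    L≢0 : NonZero L
    L≢0 = >-nonZero (λC≥1 {N} (s≤s z≤n))
  remainder : ∀ r → φ N % L ≡ r → L ∣ φ N
  remainder zero eq = m%n≡0⇒n∣m (φ N) L eq
  remainder (suc r) eq = contradiction
    (λC-least n (s≤s z≤n) (<⇒≤ (<-≤-trans r<L (proj₂ (∈-range1⁻ (λC∈ n)))))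
      (λ a ca → subst (λ e → Cong N (a ^ e) 1) eq (cong-^-% {N} (φ N) (euler N a ca) (λC-kills n a ca))))
    (<⇒≱ r<L)
    where
    r<L : suc r < L
    r<L = subst (_< L) eq (m%n<n (φ N) L)

-- The value at x of the monic polynomial of degree |cs| whose lower coefficients are cs.
evalMonic : List ℕ → ℕ → ℕ
evalMonic [] x = 1
evalMonic (c ∷ cs) x = c + x * evalMonic cs x

-- Synthetic division by x - r: the coefficients of the quotient are the values at r of the
-- successive Horner tails.
quotMonic : List ℕ → ℕ → List ℕ
quotMonic [] r = []
quotMonic (c ∷ []) r = []
quotMonic (c ∷ d ∷ cs) r = evalMonic (d ∷ cs) r ∷ quotMonic (d ∷ cs) r

-- The factor theorem, with both sides moved so that no subtraction occurs.
quotMonic-spec : ∀ c cs x r → let q = evalMonic (quotMonic (c ∷ cs) r) x in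
  evalMonic (c ∷ cs) x + r * q ≡ evalMonic (c ∷ cs) r + x * q
quotMonic-spec c [] x r = base c x r
  where
  base : ∀ c x r → c + x * 1 + r * 1 ≡ c + r * 1 + x * 1
  base = solve-∀
quotMonic-spec c (d ∷ cs) x r = begin
  c + x * X + r * (R + x * Q) ≡⟨ lhs c x X r R Q ⟩
  c + r * R + x * (X + r * Q) ≡⟨ cong (λ k → c + r * R + x * k) (quotMonic-spec d cs x r) ⟩
  c + r * R + x * (R + x * Q) ∎
  where
  open ≡-Reasoning
  X = evalMonic (d ∷ cs) x
  R = evalMonic (d ∷ cs) r
  Q = evalMonic (quotMonic (d ∷ cs) r) x
  lhs : ∀ c x X r R Q → c + x * X + r * (R + x * Q) ≡ c + r * R + x * (X + r * Q)
  lhs = solve-∀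

length-quotMonic : ∀ c cs r → length (quotMonic (c ∷ cs) r) ≡ length cs
length-quotMonic c [] r = refl
length-quotMonic c (d ∷ cs) r = cong suc (length-quotMonic d cs r)

-- The roots are listed in increasing order so that each later root is x = r + (1 + d) with 0 < 1 +
-- d < p. Then p divides (1 + d) times the value of the quotient at x, and Euclid's lemma makes x a
-- root of the quotient.
lagrange : ∀ {p} → Prime p → ∀ cs {xs} → AllPairs _<_ xs → (∀ {x} → x ∈ xs → x < p × p ∣ evalMonic cs x) →
  length xs ≤ length cs
lagrange pp cs {[]} _ _ = z≤n
lagrange pp [] {x ∷ xs} _ h = contradiction (proj₂ (h (here refl))) (prime-∤1 pp)
lagrange {p} pp (c ∷ cs) {r ∷ xs} (r<xs ∷ s) h = s≤s (subst (length xs ≤_) (length-quotMonic c cs r)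
  (lagrange pp (quotMonic (c ∷ cs) r) s root))
  where
  root : ∀ {x} → x ∈ xs → x < p × p ∣ evalMonic (quotMonic (c ∷ cs) r) x
  root {x} x∈ with m≤n⇒∃[o]m+o≡n (All.lookup r<xs x∈) | h (there x∈) | quotMonic-spec c cs x r
  ... | d , refl | x<p , p∣x | spec =
    x<p , [ (λ p∣d → contradiction (∣⇒≤ p∣d) (<⇒≱ (≤-<-trans (s≤s (m≤n+m d r)) x<p))) , id ]′
            (euclidsLemma (suc d) q pp (∣m+n∣m⇒∣n {p} {evalMonic (c ∷ cs) r} (subst (p ∣_) eq p∣x) (proj₂ (h (here refl)))))
    where
    q = evalMonic (quotMonic (c ∷ cs) r) x
    eq : evalMonic (c ∷ cs) x ≡ evalMonic (c ∷ cs) r + suc d * q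
    eq = +-cancelʳ-≡ (r * q) _ _ (trans spec (rearrange (evalMonic (c ∷ cs) r) r d q))
      where
      rearrange : ∀ v r d q → v + suc (r + d) * q ≡ v + suc d * q + r * q
      rearrange = solve-∀

evalMonic-0s : ∀ k x → evalMonic (replicate k 0) x ≡ x ^ k
evalMonic-0s zero x = refl
evalMonic-0s (suc k) x = cong (x *_) (evalMonic-0s k x)

φ-prime : ∀ {p} → Prime p → φ p ≡ p ∸ 1
φ-prime {p} pp = trans (cong φ (sym (*-identityʳ p))) (trans (φ-prime-∤ pp (prime-∤1 pp)) (*-identityʳ (p ∸ 1)))

<prime⇒∤ : ∀ {p a} → 1 ≤ a → a < p → ¬ p ∣ a
<prime⇒∤ {a = suc a} _ lt p∣a = <⇒≱ lt (∣⇒≤ p∣a)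

-- Let r be the remainder of E modulo p - 1. With Fermat's theorem all p - 1 nonzero residues are
-- roots of x ^ r - 1, which for r > 0 are more than its degree r.
pred∣exponent : ∀ {p} → (pp : Prime p) → ∀ E →
  (∀ a → 1 ≤ a → a < p → Cong p {{prime⇒nonZero pp}} (a ^ E) 1) → p ∸ 1 ∣ E
pred∣exponent {zero} pp = contradiction (prime⇒1< pp) λ ()
pred∣exponent {suc zero} pp = contradiction (prime⇒1< pp) λ { (s≤s ()) }
pred∣exponent {p@(suc (suc p′))} pp E h = remainder (E % suc p′) refl
  where
  p-1 = suc p′
  remainder : ∀ r → E % p-1 ≡ r → p-1 ∣ E
  remainder zero eq = m%n≡0⇒n∣m E p-1 eq
  remainder (suc r) eq = contradiction (begin
    p-1 ≡⟨ length-range1 p-1 ⟨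
    -- The coefficient list encodes (p - 1) + x ^ (r + 1); the constant p - 1 stands for -1 modulo
    -- p.
    length (range1 p-1) ≤⟨ lagrange pp (p-1 ∷ replicate r 0) (range1-sorted p-1) root ⟩
    suc (length (replicate r 0)) ≡⟨ cong suc (length-replicate r) ⟩
    suc r ∎) (<⇒≱ (subst (_< p-1) eq (m%n<n E p-1)))
    where
    open ≤-Reasoning
    root : ∀ {x} → x ∈ range1 p-1 → x < p × p ∣ evalMonic (p-1 ∷ replicate r 0) x
    root {x} x∈ = s≤s (proj₂ (∈-range1⁻ x∈)) ,
      subst (p ∣_) (trans (sum-eq p-1 (x ^ suc r / p)) (cong (p-1 +_) (trans (sym x^≡) (cong (x *_) (sym (evalMonic-0s r x))))))
        (∣m∣n⇒∣m+n (∣-refl {p}) (n∣m*n (x ^ suc r / p)))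
      where
      x<p : x < p
      x<p = s≤s (proj₂ (∈-range1⁻ x∈))
      1≤x : 1 ≤ x
      1≤x = proj₁ (∈-range1⁻ x∈)
      fermat : Cong p (x ^ p-1) 1
      fermat = subst (λ e → Cong p (x ^ e) 1) (φ-prime pp) (euler p x (coprime-sym (prime∤⇒coprime pp (<prime⇒∤ 1≤x x<p))))
      x^r : Cong p (x ^ suc r) 1
      x^r = subst (λ e → Cong p (x ^ e) 1) eq (cong-^-% {p} {L = p-1} E (h x 1≤x x<p) fermat)
      x^≡ : x ^ suc r ≡ 1 + x ^ suc r / p * p
      x^≡ = trans (m≡m%n+[m/n]*n (x ^ suc r) p) (cong (_+ x ^ suc r / p * p) x^r)
      sum-eq : ∀ k q → suc k + q * suc k ≡ k + (1 + q * suc k)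
      sum-eq = solve-∀

coprime-*+1 : ∀ m t {x} → x ≡ m * t + 1 → Coprime x m
coprime-*+1 m t {x} eq {e} (e∣x , e∣m) = ∣1⇒≡1 (∣m+n∣m⇒∣n (subst (e ∣_) eq e∣x) (∣m⇒∣m*n t e∣m))

-- A unit modulo p lifts to a unit modulo p ^ k * m, congruent to 1 modulo m.
lift-unit : ∀ {p m} (pp : Prime p) → ¬ p ∣ m → 1 ≤ m → ∀ k a → 1 ≤ a → a < p →
  ∃[ a′ ] Cong p {{prime⇒nonZero pp}} a′ a × Coprime a′ (p ^ k * m)
lift-unit {p} {suc m} pp p∤m _ k (suc a) _ a<p =
  a′ , sym (∣⇒cong-+ {p} {{prime⇒nonZero pp}} (suc a) p∣) ,
  coprime-sym (coprime-* (coprime-^ k (prime∤⇒coprime pp p∤a′)) (coprime-sym cop-m))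
  where
  M = suc m
  -- By Euler c is 1 modulo M and it is 0 modulo p. The bound a of this clause is one less than the
  -- unit being lifted, and m stands for -1 modulo M = m + 1, so a′ is congruent to (a + 1) - a = 1
  -- modulo M.
  c = p ^ φ M
  a′ = suc a + c * (m * a)
  p∣c : ∀ e → 1 ≤ e → p ∣ p ^ e
  p∣c (suc e) _ = m∣m*n (p ^ e)
  p∣ : p ∣ c * (m * a)
  p∣ = ∣m⇒∣m*n (m * a) (p∣c (φ M) (φ≥1 {M} (s≤s z≤n)))
  p∤a′ : ¬ p ∣ a′
  p∤a′ p∣a′ = <prime⇒∤ {p} {suc a} (s≤s z≤n) a<p (∣m+n∣m⇒∣n (subst (p ∣_) (+-comm (suc a) _) p∣a′) p∣)
  cop-m : Coprime a′ M
  cop-m with m≤n⇒∃[o]m+o≡n (m^n>0 p {{prime⇒nonZero pp}} (φ M))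
  ... | d , 1+d≡c with cong-+⇒∣ {M} {1} {d} (trans (sym (euler M p (prime∤⇒coprime pp p∤m))) (cong (_% M) (sym 1+d≡c)))
  ... | divides q d≡ = coprime-*+1 M (a + q * m * a) a′≡
    where
    expand : ∀ a q m → suc a + suc (q * suc m) * (m * a) ≡ suc m * (a + q * m * a) + 1
    expand = solve-∀
    a′≡ : a′ ≡ M * (a + q * m * a) + 1
    a′≡ = trans (cong (λ c → suc a + c * (m * a)) (trans (sym 1+d≡c) (cong suc d≡))) (expand a q m)

-- Every unit modulo p lifts to a unit modulo n, which the exponent λ(n) kills; reducing modulo p
-- shows that λ(n) kills all units modulo p.
pred∣λC : ∀ {p n} → Prime p → 1 ≤ n → p ∣ n → p ∸ 1 ∣ λC n
pred∣λC {p} {suc n} pp 1≤n p∣n with splitPower (prime⇒1< pp) (suc n) 1≤n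
... | k , m , eq , p∤m = pred∣exponent pp (λC (suc n)) kills
  where
  instance
    p≢0 : NonZero p
    p≢0 = prime⇒nonZero pp
  kills : ∀ a → 1 ≤ a → a < p → Cong p (a ^ λC (suc n)) 1
  kills a 1≤a a<p with lift-unit pp p∤m (1≤*⇒1≤ʳ (p ^ k) (subst (1 ≤_) eq 1≤n)) k a 1≤a a<p
  ... | a′ , a′≋a , ca′ = trans (cong-^ {p} (λC (suc n)) (sym a′≋a)) (begin
    (a′ ^ L) % p ≡⟨ m∣n⇒o%n%m≡o%m p (suc n) (a′ ^ L) p∣n ⟨
    (a′ ^ L) % suc n % p ≡⟨ cong (_% p) (λC-kills n a′ (subst (Coprime a′) (sym eq) ca′)) ⟩
    1 % suc n % p ≡⟨ m∣n⇒o%n%m≡o%m p (suc n) 1 p∣n ⟩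
    1 % p ∎)
    where
    open ≡-Reasoning
    L = λC (suc n)

-- Recovering n from f(n)

-- For `phi` and `lam` the power of p contributed by p ^ a is left out: it already divides n, p ∸ 1
-- alone determines p, and for λ the full p ^ (a - 1) (p - 1) need not divide the value when p = 2.
local : Basic → ℕ → ℕ → ℕ
local phi p a = p ∸ 1
local sigma p a = geom p a
local lam p a = p ∸ 1

-- Recovers p from a and local f p a.
base : Basic → ℕ → ℕ → ℕ
base phi a e = suc e
base sigma a e = firstWith (λ q → geom q a ≡ᵇ e) (range1 e)
base lam a e = suc e

base-h : ∀ f {p} a → Prime p → base f (suc a) (local f p (suc a)) ≡ p
base-h phi a pp = m+[n∸m]≡n (prime⇒1≤ pp)
base-h lam a pp = m+[n∸m]≡n (prime⇒1≤ pp)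
base-h sigma {p} a pp = geom-injectiveˡ a (≡ᵇ-true⁻ _ _ (proj₁
  (firstWith-holds (λ q → geom q (suc a) ≡ᵇ geom p (suc a)) (∈-range1⁺ (prime⇒1≤ pp) (p≤geom p a)) (≡ᵇ-true (geom p (suc a)) _ refl))))

p≤p^1+a : ∀ {p} a → 1 ≤ p → p ≤ p ^ suc a
p≤p^1+a {p} a 1≤p = m≤m*n p (p ^ a) {{m^n≢0 p a {{>-nonZero 1≤p}}}}

h≤ : ∀ f {p} a → Prime p → local f p (suc a) ≤ 2 * p ^ suc a
h≤ phi {p} a pp = ≤-trans (m∸n≤m p 1) (≤-trans (p≤p^1+a a (prime⇒1≤ pp)) (m≤n*m _ 2))
h≤ lam {p} a pp = h≤ phi a pp
h≤ sigma {p} a pp = <⇒≤ (geom≤ (prime⇒1< pp) (suc a))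

h≥1 : ∀ f {p} a → Prime p → 1 ≤ local f p a
h≥1 phi a pp = m<n⇒0<n∸m (prime⇒1< pp)
h≥1 lam a pp = m<n⇒0<n∸m (prime⇒1< pp)
h≥1 sigma {p} a pp = geom≥1 p a

component : ∀ {n l p a} → Factored n l → (p , a) ∈ l → Prime p × (∃[ b ] a ≡ suc b) × p ^ a ∣ n
component (mul {p} {a} {m} pp _ f) (here refl) = pp , (a , refl) , m∣m*n m
component (mul {p} {a} {m} pp _ f) (there q) = let pq , b , d = component f q in pq , b , ∣n⇒∣m*n (p ^ suc a) d

∏-∣ : ∀ {l p a} h → (p , a) ∈ l → h p a ∣ ∏ l h
∏-∣ {(p , a) ∷ l} h (here refl) = m∣m*n (∏ l h)
∏-∣ {(p , a) ∷ l} h (there q)   = ∣n⇒∣m*n (h p a) (∏-∣ h q)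

component∣prime : ∀ {n l p a} → Factored n l → (p , a) ∈ l → p ∣ n
component∣prime {p = p} f q with component f q
... | pp , (b , refl) , d = ∣-trans (m∣m*n (p ^ b)) d

h∣⟦f⟧ : ∀ f {n l p a} → Factored n l → (p , a) ∈ l → local f p a ∣ ⟦ f ⟧ᵇ n
h∣⟦f⟧ phi F q = pred∣φ F q
h∣⟦f⟧ sigma F q = subst (_ ∣_) (sym (σ≡∏ F)) (∏-∣ geom q)
h∣⟦f⟧ lam F q = pred∣λC (proj₁ (component F q)) (factored≥1 F) (component∣prime F q)

⟦f⟧∣ : ∀ f {n l} → Factored n l → ⟦ f ⟧ᵇ n ∣ n * ∏ l (local f)
⟦f⟧∣ phi F = φ∣ F
⟦f⟧∣ sigma {n} F = subst (_∣ n * _) (sym (σ≡∏ F)) (n∣m*n n)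
⟦f⟧∣ lam F = ∣-trans (λC∣φ (factored≥1 F)) (φ∣ F)

⟦f⟧≥1 : ∀ f {n} → 1 ≤ n → 1 ≤ ⟦ f ⟧ᵇ n
⟦f⟧≥1 phi   = φ≥1
⟦f⟧≥1 sigma = σ≥1
⟦f⟧≥1 lam   = λC≥1

⟦f⟧≤ : ∀ f {n k} → 1 ≤ n → n ≤ 2 ^ k → ⟦ f ⟧ᵇ n ≤ n * suc k
⟦f⟧≤ phi {n} {k} 1≤n le = ≤-trans (φ≤ n) (m≤m*n n (suc k))
⟦f⟧≤ sigma 1≤n le = σ≤ 1≤n le
⟦f⟧≤ lam {n} {k} 1≤n le = ≤-trans (∣⇒≤′ (φ≥1 1≤n) (λC∣φ 1≤n)) (⟦f⟧≤ phi {n} {k} 1≤n le)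

τ-double : ∀ {p m} a → Prime p → ¬ p ∣ m → 1 ≤ m → 2 * τ m ≤ τ (p ^ suc a * m)
τ-double {p} {m} a pp p∤m 1≤m = begin
  2 * τ m ≡⟨ cong (τ m +_) (+-identityʳ (τ m)) ⟩
  τ m + τ m ≡⟨ cong (τ m +_) (length-map (p *_) (divisors m)) ⟨
  τ m + length (map (p *_) (divisors m)) ≡⟨ length-++ (divisors m) ⟨
  length (divisors m ++ map (p *_) (divisors m)) ≤⟨ length-⊆ unique sub ⟩
  τ (p ^ suc a * m) ∎
  where
  open ≤-Reasoning
  1≤n : 1 ≤ p ^ suc a * m
  1≤n = 1≤* (m^n>0 p {{prime⇒nonZero pp}} (suc a)) 1≤m
  unique : Unique (divisors m ++ map (p *_) (divisors m))
  unique = Unique.++⁺ (divisors-unique m) (Unique.map⁺ (λ {x} {y} → *-cancelˡ-≡ x y p {{prime⇒nonZero pp}}) (divisors-unique m))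
    (λ (q , r) → case ∈-map⁻ (p *_) r of λ { (d , _ , refl) → p∤m (∣-trans (m∣m*n d) (proj₂ (∈-divisors⁻ {n = m} q))) })
  sub : divisors m ++ map (p *_) (divisors m) ⊆′ divisors (p ^ suc a * m)
  sub q with ∈-++⁻ (divisors m) q
  ... | inj₁ r = ∈-divisors⁺ 1≤n (∣n⇒∣m*n (p ^ suc a) (proj₂ (∈-divisors⁻ {n = m} r)))
  ... | inj₂ r with ∈-map⁻ (p *_) r
  ... | d , d∈ , refl = ∈-divisors⁺ 1≤n (*-pres-∣ {p} {p ^ suc a} (m∣m*n (p ^ a)) (proj₂ (∈-divisors⁻ {n = m} d∈)))

-- Turns a bound τ(n) ≤ 2 ^ T into a bound T for the number of prime factors, that is, for the
-- number of local factors and of factors in `products`.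
2^ω≤τ : ∀ {n l} → Factored n l → 2 ^ length l ≤ τ n
2^ω≤τ one = ≤-refl
2^ω≤τ (mul {p} {a} pp p∤m F) = ≤-trans (*-monoʳ-≤ 2 (2^ω≤τ F)) (τ-double a pp p∤m (factored≥1 F))

2^-cancel-≤ : ∀ a b → 2 ^ a ≤ 2 ^ b → a ≤ b
2^-cancel-≤ a b le with a ≤? b
... | yes a≤b = a≤b
... | no  a≰b = contradiction le (<⇒≱ (^-monoʳ-< 2 (s≤s (s≤s z≤n)) (≰⇒> a≰b)))

∏-h≥1 : ∀ f {n l} → Factored n l → 1 ≤ ∏ l (local f)
∏-h≥1 f one = ≤-refl
∏-h≥1 f (mul {a = a} pp _ F) = 1≤* (h≥1 f (suc a) pp) (∏-h≥1 f F)

τ∏≤ : ∀ f {n l D} → Factored n l → (∀ {p a} → (p , a) ∈ l → τ (local f p a) ≤ D) → τ (∏ l (local f)) ≤ D ^ length l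
τ∏≤ f one _ = ≤-refl
τ∏≤ f (mul {a = a} pp _ F) le = ≤-trans (τ-submult (h≥1 f (suc a) pp) (∏-h≥1 f F))
  (*-mono-≤ (le (here refl)) (τ∏≤ f F (le ∘ there)))

τ-⟦f⟧≤ : ∀ f {n l T K} → Factored n l → τ n ≤ 2 ^ T → (∀ {p a} → (p , a) ∈ l → τ (local f p a) ≤ 2 ^ K) →
  τ (⟦ f ⟧ᵇ n) ≤ 2 ^ (T + K * T)
τ-⟦f⟧≤ f {n} {l} {T} {K} F τn≤ τh≤ = begin
  τ (⟦ f ⟧ᵇ n) ≤⟨ τ-mono-∣ (1≤* (factored≥1 F) (∏-h≥1 f F)) (⟦f⟧∣ f F) ⟩
  τ (n * ∏ l (local f)) ≤⟨ τ-submult (factored≥1 F) (∏-h≥1 f F) ⟩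
  τ n * τ (∏ l (local f)) ≤⟨ *-mono-≤ τn≤ (τ∏≤ f F τh≤) ⟩
  2 ^ T * (2 ^ K) ^ length l ≤⟨ *-monoʳ-≤ (2 ^ T) (^-monoʳ-≤ (2 ^ K) {{m^n≢0 2 K}} (2^-cancel-≤ (length l) T (≤-trans (2^ω≤τ F) τn≤))) ⟩
  2 ^ T * (2 ^ K) ^ T ≡⟨ cong (2 ^ T *_) (^-*-assoc 2 K T) ⟩
  2 ^ T * 2 ^ (K * T) ≡⟨ ^-distribˡ-+-* 2 T (K * T) ⟨
  2 ^ (T + K * T) ∎
  where open ≤-Reasoning

products : ℕ → List ℕ → List ℕ
products zero C = 1 ∷ []
products (suc W) C = cartesianProductWith _*_ C (products W C)

length-products : ∀ W C → length (products W C) ≡ length C ^ W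
length-products zero C = refl
length-products (suc W) C = trans (length-cartesianProductWith _*_ C (products W C)) (cong (length C *_) (length-products W C))

∈-products : ∀ {n l W C} → Factored n l → 1 ∈ C → (∀ {p a} → (p , a) ∈ l → p ^ a ∈ C) → length l ≤ W → n ∈ products W C
∈-products {W = zero}  one 1∈ _ _ = here refl
∈-products {W = suc W} {C} one 1∈ _ _ = ∈-cartesianProductWith⁺ _*_ {xs = C} 1∈ (∈-products {W = W} one 1∈ (λ ()) z≤n)
∈-products {W = suc W} {C} (mul _ _ F) 1∈ p∈ (s≤s le) = ∈-cartesianProductWith⁺ _*_ {xs = C} (p∈ (here refl)) (∈-products F 1∈ (p∈ ∘ there) le)

powersAt : Basic → (m a : ℕ) → List ℕ
powersAt f m a = map (λ d → base f a d ^ a) (divisors m)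

-- The leading 1 pads factorisations with fewer than W prime powers, so that products of exactly W
-- candidates cover them. Spurious candidates are harmless, as only an upper bound for the number is
-- wanted.
candidates : Basic → ℕ → ℕ → List ℕ
candidates f k m = 1 ∷ concatMap (powersAt f m) (range1 k)

length-candidates : ∀ f k m → length (candidates f k m) ≡ suc (k * τ m)
length-candidates f k m = cong suc (trans (length-concatMap (powersAt f m) (range1 k))
  (trans (∑-cong (range1 k) (λ {a} _ → length-map (λ d → base f a d ^ a) (divisors m)))
  (trans (∑-const (range1 k) (τ m)) (cong (_* τ m) (length-range1 k)))))

exponent≤ : ∀ {p n k} a → Prime p → 1 ≤ n → n ≤ 2 ^ k → p ^ a ∣ n → a ≤ k
exponent≤ {p} {n} {k} a pp 1≤n n≤ d = 2^-cancel-≤ a k (≤-trans (^-monoˡ-≤ a (prime⇒1< pp)) (≤-trans (∣⇒≤′ 1≤n d) n≤))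

∈-candidates : ∀ f {n l k p a} → Factored n l → n ≤ 2 ^ k → (p , a) ∈ l → p ^ a ∈ candidates f k (⟦ f ⟧ᵇ n)
∈-candidates f {n} {l} {k} {p} F n≤ q with component F q
... | pp , (a , refl) , d = there (∈-concatMap (powersAt f (⟦ f ⟧ᵇ n)) {range1 k} (∈-range1⁺ (s≤s z≤n) (exponent≤ (suc a) pp (factored≥1 F) n≤ d))
  (subst (λ b → b ^ suc a ∈ powersAt f (⟦ f ⟧ᵇ n) (suc a)) (base-h f a pp)
    (∈-map⁺ (λ d → base f (suc a) d ^ suc a) (∈-divisors⁺ (⟦f⟧≥1 f (factored≥1 F)) (h∣⟦f⟧ f F q)))))

-- The list is left empty when m has too many divisors, which makes the length bound valid for every
-- m; such values come only from exceptional n.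
preimages : Basic → (k T W : ℕ) → ℕ → List ℕ
preimages f k T W m with τ m ≤? 2 ^ T
... | yes _ = products W (candidates f k m)
... | no  _ = []

length-preimages : ∀ f {t k} T W m → suc k ≤ 2 ^ t → length (preimages f k T W m) ≤ 2 ^ ((t + T) * W)
length-preimages f {t} {k} T W m k< with τ m ≤? 2 ^ T
... | no  _ = z≤n
... | yes τ≤ = begin
  length (products W (candidates f k m)) ≡⟨ length-products W (candidates f k m) ⟩
  length (candidates f k m) ^ W ≡⟨ cong (_^ W) (length-candidates f k m) ⟩
  suc (k * τ m) ^ W ≤⟨ ^-monoˡ-≤ W (+-mono-≤ (1≤2^ T) (*-monoʳ-≤ k τ≤)) ⟩
  (suc k * 2 ^ T) ^ W ≤⟨ ^-monoˡ-≤ W (*-monoˡ-≤ (2 ^ T) k<) ⟩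
  (2 ^ t * 2 ^ T) ^ W ≡⟨ cong (_^ W) (^-distribˡ-+-* 2 t T) ⟨
  (2 ^ (t + T)) ^ W ≡⟨ ^-*-assoc 2 (t + T) W ⟩
  2 ^ ((t + T) * W) ∎
  where open ≤-Reasoning

∈-preimages : ∀ f {n k T W} → 1 ≤ n → n ≤ 2 ^ k → τ n ≤ 2 ^ W → τ (⟦ f ⟧ᵇ n) ≤ 2 ^ T → n ∈ preimages f k T W (⟦ f ⟧ᵇ n)
∈-preimages f {n} {k} {T} {W} 1≤n n≤ τn≤ τfn≤ with τ (⟦ f ⟧ᵇ n) ≤? 2 ^ T
... | no  τ≰ = contradiction τfn≤ τ≰
... | yes _ with factored n 1≤n
... | l , F = ∈-products F (here refl) (∈-candidates f {k = k} F n≤) (2^-cancel-≤ (length l) W (≤-trans (2^ω≤τ F) τn≤))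

-- If e is the local factor of p ^ a, then e ≤ 2 p ^ a, so c p ^ a ≤ x forces c e ≤ 2 x: the range
-- of the cofactor c is bounded in terms of e alone.
multiplesAt : Basic → (x a e : ℕ) → List ℕ
multiplesAt f x a e = map (base f a e ^ a *_) (range1 (2 * x ÷ e))

wildAt : Basic → (K x a : ℕ) → List ℕ
wildAt f K x a = concatMap (multiplesAt f x a) (filter (λ e → 2 ^ K <? τ e) (range1 (2 * x)))

wild : Basic → (k K x : ℕ) → List ℕ
wild f k K x = concatMap (wildAt f K x) (range1 k)

length-wild : ∀ f k K x → x ≤ 2 ^ k → length (wild f k K x) * 2 ^ K ≤ k * (2 * x * suc (suc k) * suc (suc k))
length-wild f k K x x≤ = begin
  length (wild f k K x) * 2 ^ K ≡⟨ cong (_* 2 ^ K) (length-concatMap (wildAt f K x) (range1 k)) ⟩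
  ∑ (range1 k) (λ a → length (wildAt f K x a)) * 2 ^ K ≡⟨ cong (_* 2 ^ K) (∑-cong (range1 k) (λ {a} _ → length-inner a)) ⟩
  ∑ (range1 k) (λ a → ∑ many (2 * x ÷_)) * 2 ^ K ≡⟨ cong (_* 2 ^ K) (trans (∑-const (range1 k) _) (cong (_* ∑ many (2 * x ÷_)) (length-range1 k))) ⟩
  k * ∑ many (2 * x ÷_) * 2 ^ K ≡⟨ *-assoc k _ _ ⟩
  k * (∑ many (2 * x ÷_) * 2 ^ K) ≤⟨ *-monoʳ-≤ k (manyDivisors-weight {2 * x} {suc k} K (*-monoʳ-≤ 2 x≤)) ⟩
  k * (2 * x * suc (suc k) * suc (suc k)) ∎
  where
  open ≤-Reasoning
  many = filter (λ e → 2 ^ K <? τ e) (range1 (2 * x))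
  length-inner : ∀ a → length (wildAt f K x a) ≡ ∑ many (2 * x ÷_)
  length-inner a = trans (length-concatMap (multiplesAt f x a) many)
    (∑-cong many (λ {e} _ → trans (length-map (base f a e ^ a *_) (range1 (2 * x ÷ e))) (length-range1 (2 * x ÷ e))))

∈-wild : ∀ f {n l k K x p a} → Factored n l → n ≤ x → x ≤ 2 ^ k → (p , a) ∈ l → 2 ^ K < τ (local f p a) → n ∈ wild f k K x
∈-wild f {n} {l} {k} {K} {x} {p} F n≤x x≤ q many with component F q
... | pp , (a , refl) , divides c eq = ∈-concatMap (wildAt f K x) {range1 k} (∈-range1⁺ (s≤s z≤n) (exponent≤ (suc a) pp 1≤n (≤-trans n≤x x≤) (divides c eq)))
  (∈-concatMap (multiplesAt f x (suc a)) {filter (λ e → 2 ^ K <? τ e) (range1 (2 * x))}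
    (∈-filter⁺ (λ e → 2 ^ K <? τ e) (∈-range1⁺ 1≤e (≤-trans (m≤n*m e c {{>-nonZero 1≤c}}) ce≤)) many)
    (subst (_∈ multiplesAt f x (suc a) e)
      (trans (cong (λ b → b ^ suc a * c) (base-h f a pp)) (trans (*-comm (p ^ suc a) c) (sym eq)))
      (∈-map⁺ (base f (suc a) e ^ suc a *_) (∈-range1⁺ 1≤c (÷-greatest 1≤e ce≤)))))
  where
  1≤n = factored≥1 F
  e = local f p (suc a)
  1≤e : 1 ≤ e
  1≤e = h≥1 f (suc a) pp
  1≤c : 1 ≤ c
  1≤c = 1≤*⇒1≤ˡ c (subst (1 ≤_) eq 1≤n)
  ce≤ : c * e ≤ 2 * x
  ce≤ = begin
    c * e ≤⟨ *-monoʳ-≤ c (h≤ f a pp) ⟩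
    c * (2 * p ^ suc a) ≡⟨ rearrange c (p ^ suc a) ⟩
    2 * (c * p ^ suc a) ≡⟨ cong (2 *_) eq ⟨
    2 * n ≤⟨ *-monoʳ-≤ 2 n≤x ⟩
    2 * x ∎
    where
    open ≤-Reasoning
    rearrange : ∀ c q → c * (2 * q) ≡ 2 * (c * q)
    rearrange = solve-∀

all-or-some : ∀ {a p q} {A : Set a} {P : A → Set p} {Q : A → Set q} → (∀ x → P x ⊎ Q x) → ∀ xs →
  (∀ {x} → x ∈ xs → P x) ⊎ (∃[ x ] x ∈ xs × Q x)
all-or-some d []  = inj₁ λ ()
all-or-some d (x ∷ xs) with d x | all-or-some d xs
... | inj₂ q | _  = inj₂ (x , here refl , q)
... | inj₁ p | inj₂ (y , y∈ , q)   = inj₂ (y , there y∈ , q)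
... | inj₁ p | inj₁ ps  = inj₁ λ { (here refl) → p ; (there y∈) → ps y∈ }

wild-or-tame : ∀ f {n k T} K x → 1 ≤ n → n ≤ x → x ≤ 2 ^ k → τ n ≤ 2 ^ T → n ∈ wild f k K x ⊎ τ (⟦ f ⟧ᵇ n) ≤ 2 ^ (T + K * T)
wild-or-tame f {n} {k} {T} K x 1≤n n≤x x≤ τ≤ with factored n 1≤n
... | l , F with all-or-some {P = λ (p , a) → τ (local f p a) ≤ 2 ^ K} (λ (p , a) → ≤-<-connex (τ (local f p a)) (2 ^ K)) l
... | inj₁ good  = inj₂ (τ-⟦f⟧≤ f {n} {l} {T} {K} F τ≤ good)
... | inj₂ (_ , q , bad) = inj₁ (∈-wild f {n} {l} {k} {K} {x} F n≤x x≤ q bad)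

-- Polynomial bounds in t and the iteration over the composition

Poly : (ℕ → ℕ) → Set
Poly T = ∃[ c ] ∃[ e ] ∀ t → T t ≤ (2 + c + t) ^ e

poly-const : ∀ c → Poly (λ _ → c)
poly-const c = c , 1 , λ t → ≤-trans (≤-trans (m≤n+m c 2) (m≤m+n (2 + c) t)) (≤-reflexive (sym (*-identityʳ _)))

poly-id : Poly (λ t → t)
poly-id = 0 , 1 , λ t → ≤-trans (m≤n+m t 2) (≤-reflexive (sym (*-identityʳ _)))

poly-* : ∀ {S T} → Poly S → Poly T → Poly (λ t → S t * T t)
poly-* (c , e , p) (d , f , q) = c + d , e + f , λ t → ≤-trans
  (*-mono-≤ (≤-trans (p t) (^-monoˡ-≤ e (+-monoˡ-≤ t (+-monoʳ-≤ 2 (m≤m+n c d)))))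
            (≤-trans (q t) (^-monoˡ-≤ f (+-monoˡ-≤ t (+-monoʳ-≤ 2 (m≤n+m d c))))))
  (≤-reflexive (sym (^-distribˡ-+-* (2 + (c + d) + t) e f)))

-- The summand 2 in `Poly` keeps the base W at least 2, so one more factor W absorbs the sum of two
-- powers.
poly-+ : ∀ {S T} → Poly S → Poly T → Poly (λ t → S t + T t)
poly-+ {S} {T} (c , e , p) (d , f , q) = c + d , suc (e + f) , λ t → let W = 2 + (c + d) + t in begin
  S t + T t ≤⟨ +-mono-≤ (≤-trans (p t) (^-monoˡ-≤ e (+-monoˡ-≤ t (+-monoʳ-≤ 2 (m≤m+n c d)))))
                                              (≤-trans (q t) (^-monoˡ-≤ f (+-monoˡ-≤ t (+-monoʳ-≤ 2 (m≤n+m d c))))) ⟩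
  W ^ e + W ^ f ≤⟨ +-mono-≤ (^-monoʳ-≤ W (m≤m+n e f)) (^-monoʳ-≤ W (m≤n+m f e)) ⟩
  W ^ (e + f) + W ^ (e + f) ≡⟨ cong (W ^ (e + f) +_) (+-identityʳ _) ⟨
  2 * W ^ (e + f) ≤⟨ *-monoˡ-≤ (W ^ (e + f)) {2} {W} (s≤s (s≤s z≤n)) ⟩
  W * W ^ (e + f) ∎
  where open ≤-Reasoning

-- Outside a sparse list of exceptions, n ≤ x can be recovered from F(n) up to 2 ^ M(t) choices.
-- Here t is about log log x, so M(t) is negligible against log x.
record Encoding (F : ℕ → ℕ) (j A : ℕ) : Set where
  field
    T M : ℕ → ℕ
    T-poly : Poly T
    M-poly : Poly M
    encode : ∀ t k x → 2 + k ≤ 2 ^ t → x * 2 ^ (j * t) ≤ 2 ^ k →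
      Σ (List ℕ) λ bad → Σ (ℕ → List ℕ) λ pre →
        length bad * 2 ^ (A * t) ≤ x × (∀ m → length (pre m) ≤ 2 ^ M t) ×
        (∀ {n} → 1 ≤ n → n ≤ x → 1 ≤ F n × F n ≤ x * 2 ^ (j * t) × (n ∈ bad ⊎ (τ (F n) ≤ 2 ^ T t × n ∈ pre (F n))))

-- The exceptions are the integers e ≤ x with more than 2 ^ T divisors. Each has weight x ÷ e ≥ 1,
-- so there are at most x (k + 1) ^ 2 / 2 ^ T of them; the 2 in A + 2 cancels (k + 1) ^ 2.
encode-id : ∀ A → Encoding id 0 A
encode-id A = record
  { T = T ; M = λ _ → 0
  ; T-poly = poly-* (poly-const (A + 2)) poly-id ; M-poly = poly-const 0
  ; encode = λ t k x k< x≤′ → let x≤ = subst (_≤ 2 ^ k) (*-identityʳ x) x≤′ in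
      bad t x , (λ m → m ∷ []) , bad-small t k x k< x≤ , (λ _ → ≤-refl) ,
      λ 1≤n n≤x → 1≤n , subst (_ ≤_) (sym (*-identityʳ x)) n≤x , classify t x 1≤n n≤x }
  where
  T : ℕ → ℕ
  T t = (A + 2) * t
  bad : ℕ → ℕ → List ℕ
  bad t x = filter (λ e → 2 ^ T t <? τ e) (range1 x)
  classify : ∀ t x {n} → 1 ≤ n → n ≤ x → n ∈ bad t x ⊎ (τ n ≤ 2 ^ T t × n ∈ n ∷ [])
  classify t x {n} 1≤n n≤x with ≤-<-connex (τ n) (2 ^ T t)
  ... | inj₁ le = inj₂ (le , here refl)
  ... | inj₂ gt = inj₁ (∈-filter⁺ (λ e → 2 ^ T t <? τ e) (∈-range1⁺ 1≤n n≤x) gt)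
  bad-small : ∀ t k x → 2 + k ≤ 2 ^ t → x ≤ 2 ^ k → length (bad t x) * 2 ^ (A * t) ≤ x
  bad-small t k x k< x≤ = *-cancelʳ-≤ _ _ (2 ^ t * 2 ^ t) {{m*n≢0 (2 ^ t) (2 ^ t) {{m^n≢0 2 t}} {{m^n≢0 2 t}}}} (begin
    length (bad t x) * 2 ^ (A * t) * (2 ^ t * 2 ^ t) ≡⟨ cong (length (bad t x) * 2 ^ (A * t) *_) (^-distribˡ-+-* 2 t t) ⟨
    length (bad t x) * 2 ^ (A * t) * 2 ^ (t + t) ≡⟨ *-assoc (length (bad t x)) _ _ ⟩
    length (bad t x) * (2 ^ (A * t) * 2 ^ (t + t)) ≡⟨ cong (length (bad t x) *_) (^-distribˡ-+-* 2 (A * t) (t + t)) ⟨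
    length (bad t x) * 2 ^ (A * t + (t + t)) ≡⟨ cong (λ e → length (bad t x) * 2 ^ e) (exponents A t) ⟩
    length (bad t x) * 2 ^ T t ≡⟨ cong (_* 2 ^ T t) (length≡∑1 (bad t x)) ⟩
    ∑ (bad t x) (λ _ → 1) * 2 ^ T t ≤⟨ *-monoˡ-≤ (2 ^ T t) (∑-mono (bad t x) (λ e∈ → let 1≤e , e≤x = ∈-range1⁻ (proj₁ (∈-filter⁻ (λ e → 2 ^ T t <? τ e) {xs = range1 x} e∈)) in ÷-greatest 1≤e (subst (_≤ x) (sym (*-identityˡ _)) e≤x))) ⟩
    ∑ (bad t x) (x ÷_) * 2 ^ T t ≤⟨ manyDivisors-weight {x} {k} (T t) x≤ ⟩
    x * suc k * suc k ≤⟨ *-mono-≤ (*-monoʳ-≤ x (<⇒≤ k<)) (<⇒≤ k<) ⟩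
    x * 2 ^ t * 2 ^ t ≡⟨ *-assoc x _ _ ⟩
    x * (2 ^ t * 2 ^ t) ∎)
    where
    open ≤-Reasoning
    exponents : ∀ A t → A * t + (t + t) ≡ (A + 2) * t
    exponents = solve-∀

2^-* : ∀ a b → 2 ^ a * 2 ^ b ≡ 2 ^ (a + b)
2^-* a b = sym (^-distribˡ-+-* 2 a b)

-- A new exception is an n for which F n is wild; each wild value has at most 2 ^ M candidates n in
-- `pre`, so pulling the wild list back keeps it small. The function f enlarges values by at most k
-- + 1 ≤ 2 ^ t, which raises j by one.
encode-step : ∀ f {F j A} → Encoding F j (suc A) → Encoding (⟦ f ⟧ᵇ ∘ F) (suc j) A
encode-step f {F} {j} {A} E = record
  { T = T′ ; M = M′
  ; T-poly = poly-+ E.T-poly (poly-* K-poly E.T-poly)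
  ; M-poly = poly-+ (poly-* (poly-+ poly-id (poly-+ E.T-poly (poly-* K-poly E.T-poly))) E.T-poly) E.M-poly
  ; encode = encode′ }
  where
  module E = Encoding E
  K T′ M′ : ℕ → ℕ
  -- E.M t pays for the candidates per wild value, suc (A * t) for the claimed saving with a factor
  -- 2 to spare, suc (3 * t) for the factor 2 k (k + 2) ^ 2 of `length-wild`, and j * t for the
  -- range X in place of x.
  K t  = E.M t + (suc (A * t) + (suc (3 * t) + j * t))
  T′ t = E.T t + K t * E.T t
  -- F n has at most E.T t prime powers, each chosen from at most 2 ^ (t + T′ t) candidates; then n
  -- is recovered from F n at the cost E.M t.
  M′ t = (t + T′ t) * E.T t + E.M t
  linear-poly : ∀ c → Poly (c *_)
  linear-poly c = poly-* (poly-const c) poly-id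
  K-poly : Poly K
  K-poly = poly-+ E.M-poly (poly-+ (poly-+ (poly-const 1) (linear-poly A)) (poly-+ (poly-+ (poly-const 1) (linear-poly 3)) (linear-poly j)))
  encode′ : ∀ t k x → 2 + k ≤ 2 ^ t → x * 2 ^ (suc j * t) ≤ 2 ^ k →
    Σ (List ℕ) λ bad → Σ (ℕ → List ℕ) λ pre →
      length bad * 2 ^ (A * t) ≤ x × (∀ m → length (pre m) ≤ 2 ^ M′ t) ×
      (∀ {n} → 1 ≤ n → n ≤ x → 1 ≤ ⟦ f ⟧ᵇ (F n) × ⟦ f ⟧ᵇ (F n) ≤ x * 2 ^ (suc j * t) ×
        (n ∈ bad ⊎ (τ (⟦ f ⟧ᵇ (F n)) ≤ 2 ^ T′ t × n ∈ pre (⟦ f ⟧ᵇ (F n)))))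
  encode′ t k x k< x≤ with E.encode t k x k< (≤-trans (*-monoʳ-≤ x (^-monoʳ-≤ 2 (m≤n+m (j * t) t))) x≤)
  ... | bad , pre , bad-small , pre-small , spec =
    bad ++ concatMap pre W , pre′ , bad′-small , pre′-small , λ {n} 1≤n n≤x → spec′ 1≤n n≤x
    where
    X = x * 2 ^ (j * t)
    X≤ : X ≤ 2 ^ k
    X≤ = ≤-trans (*-monoʳ-≤ x (^-monoʳ-≤ 2 (m≤n+m (j * t) t))) x≤
    1+k≤ : suc k ≤ 2 ^ t
    1+k≤ = <⇒≤ k<
    W = wild f k (K t) X
    pre′ : ℕ → List ℕ
    pre′ m = concatMap pre (preimages f k (T′ t) (E.T t) m)
    pulledBack-small : ∀ l → length (concatMap pre l) ≤ length l * 2 ^ E.M t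
    pulledBack-small l = ≤-trans (≤-reflexive (length-concatMap pre l)) (∑-bound l (λ {m} _ → pre-small m))
    pre′-small : ∀ m → length (pre′ m) ≤ 2 ^ M′ t
    pre′-small m = begin
      length (pre′ m) ≤⟨ pulledBack-small (preimages f k (T′ t) (E.T t) m) ⟩
      length (preimages f k (T′ t) (E.T t) m) * 2 ^ E.M t ≤⟨ *-monoˡ-≤ (2 ^ E.M t) (length-preimages f {t} {k} (T′ t) (E.T t) m 1+k≤) ⟩
      2 ^ ((t + T′ t) * E.T t) * 2 ^ E.M t ≡⟨ 2^-* ((t + T′ t) * E.T t) (E.M t) ⟩
      2 ^ M′ t ∎
      where open ≤-Reasoning
    c = suc (3 * t) + j * t
    wild-small : length W * 2 ^ (E.M t + suc (A * t)) ≤ x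
    wild-small = *-cancelʳ-≤ _ _ (2 ^ c) {{m^n≢0 2 c}} (begin
      length W * 2 ^ (E.M t + suc (A * t)) * 2 ^ c ≡⟨ *-assoc (length W) _ _ ⟩
      length W * (2 ^ (E.M t + suc (A * t)) * 2 ^ c) ≡⟨ cong (length W *_) (2^-* (E.M t + suc (A * t)) c) ⟩
      length W * 2 ^ (E.M t + suc (A * t) + c) ≡⟨ cong (λ e → length W * 2 ^ e) (+-assoc (E.M t) (suc (A * t)) c) ⟩
      length W * 2 ^ K t ≤⟨ length-wild f k (K t) X X≤ ⟩
      k * (2 * X * suc (suc k) * suc (suc k)) ≤⟨ *-mono-≤ (≤-trans (n≤1+n k) 1+k≤) (*-mono-≤ (*-monoʳ-≤ (2 * X) k<) k<) ⟩
      2 ^ t * (2 * (x * 2 ^ (j * t)) * 2 ^ t * 2 ^ t) ≡⟨ rearrange x (2 ^ (j * t)) (2 ^ t) ⟩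
      x * ((2 * (2 ^ t * (2 ^ t * 2 ^ t))) * 2 ^ (j * t)) ≡⟨ cong (λ e → x * (2 * e * 2 ^ (j * t))) (trans (cong (2 ^ t *_) (2^-* t t)) (2^-* t (t + t))) ⟩
      x * (2 * 2 ^ (t + (t + t)) * 2 ^ (j * t)) ≡⟨ cong (x *_) (2^-* (suc (t + (t + t))) (j * t)) ⟩
      x * 2 ^ (suc (t + (t + t)) + j * t) ≡⟨ cong (λ e → x * 2 ^ (suc (t + (t + e)) + j * t)) (+-identityʳ t) ⟨
      x * 2 ^ c ∎)
      where
      open ≤-Reasoning
      rearrange : ∀ x y z → z * (2 * (x * y) * z * z) ≡ x * ((2 * (z * (z * z))) * y)
      rearrange = solve-∀
    2≤2^t : 2 ≤ 2 ^ t
    2≤2^t = ≤-trans (s≤s (s≤s z≤n)) k<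
    -- Old and new exceptions get half of the allowance each. For the old ones the factor 2 is
    -- bought with the surplus unit of suc A, as 2 ≤ 2 ^ t.
    bad′-small : length (bad ++ concatMap pre W) * 2 ^ (A * t) ≤ x
    bad′-small = *-cancelʳ-≤ _ _ 2 (begin
      length (bad ++ concatMap pre W) * 2 ^ (A * t) * 2
        ≡⟨ cong (λ l → l * 2 ^ (A * t) * 2) (length-++ bad) ⟩
      (length bad + length (concatMap pre W)) * 2 ^ (A * t) * 2
        ≡⟨ distribute (length bad) _ (2 ^ (A * t)) ⟩
      length bad * (2 * 2 ^ (A * t)) + length (concatMap pre W) * (2 * 2 ^ (A * t))
        ≤⟨ +-mono-≤ (*-monoʳ-≤ (length bad) (≤-trans (*-monoˡ-≤ (2 ^ (A * t)) 2≤2^t) (≤-reflexive (2^-* t (A * t)))))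
                    (*-monoˡ-≤ (2 * 2 ^ (A * t)) (pulledBack-small W)) ⟩
      length bad * 2 ^ (suc A * t) + length W * 2 ^ E.M t * (2 * 2 ^ (A * t))
        ≡⟨ cong (length bad * 2 ^ (suc A * t) +_) (trans (*-assoc (length W) _ _) (cong (length W *_) (2^-* (E.M t) (suc (A * t))))) ⟩
      length bad * 2 ^ (suc A * t) + length W * 2 ^ (E.M t + suc (A * t))
        ≤⟨ +-mono-≤ bad-small wild-small ⟩
      x + x
        ≡⟨ double x ⟩
      x * 2 ∎)
      where
      open ≤-Reasoning
      distribute : ∀ a b c → (a + b) * c * 2 ≡ a * (2 * c) + b * (2 * c)
      distribute = solve-∀
      double : ∀ x → x + x ≡ x * 2
      double = solve-∀
    spec′ : ∀ {n} → 1 ≤ n → n ≤ x → 1 ≤ ⟦ f ⟧ᵇ (F n) × ⟦ f ⟧ᵇ (F n) ≤ x * 2 ^ (suc j * t) ×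
      (n ∈ bad ++ concatMap pre W ⊎ (τ (⟦ f ⟧ᵇ (F n)) ≤ 2 ^ T′ t × n ∈ pre′ (⟦ f ⟧ᵇ (F n))))
    spec′ {n} 1≤n n≤x with spec 1≤n n≤x
    ... | 1≤Fn , Fn≤ , d = ⟦f⟧≥1 f 1≤Fn , fFn≤ , classify d
      where
      Fn≤2^k : F n ≤ 2 ^ k
      Fn≤2^k = ≤-trans Fn≤ X≤
      fFn≤ : ⟦ f ⟧ᵇ (F n) ≤ x * 2 ^ (suc j * t)
      fFn≤ = begin
        ⟦ f ⟧ᵇ (F n) ≤⟨ ⟦f⟧≤ f {F n} {k} 1≤Fn Fn≤2^k ⟩
        F n * suc k ≤⟨ *-mono-≤ Fn≤ 1+k≤ ⟩
        x * 2 ^ (j * t) * 2 ^ t ≡⟨ *-assoc x _ _ ⟩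
        x * (2 ^ (j * t) * 2 ^ t) ≡⟨ cong (x *_) (2^-* (j * t) t) ⟩
        x * 2 ^ (j * t + t) ≡⟨ cong (λ e → x * 2 ^ e) (+-comm (j * t) t) ⟩
        x * 2 ^ (suc j * t) ∎
        where open ≤-Reasoning
      classify : (n ∈ bad ⊎ (τ (F n) ≤ 2 ^ E.T t × n ∈ pre (F n))) →
        n ∈ bad ++ concatMap pre W ⊎ (τ (⟦ f ⟧ᵇ (F n)) ≤ 2 ^ T′ t × n ∈ pre′ (⟦ f ⟧ᵇ (F n)))
      classify (inj₁ n∈) = inj₁ (∈-++⁺ˡ n∈)
      classify (inj₂ (τ≤ , n∈)) with wild-or-tame f {F n} {k} {E.T t} (K t) X 1≤Fn Fn≤ X≤ τ≤
      ... | inj₁ w   = inj₁ (∈-++⁺ʳ bad (∈-concatMap pre {W} w n∈))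
      ... | inj₂ τ≤′ = inj₂ (τ≤′ , ∈-concatMap pre {preimages f k (T′ t) (E.T t) (⟦ f ⟧ᵇ (F n))} (∈-preimages f {F n} {k} {T′ t} {E.T t} 1≤Fn Fn≤2^k τ≤ τ≤′) n∈)

encode-composeL : ∀ fs A → Encoding (composeL fs) (length fs) A
encode-composeL [] A = encode-id A
encode-composeL (f ∷ fs) A = encode-step f (encode-composeL fs (suc A))

-- A lower bound for the number of primes

primes : ℕ → List ℕ
primes n = filter prime? (range1 n)

-- The largest e ≤ k with p ^ e ≤ n, or 0 if there is none.
logFloor : (p n k : ℕ) → ℕ
logFloor p n zero  = 0
logFloor p n (suc k) with p ^ suc k ≤? n
... | yes _ = suc k
... | no  _ = logFloor p n k

^logFloor≤ : ∀ {p n} k → 1 ≤ n → p ^ logFloor p n k ≤ n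
^logFloor≤ zero 1≤n = 1≤n
^logFloor≤ {p} {n} (suc k) 1≤n with p ^ suc k ≤? n
... | yes le = le
... | no  _  = ^logFloor≤ k 1≤n

logFloor-greatest : ∀ {p n a} k → a ≤ k → p ^ a ≤ n → a ≤ logFloor p n k
logFloor-greatest {a = zero} k _ _ = z≤n
logFloor-greatest {p} {n} {suc a} (suc k) a≤ le with p ^ suc k ≤? n
... | yes _   = a≤
... | no  ¬le with m≤n⇒m<n∨m≡n a≤
... | inj₁ (s≤s a<) = logFloor-greatest k a< le
... | inj₂ refl  = contradiction le ¬le

-- lcm(1, ..., n) as the product of the largest prime powers up to n: each factor is at most n, so
-- an upper bound in terms of the number of primes can be read off.
lcmUpTo : ℕ → ℕ
lcmUpTo n = product (map (λ p → p ^ logFloor p n n) (primes n))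

product-≤ : ∀ {xs c} → (∀ {x} → x ∈ xs → x ≤ c) → product xs ≤ c ^ length xs
product-≤ {[]} le = ≤-refl
product-≤ {x ∷ xs} le = *-mono-≤ (le (here refl)) (product-≤ {xs} (le ∘ there))

lcmUpTo≤ : ∀ {n} → 1 ≤ n → lcmUpTo n ≤ n ^ length (primes n)
lcmUpTo≤ {n} 1≤n = ≤-trans (product-≤ {map f (primes n)} bound) (≤-reflexive (cong (n ^_) (length-map f (primes n))))
  where
  f : ℕ → ℕ
  f p = p ^ logFloor p n n
  bound : ∀ {x} → x ∈ map f (primes n) → x ≤ n
  bound x∈ with ∈-map⁻ f x∈
  ... | p , _ , refl = ^logFloor≤ {p} n 1≤n

∣product : ∀ {xs x} → x ∈ xs → x ∣ product xs
∣product {y ∷ xs} (here refl) = m∣m*n (product xs)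
∣product {y ∷ xs} (there x∈)  = ∣n⇒∣m*n y (∣product x∈)

^-monoʳ-∣ : ∀ p {a b} → a ≤ b → p ^ a ∣ p ^ b
^-monoʳ-∣ p {a} le with m≤n⇒∃[o]m+o≡n le
... | d , refl = subst (p ^ a ∣_) (sym (^-distribˡ-+-* p a d)) (m∣m*n (p ^ d))

factored-∣ : ∀ {n l D} → Factored n l → (∀ {p a} → (p , a) ∈ l → p ^ a ∣ D) → n ∣ D
factored-∣ one _ = 1∣ _
factored-∣ (mul {a = a} pp p∤m F) d = coprime⇒*∣ (coprime-^ (suc a) (prime∤⇒coprime pp p∤m)) (d (here refl)) (factored-∣ F (d ∘ there))

n<2^n : ∀ n → n < 2 ^ n
n<2^n zero  = s≤s z≤n
n<2^n (suc n) = begin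
  2 + n ≤⟨ +-mono-≤ (1≤2^ n) (n<2^n n) ⟩
  2 ^ n + 2 ^ n ≡⟨ cong (2 ^ n +_) (+-identityʳ (2 ^ n)) ⟨
  2 ^ suc n ∎
  where open ≤-Reasoning

∣lcmUpTo : ∀ {n i} → 1 ≤ i → i ≤ n → i ∣ lcmUpTo n
∣lcmUpTo {n} {i} 1≤i i≤n with factored i 1≤i
... | l , F = factored-∣ F divides-component
  where
  f : ℕ → ℕ
  f p = p ^ logFloor p n n
  divides-component : ∀ {p a} → (p , a) ∈ l → p ^ a ∣ lcmUpTo n
  divides-component {p} {a} q with component F q
  ... | pp , (b , refl) , d = ∣-trans (^-monoʳ-∣ p (logFloor-greatest {p} {n} {a} n a≤n p^a≤n))
          (∣product (∈-map⁺ f (∈-filter⁺ prime? (∈-range1⁺ (prime⇒1≤ pp) p≤n) pp)))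
    where
    p^a≤n : p ^ a ≤ n
    p^a≤n = ≤-trans (∣⇒≤′ 1≤i d) i≤n
    p≤n : p ≤ n
    p≤n = ≤-trans (p≤p^1+a b (prime⇒1≤ pp)) p^a≤n
    a≤n : a ≤ n
    a≤n = ≤-trans (<⇒≤ (<-≤-trans (n<2^n a) (^-monoˡ-≤ a (prime⇒1< pp)))) p^a≤n

-- binom m d = (m + d choose m)
binom : ℕ → ℕ → ℕ
binom zero d  = 1
binom (suc m) zero  = 1
binom (suc m) (suc d) = binom m (suc d) + binom (suc m) d

-- Proved together with its mirror image: both have the same right-hand side, which makes the two
-- terms of Pascal's rule commensurable.
binom-absorbˡ : ∀ m d → suc m * binom (suc m) d ≡ suc (m + d) * binom m d
binom-absorbʳ : ∀ m d → suc d * binom m (suc d) ≡ suc (m + d) * binom m d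
binom-absorbˡ zero zero  = refl
binom-absorbˡ (suc m) zero  = cong (λ k → suc k * 1) (cong suc (sym (+-identityʳ m)))
binom-absorbˡ m (suc d) = begin
  suc m * (binom m (suc d) + binom (suc m) d) ≡⟨ *-distribˡ-+ (suc m) (binom m (suc d)) (binom (suc m) d) ⟩
  suc m * binom m (suc d) + suc m * binom (suc m) d ≡⟨ cong (suc m * binom m (suc d) +_) (trans (binom-absorbˡ m d) (sym (binom-absorbʳ m d))) ⟩
  suc m * binom m (suc d) + suc d * binom m (suc d) ≡⟨ *-distribʳ-+ (binom m (suc d)) (suc m) (suc d) ⟨
  suc (m + suc d) * binom m (suc d) ∎
  where open ≡-Reasoning
binom-absorbʳ zero d = refl
binom-absorbʳ (suc m) d = begin
  suc d * (binom m (suc d) + binom (suc m) d) ≡⟨ *-distribˡ-+ (suc d) (binom m (suc d)) (binom (suc m) d) ⟩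
  suc d * binom m (suc d) + suc d * binom (suc m) d ≡⟨ cong (_+ suc d * binom (suc m) d) (trans (binom-absorbʳ m d) (sym (binom-absorbˡ m d))) ⟩
  suc m * binom (suc m) d + suc d * binom (suc m) d ≡⟨ *-distribʳ-+ (binom (suc m) d) (suc m) (suc d) ⟨
  (suc m + suc d) * binom (suc m) d ≡⟨ cong (_* binom (suc m) d) (+-suc (suc m) d) ⟩
  suc (suc m + d) * binom (suc m) d ∎
  where open ≡-Reasoning

binom-monoˡ : ∀ m d → binom m d ≤ binom (suc m) d
binom-monoˡ zero zero  = ≤-refl
binom-monoˡ (suc m) zero  = ≤-refl
binom-monoˡ m (suc d) = m≤m+n _ _

binom-monoʳ : ∀ m d → binom m d ≤ binom m (suc d)
binom-monoʳ zero d = ≤-refl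
binom-monoʳ (suc m) d = m≤n+m _ _

binom≥1 : ∀ m d → 1 ≤ binom m d
binom≥1 zero d = ≤-refl
binom≥1 (suc m) d = ≤-trans (binom≥1 m d) (binom-monoˡ m d)

2^≤binom : ∀ m → 2 ^ m ≤ binom m m
2^≤binom zero  = ≤-refl
2^≤binom (suc m) = begin
  2 ^ m + (2 ^ m + 0) ≡⟨ cong (2 ^ m +_) (+-identityʳ (2 ^ m)) ⟩
  2 ^ m + 2 ^ m ≤⟨ +-mono-≤ (≤-trans (2^≤binom m) (binom-monoʳ m m)) (≤-trans (2^≤binom m) (binom-monoˡ m m)) ⟩
  binom m (suc m) + binom (suc m) m ∎
  where open ≤-Reasoning

-- The entries 1/((n+1) C(n,m)) of Leibniz's harmonic triangle: each is a difference of entries one row up and to the left,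
-- so all of them up to row N are multiples of 1/D.
leibniz : ∀ {D N} → (∀ {i} → 1 ≤ i → i ≤ N → i ∣ D) → ∀ m d → m + d < N → suc (m + d) * binom m d ∣ D
leibniz {D} all∣ zero d lt = subst (_∣ D) (sym (*-identityʳ (suc d))) (all∣ (s≤s z≤n) lt)
leibniz {D} {N} all∣ (suc m) d lt
  with leibniz all∣ m d (<-trans (n<1+n (m + d)) lt) | leibniz all∣ m (suc d) (subst (_< N) (sym (+-suc m d)) lt)
... | divides q D≡q | divides r D≡r = divides (q ∸ r) (sym (begin
    (q ∸ r) * (n₂ * z) ≡⟨ *-assoc (q ∸ r) n₂ z ⟨
    (q ∸ r) * n₂ * z ≡⟨ cong (_* z) (*-distribʳ-∸ n₂ q r) ⟩
    (q * n₂ ∸ r * n₂) * z ≡⟨ cong (λ k → (q * n₂ ∸ k) * z) r-eq ⟩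
    (q * n₂ ∸ suc d * q) * z ≡⟨ cong (λ k → (k ∸ suc d * q) * z) (split q m d) ⟩
    (suc m * q + suc d * q ∸ suc d * q) * z ≡⟨ cong (_* z) (m+n∸n≡m (suc m * q) (suc d * q)) ⟩
    suc m * q * z ≡⟨ swap-mul (suc m) q z ⟩
    q * (suc m * z) ≡⟨ cong (q *_) (binom-absorbˡ m d) ⟩
    q * c ≡⟨ D≡q ⟨
    D ∎))
  where
  open ≡-Reasoning
  n₂ = suc (suc (m + d))
  z  = binom (suc m) d
  y  = binom m (suc d)
  c  = suc (m + d) * binom m d
  split : ∀ q m d → q * suc (suc (m + d)) ≡ suc m * q + suc d * q
  split = solve-∀
  swap-mul : ∀ a q z → a * q * z ≡ q * (a * z)
  swap-mul = solve-∀
  r-eq : r * n₂ ≡ suc d * q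
  r-eq = *-cancelʳ-≡ (r * n₂) (suc d * q) c {{>-nonZero (1≤* {suc (m + d)} (s≤s z≤n) (binom≥1 m d))}} (begin
    r * n₂ * c ≡⟨ cong (r * n₂ *_) (binom-absorbʳ m d) ⟨
    r * n₂ * (suc d * y) ≡⟨ rearrange r n₂ (suc d) y ⟩
    suc d * (r * (n₂ * y)) ≡⟨ cong (λ k → suc d * (r * (suc k * y))) (+-suc m d) ⟨
    suc d * (r * (suc (m + suc d) * y)) ≡⟨ cong (suc d *_) (trans (sym D≡r) D≡q) ⟩
    suc d * (q * c) ≡⟨ *-assoc (suc d) q c ⟨
    suc d * q * c ∎)
    where
    rearrange : ∀ r n e y → r * n * (e * y) ≡ e * (r * (n * y))
    rearrange = solve-∀

-- Uses the central entry of Leibniz's triangle: (2m + 1) C(2m, m) divides the lcm and is at least 2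
-- ^ m.
2^≤lcmUpTo : ∀ m {N} → m + m < N → 2 ^ m ≤ lcmUpTo N
2^≤lcmUpTo m {N} lt = begin
  2 ^ m ≤⟨ 2^≤binom m ⟩
  binom m m ≤⟨ m≤n*m (binom m m) (suc (m + m)) ⟩
  suc (m + m) * binom m m ≤⟨ ∣⇒≤′ 1≤lcm (leibniz (∣lcmUpTo {N}) m m lt) ⟩
  lcmUpTo N ∎
  where
  open ≤-Reasoning
  1≤product : ∀ {xs} → (∀ {x} → x ∈ xs → 1 ≤ x) → 1 ≤ product xs
  1≤product {[]} _ = ≤-refl
  1≤product {x ∷ xs} p = 1≤* (p (here refl)) (1≤product {xs} (p ∘ there))
  1≤lcm : 1 ≤ lcmUpTo N
  1≤lcm = 1≤product {map (λ p → p ^ logFloor p N N) (primes N)} λ x∈ → case ∈-map⁻ (λ p → p ^ logFloor p N N) x∈ of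
    λ { (p , p∈ , refl) → m^n>0 p {{prime⇒nonZero (proj₂ (∈-filter⁻ prime? {xs = range1 N} p∈))}} (logFloor p N N) }

half : ∀ N → ∃[ m ] (m + m ≤ N × N ≤ suc (m + m))
half zero  = 0 , z≤n , z≤n
half (suc zero) = 0 , z≤n , ≤-refl
half (suc (suc N)) = let m , lo , hi = half N in
  suc m , subst (_≤ suc (suc N)) (sym (cong suc (+-suc m m))) (s≤s (s≤s lo)) , subst (suc (suc N) ≤_) (sym (cong (suc ∘ suc) (+-suc m m))) (s≤s (s≤s hi))

-- A weak form of Chebyshev's lower bound for the number of primes.
primes-dense : ∀ y k → y ≤ 2 ^ k → y ≤ 3 + 2 * (k * length (primes (y ∸ 1)))
primes-dense zero k _ = z≤n
primes-dense (suc zero) k _ = s≤s z≤n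
primes-dense y@(suc (suc N)) k y≤ with half N
... | m , lo , hi = begin
  suc (suc N) ≤⟨ s≤s (s≤s hi) ⟩
  3 + (m + m) ≡⟨ cong (λ z → 3 + (m + z)) (+-identityʳ m) ⟨
  3 + 2 * m ≤⟨ +-monoʳ-≤ 3 (*-monoʳ-≤ 2 m≤) ⟩
  3 + 2 * (k * length (primes (suc N))) ∎
  where
  open ≤-Reasoning
  π = length (primes (suc N))
  m≤ : m ≤ k * π
  m≤ = 2^-cancel-≤ m (k * π) (begin
    2 ^ m ≤⟨ 2^≤lcmUpTo m (s≤s lo) ⟩
    lcmUpTo (suc N) ≤⟨ lcmUpTo≤ {suc N} (s≤s z≤n) ⟩
    suc N ^ π ≤⟨ ^-monoˡ-≤ π (≤-trans (n≤1+n (suc N)) y≤) ⟩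
    (2 ^ k) ^ π ≡⟨ ^-*-assoc 2 k π ⟩
    2 ^ (k * π) ∎)

-- Occurrences of a word in a random string

∑-concatMap : ∀ {a b} {A : Set a} {B : Set b} (f : A → List B) xs (F : B → ℕ) → ∑ (concatMap f xs) F ≡ ∑ xs (λ x → ∑ (f x) F)
∑-concatMap f [] F = refl
∑-concatMap f (x ∷ xs) F = trans (∑-++ (f x) (concatMap f xs) F) (cong (∑ (f x) F +_) (∑-concatMap f xs F))

length-allFin : ∀ n → length (allFin n) ≡ n
length-allFin n = length-tabulate {n = n} id

∑-allFin-const : ∀ n c → ∑ (allFin n) (λ _ → c) ≡ n * c
∑-allFin-const n c = trans (∑-const (allFin n) c) (cong (_* c) (length-allFin n))

∑-δ : ∀ {a} {A : Set a} {xs : List A} {x c} {F : A → ℕ} → Unique xs → x ∈ xs → F x ≡ c → (∀ {y} → y ∈ xs → y ≢ x → F y ≡ 0) → ∑ xs F ≡ c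
∑-δ {xs = x ∷ xs} {F = F} (nx ∷ u) (here refl) eq zeros = trans (cong₂ _+_ eq
  (trans (∑-cong xs (λ y∈ → zeros (there y∈) (λ { refl → All≢⇒∉ nx y∈ }))) (trans (∑-const xs 0) (*-zeroʳ (length xs))))) (+-identityʳ _)
∑-δ {xs = x ∷ xs} {F = F} (nx ∷ u) (there x∈) eq zeros = trans (cong (_+ ∑ xs F) (zeros (here refl) (λ { refl → All≢⇒∉ nx x∈ })))
  (∑-δ u x∈ eq (zeros ∘ there))

module _ {g : ℕ} where

  Word : Set
  Word = List (Fin g)

  strings : ℕ → List Word
  strings zero  = [] ∷ []
  strings (suc ℓ) = concatMap (λ x → map (x ∷_) (strings ℓ)) (allFin g)

  ∑-strings-suc : ∀ ℓ (F : Word → ℕ) → ∑ (strings (suc ℓ)) F ≡ ∑ (allFin g) (λ x → ∑ (strings ℓ) (λ s → F (x ∷ s)))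
  ∑-strings-suc ℓ F = trans (∑-concatMap (λ x → map (x ∷_) (strings ℓ)) (allFin g) F)
    (∑-cong (allFin g) (λ {x} _ → ∑-map (x ∷_) (strings ℓ) F))

  ∑-strings-+ : ∀ k ℓ (F : Word → ℕ) → ∑ (strings (k + ℓ)) F ≡ ∑ (strings k) (λ u → ∑ (strings ℓ) (λ s → F (u ++ s)))
  ∑-strings-+ zero ℓ F = sym (+-identityʳ _)
  ∑-strings-+ (suc k) ℓ F = trans (∑-strings-suc (k + ℓ) F)
    (trans (∑-cong (allFin g) (λ {x} _ → ∑-strings-+ k ℓ (F ∘ (x ∷_))))
           (sym (∑-strings-suc k (λ u → ∑ (strings ℓ) (λ s → F (u ++ s))))))

  length-strings : ∀ ℓ → length (strings ℓ) ≡ g ^ ℓ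
  length-strings zero  = refl
  length-strings (suc ℓ) = trans (length≡∑1 (strings (suc ℓ))) (trans (∑-strings-suc ℓ (λ _ → 1))
    (trans (∑-allFin-const g _) (cong (g *_) (trans (sym (length≡∑1 (strings ℓ))) (length-strings ℓ)))))

  ∈-strings : ∀ s → s ∈ strings (length s)
  ∈-strings []  = here refl
  ∈-strings (x ∷ s) = ∈-concatMap (λ x → map (x ∷_) (strings (length s))) {allFin g} (∈-allFin x) (∈-map⁺ (x ∷_) (∈-strings s))

  ∈-strings⁻ : ∀ ℓ {s} → s ∈ strings ℓ → length s ≡ ℓ
  ∈-strings⁻ zero (here refl) = refl
  ∈-strings⁻ (suc ℓ) {s} s∈ with ∈-concat⁻′ (map (λ x → map (x ∷_) (strings ℓ)) (allFin g)) s∈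
  ... | ys , s∈ys , ys∈ with ∈-map⁻ (λ x → map (x ∷_) (strings ℓ)) ys∈
  ... | x , _ , refl with ∈-map⁻ (x ∷_) s∈ys
  ... | s′ , s′∈ , refl = cong suc (∈-strings⁻ ℓ s′∈)

  starts : Word → Word → ℕ
  starts w s = if startsWith w s then 1 else 0

  starts≤1 : ∀ w s → starts w s ≤ 1
  starts≤1 w s with startsWith w s
  ... | true  = ≤-refl
  ... | false = z≤n

  starts-++ : ∀ w u s → length w ≤ length u → starts w (u ++ s) ≡ starts w u
  starts-++ [] u s le = refl
  starts-++ (a ∷ w) (x ∷ u) s (s≤s le) with does (a Fin.≟ x)
  ... | true  = starts-++ w u s le
  ... | false = refl

  starts-∷-≢ : ∀ a w x s → a ≢ x → starts (a ∷ w) (x ∷ s) ≡ 0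
  starts-∷-≢ a w x s a≢x with a Fin.≟ x
  ... | yes eq = contradiction eq a≢x
  ... | no  _  = refl

  starts-∷ : ∀ a w s → starts (a ∷ w) (a ∷ s) ≡ starts w s
  starts-∷ a w s with a Fin.≟ a
  ... | yes _  = refl
  ... | no  a≢ = contradiction refl a≢

  ∑-starts : ∀ w → ∑ (strings (length w)) (starts w) ≡ 1
  ∑-starts []  = refl
  ∑-starts (a ∷ w) = trans (∑-strings-suc (length w) (starts (a ∷ w))) (∑-δ (Unique.allFin⁺ g) (∈-allFin a)
    (trans (∑-cong (strings (length w)) (λ {s} _ → starts-∷ a w s)) (∑-starts w))
    (λ {x} _ x≢a → trans (∑-cong (strings (length w)) (λ {s} _ → starts-∷-≢ a w x s (x≢a ∘ sym))) (trans (∑-const (strings (length w)) 0) (*-zeroʳ (length (strings (length w)))))))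

  ∑-words-starts : ∀ k s → k ≤ length s → ∑ (strings k) (λ w → starts w s) ≡ 1
  ∑-words-starts zero s le = refl
  ∑-words-starts (suc k) (x ∷ s) (s≤s le) = trans (∑-strings-suc k (λ w → starts w (x ∷ s))) (∑-δ (Unique.allFin⁺ g) (∈-allFin x)
    (trans (∑-cong (strings k) (λ {w} _ → starts-∷ x w s)) (∑-words-starts k s le))
    (λ {a} _ a≢x → trans (∑-cong (strings k) (λ {w} _ → starts-∷-≢ a w x s a≢x)) (trans (∑-const (strings k) 0) (*-zeroʳ (length (strings k))))))

  -- Every position, except fewer than k at the end, begins exactly one word of length k. This is
  -- how upper bounds for all words turn into a lower bound for each.
  ∑-words-occ : ∀ k s → length s ≤ ∑ (strings k) (λ w → occ w s) + k
  ∑-words-occ k [] = z≤n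
  ∑-words-occ k (x ∷ s) with k ≤? suc (length s)
  ... | no  k≰ = ≤-trans (<⇒≤ (≰⇒> k≰)) (m≤n+m k _)
  ... | yes k≤ = begin
    suc (length s) ≤⟨ s≤s (∑-words-occ k s) ⟩
    1 + (∑ (strings k) (λ w → occ w s) + k) ≡⟨ +-assoc 1 _ k ⟨
    1 + ∑ (strings k) (λ w → occ w s) + k ≡⟨ cong (λ z → z + ∑ (strings k) (λ w → occ w s) + k) (∑-words-starts k (x ∷ s) k≤) ⟨
    ∑ (strings k) (λ w → starts w (x ∷ s)) + ∑ (strings k) (λ w → occ w s) + k  ≡⟨ cong (_+ k) (∑-+ (strings k) _ _) ⟨
    ∑ (strings k) (λ w → occ w (x ∷ s)) + k ∎
    where open ≤-Reasoning

  length-drop-≤ : ∀ {n m} (s : Word) → length s ≤ n + m → length (drop n s) ≤ m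
  length-drop-≤ {zero}  s le  = le
  length-drop-≤ {suc n} [] le  = z≤n
  length-drop-≤ {suc n} (x ∷ s) (s≤s le) = length-drop-≤ {n} s le

  drop-++ : ∀ n (u s : Word) → length u ≡ n → drop n (u ++ s) ≡ s
  drop-++ zero [] s eq = refl
  drop-++ (suc n) (x ∷ u) s eq = drop-++ n u s (suc-injective eq)

  ∑-strings-drop : ∀ c ℓ (F : Word → ℕ) → ∑ (strings (c + ℓ)) (F ∘ drop c) ≡ g ^ c * ∑ (strings ℓ) F
  ∑-strings-drop c ℓ F = trans (∑-strings-+ c ℓ (F ∘ drop c))
    (trans (∑-cong (strings c) (λ {u} u∈ → ∑-cong (strings ℓ) (λ {s} _ → cong F (drop-++ c u s (∈-strings⁻ c u∈)))))
    (trans (∑-const (strings c) (∑ (strings ℓ) F)) (cong (_* ∑ (strings ℓ) F) (length-strings c))))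

  -- Occurrences of w at the positions congruent to the phase c modulo the length suc k of w.
  aligned : Word → (k c : ℕ) → Word → ℕ
  aligned w k c []  = 0
  aligned w k zero (x ∷ xs) = starts w (x ∷ xs) + aligned w k k xs
  aligned w k (suc c) (x ∷ xs) = aligned w k c xs

  ∑aligned : Word → (k n : ℕ) → Word → ℕ
  ∑aligned w k zero s = 0
  ∑aligned w k (suc n) s = aligned w k n s + ∑aligned w k n s

  ∑aligned-∷ : ∀ w k n x s → ∑aligned w k (suc n) (x ∷ s) ≡ starts w (x ∷ s) + (aligned w k k s + ∑aligned w k n s)
  ∑aligned-∷ w k zero x s = trans (+-identityʳ _) (cong (starts w (x ∷ s) +_) (sym (+-identityʳ _)))
  ∑aligned-∷ w k (suc n) x s = trans (cong (aligned w k n s +_) (∑aligned-∷ w k n x s))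
    (rearrange (aligned w k n s) (starts w (x ∷ s)) (aligned w k k s) (∑aligned w k n s))
    where
    rearrange : ∀ a b c d → a + (b + (c + d)) ≡ b + (c + (a + d))
    rearrange = solve-∀

  -- Overlapping occurrences are not independent, but those of one phase occupy disjoint blocks; the
  -- Chernoff argument is therefore run phase by phase.
  occ≡∑aligned : ∀ w k s → occ w s ≡ ∑aligned w k (suc k) s
  occ≡∑aligned w k []  = sym (vanish (suc k))
    where
    vanish : ∀ n → ∑aligned w k n [] ≡ 0
    vanish zero  = refl
    vanish (suc n) = vanish n
  occ≡∑aligned w k (x ∷ s) = trans (cong (starts w (x ∷ s) +_) (occ≡∑aligned w k s)) (sym (∑aligned-∷ w k k x s))

  aligned-drop : ∀ w k c s → aligned w k c s ≡ aligned w k 0 (drop c s)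
  aligned-drop w k zero s  = refl
  aligned-drop w k (suc c) []  = refl
  aligned-drop w k (suc c) (x ∷ s) = aligned-drop w k c s

  aligned≤length : ∀ w k c s → aligned w k c s ≤ length s
  aligned≤length w k c []  = z≤n
  aligned≤length w k zero (x ∷ s) = +-mono-≤ (starts≤1 w (x ∷ s)) (aligned≤length w k k s)
  aligned≤length w k (suc c) (x ∷ s) = ≤-trans (aligned≤length w k c s) (n≤1+n _)

  hits : Word → (k B : ℕ) → Word → ℕ
  hits w k zero s = 0
  hits w k (suc B) s = starts w s + hits w k B (drop k s)

  aligned≤hits : ∀ w k B s → aligned w k 0 s ≤ hits w (suc k) B s + length (drop (suc k * B) s)
  aligned≤hits w k zero s = subst (λ n → aligned w k 0 s ≤ length (drop n s)) (sym (*-zeroʳ (suc k))) (aligned≤length w k 0 s)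
  aligned≤hits w k (suc B) []  = z≤n
  aligned≤hits w k (suc B) (x ∷ s) = begin
    starts w (x ∷ s) + aligned w k k s
      ≡⟨ cong (starts w (x ∷ s) +_) (aligned-drop w k k s) ⟩
    starts w (x ∷ s) + aligned w k 0 (drop k s)
      ≤⟨ +-monoʳ-≤ (starts w (x ∷ s)) (aligned≤hits w k B (drop k s)) ⟩
    starts w (x ∷ s) + (hits w (suc k) B (drop k s) + length (drop (suc k * B) (drop k s)))
      ≡⟨ +-assoc (starts w (x ∷ s)) _ _ ⟨
    starts w (x ∷ s) + hits w (suc k) B (drop k s) + length (drop (suc k * B) (drop k s))
      ≡⟨ cong (λ r → starts w (x ∷ s) + hits w (suc k) B (drop k s) + length r) (drop-drop k (suc k * B) s) ⟩
    starts w (x ∷ s) + hits w (suc k) B (drop k s) + length (drop (k + suc k * B) s)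
      ≡⟨ cong (λ n → starts w (x ∷ s) + hits w (suc k) B (drop k s) + length (drop n (x ∷ s))) (*-suc (suc k) B) ⟨
    hits w (suc k) (suc B) (x ∷ s) + length (drop (suc k * suc B) (x ∷ s)) ∎
    where open ≤-Reasoning

  -- The moment generating function at 1 + 1/h, scaled by h ^ B to stay integral: its value is h ^ B
  -- (1 + 1/h) ^ hits.
  weight : Word → (k h B : ℕ) → Word → ℕ
  weight w k h zero s = 1
  weight w k h (suc B) s = (h + starts w s) * weight w k h B (drop k s)

  weight-hits : ∀ w k h B s → h ^ hits w k B s * weight w k h B s ≡ suc h ^ hits w k B s * h ^ B
  weight-hits w k h zero s = refl
  weight-hits w k h (suc B) s with startsWith w s | weight-hits w k h B (drop k s)
  ... | true  | ih = trans (lhs h (h ^ hits w k B (drop k s)) (weight w k h B (drop k s))) (trans (cong (λ z → h * suc h * z) ih) (rhs h (suc h ^ hits w k B (drop k s)) (h ^ B)))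
    where
    lhs : ∀ h x y → h * x * ((h + 1) * y) ≡ h * suc h * (x * y)
    lhs = solve-∀
    rhs : ∀ h x y → h * suc h * (x * y) ≡ suc h * x * (h * y)
    rhs = solve-∀
  ... | false | ih = trans (lhs h (h ^ hits w k B (drop k s)) (weight w k h B (drop k s))) (trans (cong (h *_) ih) (*-swapˡ h (suc h ^ hits w k B (drop k s)) (h ^ B)))
    where
    lhs : ∀ h x y → x * ((h + 0) * y) ≡ h * (x * y)
    lhs = solve-∀

  -- The blocks are independent: summing h + [block = w] over one block gives g ^ |w| h + 1, and the
  -- last r letters are free.
  ∑-weight : ∀ w h B r → ∑ (strings (B * length w + r)) (weight w (length w) h B) ≡ suc (g ^ length w * h) ^ B * g ^ r
  ∑-weight w h zero r = trans (sym (length≡∑1 (strings r))) (trans (length-strings r) (sym (+-identityʳ _)))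
  ∑-weight w h (suc B) r = begin
    ∑ (strings (k + B * k + r)) (weight w k h (suc B))
      ≡⟨ cong (λ n → ∑ (strings n) (weight w k h (suc B))) (+-assoc k (B * k) r) ⟩
    ∑ (strings (k + (B * k + r))) (weight w k h (suc B))
      ≡⟨ ∑-strings-+ k (B * k + r) (weight w k h (suc B)) ⟩
    ∑ (strings k) (λ u → ∑ (strings (B * k + r)) (λ s → (h + starts w (u ++ s)) * weight w k h B (drop k (u ++ s))))
      ≡⟨ ∑-cong (strings k) (λ {u} u∈ → ∑-cong (strings (B * k + r)) (λ {s} _ → cong₂ (λ a t → (h + a) * weight w k h B t)
           (starts-++ w u s (≤-reflexive (sym (∈-strings⁻ k u∈)))) (drop-++ k u s (∈-strings⁻ k u∈)))) ⟩
    ∑ (strings k) (λ u → ∑ (strings (B * k + r)) (λ s → (h + starts w u) * weight w k h B s))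
      ≡⟨ ∑-cong (strings k) (λ {u} _ → ∑-*ˡ (strings (B * k + r)) (h + starts w u) (weight w k h B)) ⟩
    ∑ (strings k) (λ u → (h + starts w u) * ∑ (strings (B * k + r)) (weight w k h B))
      ≡⟨ ∑-*ʳ (strings k) _ (λ u → h + starts w u) ⟩
    ∑ (strings k) (λ u → h + starts w u) * ∑ (strings (B * k + r)) (weight w k h B)
      ≡⟨ cong₂ _*_ total (∑-weight w h B r) ⟩
    suc (g ^ k * h) * (suc (g ^ k * h) ^ B * g ^ r)
      ≡⟨ *-assoc (suc (g ^ k * h)) (suc (g ^ k * h) ^ B) (g ^ r) ⟨
    suc (g ^ k * h) ^ suc B * g ^ r ∎
    where
    open ≡-Reasoning
    k = length w
    total : ∑ (strings k) (λ u → h + starts w u) ≡ suc (g ^ k * h)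
    total = trans (∑-+ (strings k) (λ _ → h) (starts w))
      (trans (cong₂ _+_ (trans (∑-const (strings k) h) (cong (_* h) (length-strings k))) (∑-starts w)) (+-comm _ 1))

-- The Chernoff bound

-- (1 + 1/N) ^ b ≤ (N + 1) / (N + 1 - b)
reverse-bernoulli : ∀ N b M → M + b ≤ suc N → suc N ^ b * M ≤ N ^ b * suc N
reverse-bernoulli N zero M le = ≤-trans (≤-reflexive (+-identityʳ M)) (≤-trans (≤-trans (m≤m+n M 0) le) (≤-reflexive (sym (+-identityʳ (suc N)))))
reverse-bernoulli N (suc b) M le = begin
  suc N * suc N ^ b * M ≡⟨ lhs (suc N) (suc N ^ b) M ⟩
  suc N ^ b * (suc N * M) ≤⟨ *-monoʳ-≤ (suc N ^ b) (+-monoˡ-≤ (N * M) M≤N) ⟩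
  suc N ^ b * (N + N * M) ≡⟨ mid (suc N ^ b) N M ⟩
  N * (suc N ^ b * suc M) ≤⟨ *-monoʳ-≤ N (reverse-bernoulli N b (suc M) (subst (_≤ suc N) (+-suc M b) le)) ⟩
  N * (N ^ b * suc N) ≡⟨ *-assoc N (N ^ b) (suc N) ⟨
  N * N ^ b * suc N ∎
  where
  open ≤-Reasoning
  M≤N : M ≤ N
  M≤N = ≤-pred (≤-trans (≤-reflexive (+-comm 1 M)) (≤-trans (+-monoʳ-≤ M (s≤s z≤n)) le))
  lhs : ∀ x y z → x * y * z ≡ y * (x * z)
  lhs = solve-∀
  mid : ∀ x N M → x * (N + N * M) ≡ N * (x * suc M)
  mid = solve-∀

bernoulli : ∀ Q e → Q ^ e * (Q + e) ≤ suc Q ^ e * Q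
bernoulli Q zero  = ≤-reflexive (cong (1 *_) (+-identityʳ Q))
bernoulli Q (suc e) = begin
  Q * Q ^ e * (Q + suc e) ≤⟨ m≤m+n _ (Q ^ e * e) ⟩
  Q * Q ^ e * (Q + suc e) + Q ^ e * e ≡⟨ expand Q (Q ^ e) e ⟩
  suc Q * (Q ^ e * (Q + e)) ≤⟨ *-monoʳ-≤ (suc Q) (bernoulli Q e) ⟩
  suc Q * (suc Q ^ e * Q) ≡⟨ *-assoc (suc Q) (suc Q ^ e) Q ⟨
  suc Q * suc Q ^ e * Q ∎
  where
  open ≤-Reasoning
  expand : ∀ Q x e → Q * x * (Q + suc e) + x * e ≡ suc Q * (x * (Q + e))
  expand = solve-∀

^-distribʳ-* : ∀ m n o → (m * n) ^ o ≡ m ^ o * n ^ o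
^-distribʳ-* m n zero  = refl
^-distribʳ-* m n (suc o) = trans (cong (m * n *_) (^-distribʳ-* m n o)) (rearrange m n (m ^ o) (n ^ o))
  where
  rearrange : ∀ a b c d → a * b * (c * d) ≡ a * c * (b * d)
  rearrange = solve-∀

-- A strict inequality of integers already gives (P / Q) ^ Q ≥ (1 + 1/Q) ^ Q ≥ 2, and so an
-- exponential saving.
power-gap : ∀ {P Q} n → 1 ≤ Q → Q < P → 2 ^ n * Q ^ (Q * n) ≤ P ^ (Q * n)
power-gap {P} {Q} n 1≤Q lt = begin
  2 ^ n * Q ^ (Q * n) ≡⟨ cong (2 ^ n *_) (^-*-assoc Q Q n) ⟨
  2 ^ n * (Q ^ Q) ^ n ≡⟨ ^-distribʳ-* 2 (Q ^ Q) n ⟨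
  (2 * Q ^ Q) ^ n ≤⟨ ^-monoˡ-≤ n double ⟩
  (P ^ Q) ^ n ≡⟨ ^-*-assoc P Q n ⟩
  P ^ (Q * n) ∎
  where
  open ≤-Reasoning
  double : 2 * Q ^ Q ≤ P ^ Q
  double = *-cancelʳ-≤ _ _ Q {{>-nonZero 1≤Q}} (begin
    2 * Q ^ Q * Q ≡⟨ rearrange (Q ^ Q) Q ⟩
    Q ^ Q * (Q + Q) ≤⟨ bernoulli Q Q ⟩
    suc Q ^ Q * Q ≤⟨ *-monoˡ-≤ Q (^-monoˡ-≤ Q lt) ⟩
    P ^ Q * Q ∎)
    where
    rearrange : ∀ x q → 2 * x * q ≡ x * (q + q)
    rearrange = solve-∀

-- The Chernoff exponent is positive: with z = 1 + 1/h and h = 2m, the mean (1 + 1/(bh)) of z ^ [hit] over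
-- one block is less than z ^ ((1 + 1/m) / b).
chernoff-gap : ∀ b m → 1 ≤ b → 1 ≤ m → let h = 2 * m in
  h ^ suc m * suc (b * h) ^ (b * m) < suc h ^ suc m * (b * h) ^ (b * m)
chernoff-gap b@(suc _) m@(suc m′) _ _ = *-cancelʳ-< _ _ _ (begin-strict
  h ^ suc m * suc (b * h) ^ (b * m) * i ^ m ≡⟨ *-assoc (h ^ suc m) _ _ ⟩
  h ^ suc m * (suc (b * h) ^ (b * m) * i ^ m) ≤⟨ *-monoʳ-≤ (h ^ suc m) mean^m ⟩
  h ^ suc m * ((b * h) ^ (b * m) * h ^ m) ≡⟨ rearr₁ h (h ^ m) ((b * h) ^ (b * m)) ⟩
  (b * h) ^ (b * m) * (h * (h ^ m * h ^ m)) <⟨ *-monoʳ-< ((b * h) ^ (b * m)) {{m^n≢0 (b * h) (b * m)}} squares ⟩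
  (b * h) ^ (b * m) * (suc h * (suc h ^ m * i ^ m)) ≡⟨ rearr₂ (suc h) (suc h ^ m) (i ^ m) ((b * h) ^ (b * m)) ⟩
  suc h ^ suc m * (b * h) ^ (b * m) * i ^ m ∎)
  where
  open ≤-Reasoning
  h = 2 * m
  i = m′ + (m + 0)
  rearr₁ : ∀ h x y → h * x * (y * x) ≡ y * (h * (x * x))
  rearr₁ = solve-∀
  rearr₂ : ∀ s x y z → z * (s * (x * y)) ≡ s * x * z * y
  rearr₂ = solve-∀
  -- Here i = h - 1, and the claim is (1 + 1/(b h)) ^ b ≤ h / (h - 1): `reverse-bernoulli` with N =
  -- b h removes b and leaves an inequality in m alone.
  mean : suc (b * h) ^ b * i ≤ (b * h) ^ b * h
  mean = *-cancelʳ-≤ _ _ (suc (b * h)) (begin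
    suc (b * h) ^ b * i * suc (b * h) ≡⟨ *-assoc (suc (b * h) ^ b) i _ ⟩
    suc (b * h) ^ b * (i * suc (b * h)) ≤⟨ *-monoʳ-≤ (suc (b * h) ^ b) (≤-trans (n≤1+n _) (≤-reflexive (arith b i))) ⟩
    suc (b * h) ^ b * (h * suc (b * i)) ≡⟨ swap-mul (suc (b * h) ^ b) h (suc (b * i)) ⟩
    suc (b * h) ^ b * suc (b * i) * h ≤⟨ *-monoˡ-≤ h (reverse-bernoulli (b * h) b (suc (b * i)) (≤-reflexive (arith′ b i))) ⟩
    (b * h) ^ b * suc (b * h) * h ≡⟨ swap-mul′ ((b * h) ^ b) (suc (b * h)) h ⟩
    (b * h) ^ b * h * suc (b * h) ∎)
    where
    arith : ∀ b i → suc (i * suc (b * suc i)) ≡ suc i * suc (b * i)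
    arith = solve-∀
    arith′ : ∀ b i → suc (b * i) + b ≡ suc (b * suc i)
    arith′ = solve-∀
    swap-mul : ∀ x y z → x * (y * z) ≡ x * z * y
    swap-mul = solve-∀
    swap-mul′ : ∀ x y z → x * y * z ≡ x * z * y
    swap-mul′ = solve-∀
  mean^m : suc (b * h) ^ (b * m) * i ^ m ≤ (b * h) ^ (b * m) * h ^ m
  mean^m = begin
    suc (b * h) ^ (b * m) * i ^ m ≡⟨ cong (_* i ^ m) (^-*-assoc (suc (b * h)) b m) ⟨
    (suc (b * h) ^ b) ^ m * i ^ m ≡⟨ ^-distribʳ-* (suc (b * h) ^ b) i m ⟨
    (suc (b * h) ^ b * i) ^ m ≤⟨ ^-monoˡ-≤ m mean ⟩
    ((b * h) ^ b * h) ^ m ≡⟨ ^-distribʳ-* ((b * h) ^ b) h m ⟩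
    ((b * h) ^ b) ^ m * h ^ m ≡⟨ cong (_* h ^ m) (^-*-assoc (b * h) b m) ⟩
    (b * h) ^ (b * m) * h ^ m ∎
  -- N = h ^ 2 - 1 and M = h ^ 2 - m, so `reverse-bernoulli` bounds (h ^ 2 / (h ^ 2 - 1)) ^ m by h ^
  -- 2 / (h ^ 2 - m). For h = 2 m this is less than (h + 1) / h, which is `h³<`.
  N = suc h * i
  M = m * (m′ + (m + (m + (m + 0))))
  1+N≡h² : suc N ≡ h * h
  1+N≡h² = identity i
    where
    identity : ∀ i → suc (suc (suc i) * i) ≡ suc i * suc i
    identity = solve-∀
  M+m≡ : M + m ≡ suc N
  M+m≡ = trans (identity m′) (sym 1+N≡h²)
    where
    identity : ∀ m′ → suc m′ * (m′ + (suc m′ + (suc m′ + (suc m′ + 0)))) + suc m′ ≡ (2 * suc m′) * (2 * suc m′)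
    identity = solve-∀
  h³< : h * (h * h) < suc h * M
  h³< = ≤-trans (m≤m+n _ _) (≤-reflexive (identity m′))
    where
    identity : ∀ m′ → suc ((2 * suc m′) * ((2 * suc m′) * (2 * suc m′))) + (m′ + m′ * suc m′ * 2) ≡ suc (2 * suc m′) * (suc m′ * (m′ + (suc m′ + (suc m′ + (suc m′ + 0)))))
    identity = solve-∀
  squares : h * (h ^ m * h ^ m) < suc h * (suc h ^ m * i ^ m)
  squares = subst₂ _<_ (cong (h *_) (^-distribʳ-* h h m)) (cong (suc h *_) (^-distribʳ-* (suc h) i m))
    (*-cancelʳ-< _ _ _ (begin-strict
      h * (h * h) ^ m * M ≡⟨ cong (λ z → h * z ^ m * M) 1+N≡h² ⟨
      h * suc N ^ m * M ≡⟨ *-assoc h (suc N ^ m) M ⟩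
      h * (suc N ^ m * M) ≤⟨ *-monoʳ-≤ h (reverse-bernoulli N m M (≤-reflexive M+m≡)) ⟩
      h * (N ^ m * suc N) ≡⟨ cong (λ z → h * (N ^ m * z)) 1+N≡h² ⟩
      h * (N ^ m * (h * h)) ≡⟨ *-swapˡ h (N ^ m) (h * h) ⟩
      N ^ m * (h * (h * h)) <⟨ *-monoʳ-< (N ^ m) {{m^n≢0 N m {{N≢0}}}} h³< ⟩
      N ^ m * (suc h * M) ≡⟨ rearr₄ (N ^ m) (suc h) M ⟩
      suc h * N ^ m * M ∎))
    where
    N≢0 : NonZero N
    N≢0 = >-nonZero (1≤* {suc h} {i} (s≤s z≤n) (≤-trans (s≤s z≤n) (m≤n+m (m + 0) m′)))
    rearr₄ : ∀ x y z → x * (y * z) ≡ y * x * z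
    rearr₄ = solve-∀

^-cancel-≤ : ∀ n {x y} → x ^ suc n ≤ y ^ suc n → x ≤ y
^-cancel-≤ n {x} {y} le with x ≤? y
... | yes x≤y = x≤y
... | no  x≰y = contradiction le (<⇒≱ (^-monoˡ-< (suc n) (≰⇒> x≰y)))

-- Serves as Markov's inequality: the number of strings times the least weight is at most the total
-- weight, so only the lightest string has to be estimated.
belowAverage : ∀ {a} {A : Set a} (f : A → ℕ) x xs → ∃[ y ] y ∈ x ∷ xs × length (x ∷ xs) * f y ≤ ∑ (x ∷ xs) f
belowAverage f x []  = x , here refl , ≤-refl
belowAverage f x (x′ ∷ xs) with belowAverage f x′ xs
... | y , y∈ , le with ≤-total (f x) (f y)
... | inj₁ fx≤ = x , here refl , +-monoʳ-≤ (f x) (≤-trans (*-monoʳ-≤ (length (x′ ∷ xs)) fx≤) le)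
... | inj₂ fy≤ = y , there y∈ , +-mono-≤ fy≤ le

-- W is the weight h ^ B (1 + 1/h) ^ a of a string with a hits, and the claim reads (1 + 1/h) ^ E ≤
-- (W / h ^ B) ^ n (h + 1) ^ K: the last factor pays for the possible deficit K of n a against E.
tilt : ∀ {h} a W B n K E → 1 ≤ h → h ^ a * W ≡ suc h ^ a * h ^ B → E ≤ n * a + K →
  suc h ^ E * h ^ (n * B) ≤ W ^ n * h ^ E * suc h ^ K
tilt {h} a W B n K E 1≤h eq E≤ with m≤n⇒∃[o]m+o≡n E≤
... | d , E+d≡ = *-cancelʳ-≤ _ _ (h ^ (n * a)) {{m^n≢0 h (n * a) {{>-nonZero 1≤h}}}} (begin
  suc h ^ E * h ^ (n * B) * h ^ (n * a) ≤⟨ *-monoʳ-≤ (suc h ^ E * h ^ (n * B)) (^-monoʳ-≤ h {{>-nonZero 1≤h}} (m≤m+n (n * a) K)) ⟩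
  suc h ^ E * h ^ (n * B) * h ^ (n * a + K) ≡⟨ cong (λ e → suc h ^ E * h ^ (n * B) * h ^ e) E+d≡ ⟨
  suc h ^ E * h ^ (n * B) * h ^ (E + d) ≡⟨ cong (suc h ^ E * h ^ (n * B) *_) (^-distribˡ-+-* h E d) ⟩
  suc h ^ E * h ^ (n * B) * (h ^ E * h ^ d) ≤⟨ *-monoʳ-≤ (suc h ^ E * h ^ (n * B)) (*-monoʳ-≤ (h ^ E) (^-monoˡ-≤ d (n≤1+n h))) ⟩
  suc h ^ E * h ^ (n * B) * (h ^ E * suc h ^ d) ≡⟨ rearr₁ (suc h ^ E) (h ^ (n * B)) (h ^ E) (suc h ^ d) ⟩
  suc h ^ E * suc h ^ d * h ^ (n * B) * h ^ E ≡⟨ cong (λ z → z * h ^ (n * B) * h ^ E) (trans (sym (^-distribˡ-+-* (suc h) E d)) (trans (cong (suc h ^_) E+d≡) (^-distribˡ-+-* (suc h) (n * a) K))) ⟩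
  suc h ^ (n * a) * suc h ^ K * h ^ (n * B) * h ^ E ≡⟨ rearr₂ (suc h ^ (n * a)) (suc h ^ K) (h ^ (n * B)) (h ^ E) ⟩
  suc h ^ (n * a) * h ^ (n * B) * (h ^ E * suc h ^ K)  ≡⟨ cong (_* (h ^ E * suc h ^ K)) powers ⟨
  h ^ (n * a) * W ^ n * (h ^ E * suc h ^ K) ≡⟨ rearr₃ (h ^ (n * a)) (W ^ n) (h ^ E) (suc h ^ K) ⟩
  W ^ n * h ^ E * suc h ^ K * h ^ (n * a) ∎)
  where
  open ≤-Reasoning
  rearr₁ : ∀ x y z u → x * y * (z * u) ≡ x * u * y * z
  rearr₁ = solve-∀
  rearr₂ : ∀ x y z u → x * y * z * u ≡ x * z * (u * y)
  rearr₂ = solve-∀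
  rearr₃ : ∀ x y z u → x * y * (z * u) ≡ y * z * u * x
  rearr₃ = solve-∀
  ^-*-flip : ∀ x e → (x ^ e) ^ n ≡ x ^ (n * e)
  ^-*-flip x e = trans (^-*-assoc x e n) (cong (x ^_) (*-comm e n))
  powers : h ^ (n * a) * W ^ n ≡ suc h ^ (n * a) * h ^ (n * B)
  powers = trans (cong (_* W ^ n) (sym (^-*-flip h a))) (trans (sym (^-distribʳ-* (h ^ a) W n)) (trans (cong (_^ n) eq)
    (trans (^-distribʳ-* (suc h ^ a) (h ^ B) n) (cong₂ _*_ (^-*-flip (suc h) a) (^-*-flip h B)))))

power-gap-floor : ∀ {P Q n} q .{{_ : NonZero q}} B → Q ≤ P → 2 ^ n * Q ^ q ≤ P ^ q → (2 ^ (B / q)) ^ n * Q ^ B ≤ P ^ B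
power-gap-floor {P} {Q} {n} q B Q≤P gap = begin
  (2 ^ β) ^ n * Q ^ B ≡⟨ cong₂ (λ x e → x * Q ^ e) (trans (^-*-assoc 2 β n) (trans (cong (2 ^_) (*-comm β n)) (sym (^-*-assoc 2 n β)))) B≡ ⟩
  (2 ^ n) ^ β * Q ^ (ρ + q * β) ≡⟨ cong ((2 ^ n) ^ β *_) (trans (^-distribˡ-+-* Q ρ (q * β)) (cong (Q ^ ρ *_) (sym (^-*-assoc Q q β)))) ⟩
  (2 ^ n) ^ β * (Q ^ ρ * (Q ^ q) ^ β) ≡⟨ *-swapˡ ((2 ^ n) ^ β) (Q ^ ρ) ((Q ^ q) ^ β) ⟩
  Q ^ ρ * ((2 ^ n) ^ β * (Q ^ q) ^ β) ≡⟨ cong (Q ^ ρ *_) (^-distribʳ-* (2 ^ n) (Q ^ q) β) ⟨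
  Q ^ ρ * (2 ^ n * Q ^ q) ^ β ≤⟨ *-mono-≤ (^-monoˡ-≤ ρ Q≤P) (^-monoˡ-≤ β gap) ⟩
  P ^ ρ * (P ^ q) ^ β ≡⟨ trans (^-distribˡ-+-* P ρ (q * β)) (cong (P ^ ρ *_) (sym (^-*-assoc P q β))) ⟨
  P ^ (ρ + q * β) ≡⟨ cong (P ^_) B≡ ⟨
  P ^ B ∎
  where
  open ≤-Reasoning
  β = B / q
  ρ = B % q
  B≡ : B ≡ ρ + q * β
  B≡ = trans (m≡m%n+[m/n]*n B q) (cong (ρ +_) (*-comm β q))

-- N W is at most the total weight, while `tilted` bounds W from below. The comparison is made
-- between n-th powers because the threshold (m + 1) B / n need not be an integer; the quotient of
-- the two sides is (P / Q) ^ B.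
chernoff-arith : ∀ N W B G b m h K β → let n = b * m ; Q = h ^ suc m * suc (b * h) ^ n ; P = suc h ^ suc m * (b * h) ^ n in
  1 ≤ n → 1 ≤ h → N * W ≤ suc (b * h) ^ B * G → (2 ^ β) ^ n * Q ^ B ≤ P ^ B →
  suc h ^ (suc m * B) * h ^ (n * B) ≤ W ^ n * h ^ (suc m * B) * suc h ^ K →
  N * 2 ^ β ≤ suc h ^ K * (b ^ B * G)
chernoff-arith N W B G b m h K β 1≤n 1≤h NW≤ gap tilted with b * m in n≡
... | suc n′ = ^-cancel-≤ n′ (*-cancelʳ-≤ _ _ (Q ^ B) {{m^n≢0 Q B {{Q≢0}}}} (begin
  (N * 2 ^ β) ^ n * Q ^ B ≡⟨ cong (_* Q ^ B) (^-distribʳ-* N (2 ^ β) n) ⟩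
  N ^ n * (2 ^ β) ^ n * Q ^ B ≡⟨ *-assoc (N ^ n) ((2 ^ β) ^ n) (Q ^ B) ⟩
  N ^ n * ((2 ^ β) ^ n * Q ^ B) ≤⟨ *-monoʳ-≤ (N ^ n) gap ⟩
  N ^ n * P ^ B ≡⟨ cong (N ^ n *_) (expandPower (suc h) (b * h)) ⟩
  N ^ n * (suc h ^ (suc m * B) * (b * h) ^ (n * B)) ≡⟨ cong (λ z → N ^ n * (suc h ^ (suc m * B) * z)) (^-distribʳ-* b h (n * B)) ⟩
  N ^ n * (suc h ^ (suc m * B) * (b ^ (n * B) * h ^ (n * B)))  ≡⟨ rearr₁ (N ^ n) (suc h ^ (suc m * B)) (b ^ (n * B)) (h ^ (n * B)) ⟩
  N ^ n * b ^ (n * B) * (suc h ^ (suc m * B) * h ^ (n * B)) ≤⟨ *-monoʳ-≤ (N ^ n * b ^ (n * B)) tilted ⟩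
  N ^ n * b ^ (n * B) * (W ^ n * h ^ (suc m * B) * suc h ^ K)  ≡⟨ rearr₂ (N ^ n) (b ^ (n * B)) (W ^ n) (h ^ (suc m * B)) (suc h ^ K) ⟩
  N ^ n * W ^ n * (b ^ (n * B) * h ^ (suc m * B) * suc h ^ K)  ≡⟨ cong (_* (b ^ (n * B) * h ^ (suc m * B) * suc h ^ K)) (^-distribʳ-* N W n) ⟨
  (N * W) ^ n * (b ^ (n * B) * h ^ (suc m * B) * suc h ^ K) ≤⟨ *-monoˡ-≤ (b ^ (n * B) * h ^ (suc m * B) * suc h ^ K) (^-monoˡ-≤ n NW≤) ⟩
  (V ^ B * G) ^ n * (b ^ (n * B) * h ^ (suc m * B) * suc h ^ K)
    ≡⟨ cong₂ (λ x y → x * (y * h ^ (suc m * B) * suc h ^ K)) (trans (^-distribʳ-* (V ^ B) G n) (cong (_* G ^ n) (^-*-flip V B))) (sym (^-*-flip b B)) ⟩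
  V ^ (n * B) * G ^ n * ((b ^ B) ^ n * h ^ (suc m * B) * suc h ^ K)
    ≡⟨ rearr₃ (V ^ (n * B)) (G ^ n) ((b ^ B) ^ n) (h ^ (suc m * B)) (suc h ^ K) ⟩
  suc h ^ K * ((b ^ B) ^ n * G ^ n) * (h ^ (suc m * B) * V ^ (n * B))
    ≡⟨ cong₂ (λ x y → suc h ^ K * x * y) (sym (^-distribʳ-* (b ^ B) G n)) (sym (expandPower h V)) ⟩
  suc h ^ K * (b ^ B * G) ^ n * Q ^ B
    ≤⟨ *-monoˡ-≤ (Q ^ B) (*-monoˡ-≤ ((b ^ B * G) ^ n) (m≤m*n (suc h ^ K) ((suc h ^ K) ^ n′) {{m^n≢0 (suc h ^ K) n′ {{m^n≢0 (suc h) K}}}})) ⟩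
  (suc h ^ K) ^ n * (b ^ B * G) ^ n * Q ^ B
    ≡⟨ cong (_* Q ^ B) (^-distribʳ-* (suc h ^ K) (b ^ B * G) n) ⟨
  (suc h ^ K * (b ^ B * G)) ^ n * Q ^ B ∎))
  where
  open ≤-Reasoning
  n = suc n′
  V = suc (b * h)
  Q = h ^ suc m * V ^ n
  P = suc h ^ suc m * (b * h) ^ n
  Q≢0 : NonZero Q
  Q≢0 = m*n≢0 (h ^ suc m) (V ^ n) {{m^n≢0 h (suc m) {{>-nonZero 1≤h}}}} {{m^n≢0 V n}}
  ^-*-flip : ∀ x e → (x ^ e) ^ n ≡ x ^ (n * e)
  ^-*-flip x e = trans (^-*-assoc x e n) (cong (x ^_) (*-comm e n))
  expandPower : ∀ x y → (x ^ suc m * y ^ n) ^ B ≡ x ^ (suc m * B) * y ^ (n * B)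
  expandPower x y = trans (^-distribʳ-* (x ^ suc m) (y ^ n) B) (cong₂ _*_ (^-*-assoc x (suc m) B) (^-*-assoc y n B))
  rearr₁ : ∀ a b c d → a * (b * (c * d)) ≡ a * c * (b * d)
  rearr₁ = solve-∀
  rearr₂ : ∀ a b c d e → a * b * (c * d * e) ≡ a * c * (b * d * e)
  rearr₂ = solve-∀
  rearr₃ : ∀ a b c d e → a * b * (c * d * e) ≡ e * (c * b) * (d * a)
  rearr₃ = solve-∀

length-filter≡∑ : ∀ {a p} {A : Set a} {P : Pred A p} (P? : Decidable P) xs → length (filter P? xs) ≡ ∑ xs (λ x → ind (P? x))
length-filter≡∑ P? xs = trans (length≡∑1 (filter P? xs)) (trans (∑-filter P? xs (λ _ → 1)) (∑-cong xs (λ _ → *-identityʳ _)))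

∑-filter≤ : ∀ {a p} {A : Set a} {P : Pred A p} (P? : Decidable P) xs (f : A → ℕ) → ∑ (filter P? xs) f ≤ ∑ xs f
∑-filter≤ P? xs f = ≤-trans (≤-reflexive (∑-filter P? xs f)) (∑-mono xs (λ {x} _ → ind* (P? x) (f x)))
  where
  ind* : ∀ {p} {P : Set p} (d : Dec P) y → ind d * y ≤ y
  ind* (yes _) y = ≤-reflexive (+-identityʳ y)
  ind* (no  _) y = z≤n

/-suc-≤ : ∀ B q .{{_ : NonZero q}} → suc B / q ≤ suc (B / q)
/-suc-≤ B q = ≤-pred (m<n*o⇒m/o<n {suc B} {2 + B / q} {q} (begin-strict
  suc B ≡⟨ cong suc (m≡m%n+[m/n]*n B q) ⟩
  suc (B % q) + B / q * q ≤⟨ +-monoˡ-≤ (B / q * q) (m%n<n B q) ⟩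
  q + B / q * q <⟨ m<n+m (q + B / q * q) (>-nonZero⁻¹ q) ⟩
  (2 + B / q) * q ∎))
  where open ≤-Reasoning

module _ {g : ℕ} .{{_ : NonZero g}} (w : Word {g}) (k′ : ℕ) (|w|≡ : length w ≡ suc k′) (m : ℕ) (1≤m : 1 ≤ m) where

  private
    k = suc k′
    b = g ^ k
    n = b * m
    h = 2 * m
    Q = h ^ suc m * suc (b * h) ^ n
    P = suc h ^ suc m * (b * h) ^ n
    q = Q * n
    -- At most 2 k letters follow the B blocks; together with the extra 1 in `PhaseBad` they can
    -- hide 2 k + 1 hits, each counted n times.
    K = n * suc (k + k)
    D = suc h ^ K
    1≤b : 1 ≤ b
    1≤b = m^n>0 g k
    1≤n : 1 ≤ n
    1≤n = 1≤* 1≤b 1≤m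
    1≤h : 1 ≤ h
    1≤h = 1≤* {2} (s≤s z≤n) 1≤m
    1≤Q : 1 ≤ Q
    1≤Q = 1≤* (m^n>0 h {{>-nonZero 1≤h}} (suc m)) (m^n>0 (suc (b * h)) n)
    1≤q : 1 ≤ q
    1≤q = 1≤* 1≤Q 1≤n
    instance
      q≢0 : NonZero q
      q≢0 = >-nonZero 1≤q

  -- w occurs too often in s, allowing for k further occurrences, by a factor more than 1 + 1/m.
  Bad : Word {g} → Set
  Bad s = suc m * length s < n * (occ w s + k)

  bad? : Decidable Bad
  bad? s = suc m * length s <? n * (occ w s + k)

  private
    PhaseBad : ℕ → Word {g} → Set
    PhaseBad c s = suc m * length s < n * (k * suc (aligned w k′ c s))

    phaseBad? : ∀ c → Decidable (PhaseBad c)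
    phaseBad? c s = suc m * length s <? n * (k * suc (aligned w k′ c s))

    -- The k phases share out the occurrences, and the allowance k in `Bad` gives one extra unit to
    -- each. If no phase were bad, the sum of their k inequalities would contradict `Bad`.
    bad⇒phaseBad : ∀ s → Bad s → ∃[ c ] c ∈ upTo k × PhaseBad c s
    bad⇒phaseBad s bad with all-or-some {P = λ c → n * (k * suc (aligned w k′ c s)) ≤ suc m * length s} {Q = λ c → PhaseBad c s}
                              (λ c → ≤-<-connex _ _) (upTo k)
    ... | inj₂ some = some
    ... | inj₁ all  = contradiction bad (≤⇒≯ (*-cancelˡ-≤ k (begin
      k * (n * (occ w s + k)) ≡⟨ *-swapˡ k n _ ⟩
      n * (k * (occ w s + k)) ≡⟨ cong (λ o → n * (k * (o + k))) (occ≡∑aligned w k′ s) ⟩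
      n * (k * (∑aligned w k′ k s + k)) ≤⟨ sums k ≤-refl ⟩
      k * (suc m * length s) ∎)))
      where
      open ≤-Reasoning
      sums : ∀ j → j ≤ k → n * (k * (∑aligned w k′ j s + j)) ≤ j * (suc m * length s)
      sums zero _  = ≤-reflexive (trans (cong (n *_) (*-zeroʳ k)) (*-zeroʳ n))
      sums (suc j) le = begin
        n * (k * (aligned w k′ j s + ∑aligned w k′ j s + suc j)) ≡⟨ rearrange n k (aligned w k′ j s) (∑aligned w k′ j s) j ⟩
        n * (k * suc (aligned w k′ j s)) + n * (k * (∑aligned w k′ j s + j)) ≤⟨ +-mono-≤ (all (∈-upTo⁺ le)) (sums j (<⇒≤ le)) ⟩
        suc m * length s + j * (suc m * length s) ∎
        where
        rearrange : ∀ n k a b j → n * (k * (a + b + suc j)) ≡ n * (k * suc a) + n * (k * (b + j))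
        rearrange = solve-∀

    -- The string consists of c letters before the phase starts, B blocks of length k and r further
    -- letters. The lightest phase-bad string still has many hits, hence a large weight, so few
    -- strings fit into the total weight.
    phase-count : ∀ {c} B r → c ≤ k → c + (B * k + r) ≤ k * B + (k + k) →
      length (filter (phaseBad? c) (strings (c + (B * k + r)))) * 2 ^ (B / q) ≤ D * g ^ (c + (B * k + r))
    phase-count {c} B r c≤k ℓ≤ with filter (phaseBad? c) (strings (c + (B * k + r))) in eqL
    ... | []  = z≤n
    ... | s ∷ ss with belowAverage (weight w k h B ∘ drop c) s ss
    ... | y , y∈ , NW≤ = subst (λ z → length (s ∷ ss) * 2 ^ (B / q) ≤ D * z) gℓ
        (chernoff-arith (length (s ∷ ss)) W B (g ^ c * g ^ r) b m h K (B / q) 1≤n 1≤h NW≤′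
          (power-gap-floor {P} {Q} {n} q B (<⇒≤ gap) (power-gap {P} {Q} n 1≤Q gap))
          (tilt (hits w k B y′) W B n K (suc m * B) 1≤h (weight-hits w k h B y′) manyHits))
      where
      open ≤-Reasoning
      ℓ = c + (B * k + r)
      y′ = drop c y
      W = weight w k h B y′
      gap : Q < P
      gap = chernoff-gap b m 1≤b 1≤m
      y-mem : y ∈ strings ℓ × PhaseBad c y
      y-mem = ∈-filter⁻ (phaseBad? c) {xs = strings ℓ} (subst (y ∈_) (sym eqL) y∈)
      NW≤′ : length (s ∷ ss) * W ≤ suc (b * h) ^ B * (g ^ c * g ^ r)
      NW≤′ = begin
        length (s ∷ ss) * W ≤⟨ NW≤ ⟩
        ∑ (s ∷ ss) (weight w k h B ∘ drop c) ≡⟨ cong (λ l → ∑ l (weight w k h B ∘ drop c)) eqL ⟨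
        ∑ (filter (phaseBad? c) (strings ℓ)) (weight w k h B ∘ drop c) ≤⟨ ∑-filter≤ (phaseBad? c) (strings ℓ) _ ⟩
        ∑ (strings ℓ) (weight w k h B ∘ drop c) ≡⟨ ∑-strings-drop c (B * k + r) (weight w k h B) ⟩
        g ^ c * ∑ (strings (B * k + r)) (weight w k h B) ≡⟨ cong (g ^ c *_) (subst (λ k → ∑ (strings (B * k + r)) (weight w k h B) ≡ suc (g ^ k * h) ^ B * g ^ r) |w|≡ (∑-weight w h B r)) ⟩
        g ^ c * (suc (b * h) ^ B * g ^ r) ≡⟨ *-swapˡ (g ^ c) (suc (b * h) ^ B) (g ^ r) ⟩
        suc (b * h) ^ B * (g ^ c * g ^ r) ∎
      gℓ : b ^ B * (g ^ c * g ^ r) ≡ g ^ ℓ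
      gℓ = begin-equality
        (g ^ k) ^ B * (g ^ c * g ^ r) ≡⟨ cong (_* (g ^ c * g ^ r)) (trans (^-*-assoc g k B) (cong (g ^_) (*-comm k B))) ⟩
        g ^ (B * k) * (g ^ c * g ^ r) ≡⟨ *-swapˡ (g ^ (B * k)) (g ^ c) (g ^ r) ⟩
        g ^ c * (g ^ (B * k) * g ^ r) ≡⟨ cong (g ^ c *_) (^-distribˡ-+-* g (B * k) r) ⟨
        g ^ c * g ^ (B * k + r) ≡⟨ ^-distribˡ-+-* g c (B * k + r) ⟨
        g ^ ℓ ∎
      |y| : length y ≡ ℓ
      |y| = ∈-strings⁻ ℓ (proj₁ y-mem)
      rest≤ : length (drop (k * B) y′) ≤ k + k
      rest≤ = length-drop-≤ {n = k * B} y′ (length-drop-≤ {n = c} y (≤-trans (≤-reflexive |y|) (≤-trans ℓ≤ (m≤n+m _ c))))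
      manyHits : suc m * B ≤ n * hits w k B y′ + K
      manyHits = *-cancelˡ-≤ k (begin
        k * (suc m * B) ≡⟨ rearr₁ k (suc m) B ⟩
        suc m * (B * k) ≤⟨ *-monoʳ-≤ (suc m) (≤-trans (m≤m+n (B * k) r) (m≤n+m _ c)) ⟩
        suc m * ℓ ≡⟨ cong (suc m *_) |y| ⟨
        suc m * length y ≤⟨ <⇒≤ (proj₂ y-mem) ⟩
        n * (k * suc (aligned w k′ c y)) ≤⟨ *-monoʳ-≤ n (*-monoʳ-≤ k (s≤s (≤-trans (≤-reflexive (aligned-drop w k′ c y))
                                                                        (≤-trans (aligned≤hits w k′ B y′) (+-monoʳ-≤ (hits w k B y′) rest≤))))) ⟩
        n * (k * suc (hits w k B y′ + (k + k))) ≡⟨ rearr₂ n k (hits w k B y′) (k + k) ⟩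
        k * (n * hits w k B y′ + K) ∎)
        where
        rearr₁ : ∀ x y z → x * (y * z) ≡ y * (z * x)
        rearr₁ = solve-∀
        rearr₂ : ∀ n k a d → n * (k * suc (a + d)) ≡ k * (n * a + n * suc d)
        rearr₂ = solve-∀

  chernoff : ∃[ q ] 1 ≤ q × ∃[ C ] (∀ ℓ → length (filter bad? (strings ℓ)) * 2 ^ (ℓ ÷ q) ≤ C * g ^ ℓ)
  chernoff = k * q , 1≤* {k} (s≤s z≤n) 1≤q , k * (2 * D) , bound
    where
    open ≤-Reasoning
    instance
      kq≢0 : NonZero (k * q)
      kq≢0 = >-nonZero (1≤* {k} (s≤s z≤n) 1≤q)
    ÷≡/ : ∀ ℓ d .{{_ : NonZero d}} → ℓ ÷ d ≡ ℓ / d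
    ÷≡/ ℓ (suc d) = refl
    exponent : ∀ ℓ → ℓ ÷ (k * q) ≡ (ℓ / k) / q
    exponent ℓ = trans (÷≡/ ℓ (k * q)) (sym (m/n/o≡m/[n*o] ℓ k q))
    ind-bad : ∀ s → ind (bad? s) ≤ ∑ (upTo k) (λ c → ind (phaseBad? c s))
    ind-bad s with bad? s
    ... | no  _   = z≤n
    ... | yes bad with bad⇒phaseBad s bad
    ... | c , c∈ , pb = ≤-trans (≤-reflexive (trans (sym (ind-true (phaseBad? c s) pb)) (sym (+-identityʳ _))))
              (∑-⊆ {xs = c ∷ []} (λ c → ind (phaseBad? c s)) ([] ∷ []) (λ { (here refl) → c∈ }))
    bound : ∀ ℓ → length (filter bad? (strings ℓ)) * 2 ^ (ℓ ÷ (k * q)) ≤ k * (2 * D) * g ^ ℓ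
    bound ℓ with ℓ / k in eqB
    ... | zero  = begin
      length (filter bad? (strings ℓ)) * 2 ^ (ℓ ÷ (k * q)) ≡⟨ cong (λ e → length (filter bad? (strings ℓ)) * 2 ^ e) (trans (exponent ℓ) (trans (cong (_/ q) eqB) (0/n≡0 q))) ⟩
      length (filter bad? (strings ℓ)) * 1 ≡⟨ *-identityʳ _ ⟩
      length (filter bad? (strings ℓ)) ≤⟨ length-filter bad? (strings ℓ) ⟩
      length (strings ℓ) ≡⟨ length-strings ℓ ⟩
      g ^ ℓ ≤⟨ m≤n*m (g ^ ℓ) (k * (2 * D)) {{>-nonZero (1≤* {k} (s≤s z≤n) (1≤* {2} (s≤s z≤n) (m^n>0 (suc h) K)))}} ⟩
      k * (2 * D) * g ^ ℓ ∎
    -- One block is given up so that every phase c < k leaves room for B whole blocks; this costs at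
    -- most a factor 2 in the saving.
    ... | suc B = begin
      length (filter bad? (strings ℓ)) * 2 ^ (ℓ ÷ (k * q))
        ≤⟨ *-mono-≤ union (^-monoʳ-≤ 2 (≤-trans (≤-reflexive (trans (exponent ℓ) (cong (_/ q) eqB))) (/-suc-≤ B q))) ⟩
      ∑ (upTo k) (λ c → length (filter (phaseBad? c) (strings ℓ))) * (2 * 2 ^ (B / q))
        ≡⟨ ∑-*ʳ (upTo k) (2 * 2 ^ (B / q)) (λ c → length (filter (phaseBad? c) (strings ℓ))) ⟨
      ∑ (upTo k) (λ c → length (filter (phaseBad? c) (strings ℓ)) * (2 * 2 ^ (B / q)))
        ≤⟨ ∑-bound (upTo k) each ⟩
      length (upTo k) * (2 * (D * g ^ ℓ))
        ≡⟨ cong (_* (2 * (D * g ^ ℓ))) (length-upTo k) ⟩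
      k * (2 * (D * g ^ ℓ))
        ≡⟨ rearrange k D (g ^ ℓ) ⟩
      k * (2 * D) * g ^ ℓ ∎
      where
      rearrange : ∀ k d x → k * (2 * (d * x)) ≡ k * (2 * d) * x
      rearrange = solve-∀
      union : length (filter bad? (strings ℓ)) ≤ ∑ (upTo k) (λ c → length (filter (phaseBad? c) (strings ℓ)))
      union = begin
        length (filter bad? (strings ℓ)) ≡⟨ length-filter≡∑ bad? (strings ℓ) ⟩
        ∑ (strings ℓ) (λ s → ind (bad? s)) ≤⟨ ∑-mono (strings ℓ) (λ {s} _ → ind-bad s) ⟩
        ∑ (strings ℓ) (λ s → ∑ (upTo k) (λ c → ind (phaseBad? c s))) ≡⟨ ∑-swap (strings ℓ) (upTo k) (λ s c → ind (phaseBad? c s)) ⟩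
        ∑ (upTo k) (λ c → ∑ (strings ℓ) (λ s → ind (phaseBad? c s))) ≡⟨ ∑-cong (upTo k) (λ {c} _ → length-filter≡∑ (phaseBad? c) (strings ℓ)) ⟨
        ∑ (upTo k) (λ c → length (filter (phaseBad? c) (strings ℓ))) ∎
      ℓ≡ : ℓ ≡ ℓ % k + suc B * k
      ℓ≡ = trans (m≡m%n+[m/n]*n ℓ k) (cong (λ z → ℓ % k + z * k) eqB)
      each : ∀ {c} → c ∈ upTo k → length (filter (phaseBad? c) (strings ℓ)) * (2 * 2 ^ (B / q)) ≤ 2 * (D * g ^ ℓ)
      each {c} c∈ with m≤n⇒∃[o]m+o≡n (<⇒≤ (∈-upTo⁻ c∈))
      ... | e , c+e≡k = begin
        length (filter (phaseBad? c) (strings ℓ)) * (2 * 2 ^ (B / q)) ≡⟨ swap-mul (length (filter (phaseBad? c) (strings ℓ))) (2 ^ (B / q)) ⟩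
        2 * (length (filter (phaseBad? c) (strings ℓ)) * 2 ^ (B / q)) ≤⟨ *-monoʳ-≤ 2 (subst (λ z → length (filter (phaseBad? c) (strings z)) * 2 ^ (B / q) ≤ D * g ^ z) ℓ-eq
                                                                                (phase-count B (e + ℓ % k) (<⇒≤ (∈-upTo⁻ c∈)) ℓ-bound)) ⟩
        2 * (D * g ^ ℓ) ∎
        where
        swap-mul : ∀ x y → x * (2 * y) ≡ 2 * (x * y)
        swap-mul = solve-∀
        ℓ-eq : c + (B * k + (e + ℓ % k)) ≡ ℓ
        ℓ-eq = trans (rearr c (B * k) e (ℓ % k)) (trans (cong (λ z → ℓ % k + (z + B * k)) c+e≡k) (sym ℓ≡))
          where
          rearr : ∀ c x e r → c + (x + (e + r)) ≡ r + ((c + e) + x)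
          rearr = solve-∀
        ℓ-bound : c + (B * k + (e + ℓ % k)) ≤ k * B + (k + k)
        ℓ-bound = begin
          c + (B * k + (e + ℓ % k)) ≡⟨ trans ℓ-eq ℓ≡ ⟩
          ℓ % k + (k + B * k) ≤⟨ +-monoˡ-≤ (k + B * k) (<⇒≤ (m%n<n ℓ k)) ⟩
          k + (k + B * k) ≡⟨ cong (λ z → k + (k + z)) (*-comm B k) ⟩
          k + (k + k * B) ≡⟨ rearr k (k * B) ⟩
          k * B + (k + k) ∎
          where
          rearr : ∀ k x → k + (k + x) ≡ x + (k + k)
          rearr = solve-∀

-- Exceptional integers are sparse

÷-+-≤ : ∀ {q} → 1 ≤ q → ∀ d ℓ → (d + ℓ) ÷ q ≤ d + ℓ ÷ q
÷-+-≤ {suc q} _ zero ℓ = ≤-refl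
÷-+-≤ {suc q} 1≤q (suc d) ℓ = ≤-trans (/-suc-≤ (d + ℓ) (suc q)) (s≤s (÷-+-≤ 1≤q d ℓ))

module _ {g : ℕ} .{{_ : NonZero g}} where

  valueRev : Word {g} → ℕ
  valueRev []  = 0
  valueRev (d ∷ ds) = toℕ d + g * valueRev ds

  valueRev-digitsRev : 2 ≤ g → ∀ fuel m → m ≤ fuel → valueRev (digitsRev g fuel m) ≡ m
  valueRev-digitsRev 2≤g zero zero _  = refl
  valueRev-digitsRev 2≤g (suc fuel) zero _  = refl
  valueRev-digitsRev 2≤g (suc fuel) (suc m) le = begin
    toℕ (suc m mod g) + g * valueRev (digitsRev g fuel (suc m / g)) ≡⟨ cong₂ (λ x y → x + g * y) (sym (%≡mod (suc m))) (valueRev-digitsRev 2≤g fuel (suc m / g) smaller) ⟩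
    suc m % g + g * (suc m / g) ≡⟨ cong (suc m % g +_) (*-comm g _) ⟩
    suc m % g + suc m / g * g ≡⟨ m≡m%n+[m/n]*n (suc m) g ⟨
    suc m ∎
    where
    open ≡-Reasoning
    %≡mod : ∀ m → m % g ≡ toℕ (m mod g)
    %≡mod m = sym (Fin.toℕ-fromℕ< (m%n<n m g))
    smaller : suc m / g ≤ fuel
    smaller = ≤-trans (≤-pred (m/n<m (suc m) g 2≤g)) (≤-pred le)

  length-digitsRev≤ : ∀ fuel m l → m < g ^ l → length (digitsRev g fuel m) ≤ l
  length-digitsRev≤ zero m l _  = z≤n
  length-digitsRev≤ (suc fuel) zero l _  = z≤n
  length-digitsRev≤ (suc fuel) (suc m) zero (s≤s ())
  length-digitsRev≤ (suc fuel) (suc m) (suc l) lt = s≤s (length-digitsRev≤ fuel (suc m / g) l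
    (m<n*o⇒m/o<n {suc m} {g ^ l} {g} (subst (suc m <_) (*-comm g (g ^ l)) lt)))

  length-digits≤ : ∀ m l → m < g ^ l → length (digits g m) ≤ l
  length-digits≤ m l lt = ≤-trans (≤-reflexive (length-reverse (digitsRev g m m))) (length-digitsRev≤ m m l lt)

  length-digits≥1 : ∀ {m} → 1 ≤ m → 1 ≤ length (digits g m)
  length-digits≥1 {suc m} _ = subst (1 ≤_) (sym (length-reverse (digitsRev g (suc m) (suc m)))) (s≤s z≤n)

  value : Word {g} → ℕ
  value s = valueRev (reverse s)

  value-digits : 2 ≤ g → ∀ m → value (digits g m) ≡ m
  value-digits 2≤g m = trans (cong valueRev (reverse-involutive (digitsRev g m m))) (valueRev-digitsRev 2≤g m m ≤-refl)

  valuesWhere : ∀ {P : Pred (Word {g}) 0ℓ} → Decidable P → ℕ → List ℕ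
  valuesWhere P? l = concatMap (λ ℓ → map value (filter P? (strings ℓ))) (upTo (suc l))

  ∈-valuesWhere : 2 ≤ g → ∀ {P : Pred (Word {g}) 0ℓ} (P? : Decidable P) {l m} → m < g ^ l → P (digits g m) → m ∈ valuesWhere P? l
  ∈-valuesWhere 2≤g P? {l} {m} lt p = ∈-concatMap (λ ℓ → map value (filter P? (strings ℓ))) {upTo (suc l)}
    (∈-upTo⁺ (s≤s (length-digits≤ m l lt)))
    (subst (_∈ map value (filter P? (strings (length (digits g m))))) (value-digits 2≤g m)
      (∈-map⁺ value (∈-filter⁺ P? (∈-strings (digits g m)) p)))

  -- Strings shorter by d letters have a saving smaller by at most 2 ^ d, but there are g ^ d ≥ 2 ^
  -- d times fewer of them, so every length up to l obeys the bound for l.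
  length-valuesWhere : 2 ≤ g → ∀ {P : Pred (Word {g}) 0ℓ} (P? : Decidable P) {q C} → 1 ≤ q →
    (∀ ℓ → length (filter P? (strings ℓ)) * 2 ^ (ℓ ÷ q) ≤ C * g ^ ℓ) →
    ∀ l → length (valuesWhere P? l) * 2 ^ (l ÷ q) ≤ suc l * (C * g ^ l)
  length-valuesWhere 2≤g P? {q} {C} 1≤q few l = begin
    length (valuesWhere P? l) * 2 ^ (l ÷ q)
      ≡⟨ cong (_* 2 ^ (l ÷ q)) (length-concatMap (λ ℓ → map value (filter P? (strings ℓ))) (upTo (suc l))) ⟩
    ∑ (upTo (suc l)) (λ ℓ → length (map value (filter P? (strings ℓ)))) * 2 ^ (l ÷ q)
      ≡⟨ ∑-*ʳ (upTo (suc l)) (2 ^ (l ÷ q)) (λ ℓ → length (map value (filter P? (strings ℓ)))) ⟨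
    ∑ (upTo (suc l)) (λ ℓ → length (map value (filter P? (strings ℓ))) * 2 ^ (l ÷ q))
      ≤⟨ ∑-bound (upTo (suc l)) (λ ℓ∈ → each (≤-pred (∈-upTo⁻ ℓ∈))) ⟩
    length (upTo (suc l)) * (C * g ^ l)
      ≡⟨ cong (_* (C * g ^ l)) (length-upTo (suc l)) ⟩
    suc l * (C * g ^ l) ∎
    where
    open ≤-Reasoning
    each : ∀ {ℓ} → ℓ ≤ l → length (map value (filter P? (strings ℓ))) * 2 ^ (l ÷ q) ≤ C * g ^ l
    each {ℓ} ℓ≤l with m≤n⇒∃[o]m+o≡n ℓ≤l
    ... | d , refl = begin
      length (map value (filter P? (strings ℓ))) * 2 ^ ((ℓ + d) ÷ q)
        ≤⟨ *-mono-≤ (≤-reflexive (length-map value (filter P? (strings ℓ)))) (^-monoʳ-≤ 2 (subst (λ z → z ÷ q ≤ d + ℓ ÷ q) (+-comm d ℓ) (÷-+-≤ 1≤q d ℓ))) ⟩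
      length (filter P? (strings ℓ)) * 2 ^ (d + ℓ ÷ q)
        ≡⟨ cong (length (filter P? (strings ℓ)) *_) (^-distribˡ-+-* 2 d (ℓ ÷ q)) ⟩
      length (filter P? (strings ℓ)) * (2 ^ d * 2 ^ (ℓ ÷ q))
        ≡⟨ rearrange (length (filter P? (strings ℓ))) (2 ^ d) (2 ^ (ℓ ÷ q)) ⟩
      length (filter P? (strings ℓ)) * 2 ^ (ℓ ÷ q) * 2 ^ d
        ≤⟨ *-mono-≤ (few ℓ) (^-monoˡ-≤ d 2≤g) ⟩
      C * g ^ ℓ * g ^ d
        ≡⟨ *-assoc C (g ^ ℓ) (g ^ d) ⟩
      C * (g ^ ℓ * g ^ d)
        ≡⟨ cong (C *_) (^-distribˡ-+-* g ℓ d) ⟨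
      C * g ^ (ℓ + d) ∎
      where
      rearrange : ∀ x y z → x * (y * z) ≡ x * z * y
      rearrange = solve-∀

log : ∀ {g} → 2 ≤ g → ∀ X → 1 ≤ X → ∃[ e ] g ^ e ≤ X × X < g ^ suc e
log {g} 2≤g (suc zero) _ = 0 , ≤-refl , subst (1 <_) (sym (*-identityʳ g)) 2≤g
log {g} 2≤g (suc (suc X)) _ with log 2≤g (suc X) (s≤s z≤n)
... | e , lo , hi with m≤n⇒m<n∨m≡n hi
... | inj₁ lt = e , ≤-trans lo (n≤1+n _) , lt
... | inj₂ eq = suc e , ≤-reflexive (sym eq) , subst (_< g ^ suc (suc e)) (sym eq) (^-monoʳ-< g 2≤g (n<1+n (suc e)))

loglog : ∀ y → 2 ≤ y → ∃[ s ] 2 ^ (2 ^ s) ≤ y × y < 2 ^ (2 ^ suc s)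
loglog y 2≤y with log (s≤s (s≤s z≤n)) y (<⇒≤ 2≤y)
... | zero  , _  , hi = contradiction 2≤y (<⇒≱ hi)
... | suc e , lo , hi with log (s≤s (s≤s z≤n)) (suc e) (s≤s z≤n)
... | s , lo′ , hi′ = s , ≤-trans (^-monoʳ-≤ 2 lo′) lo , <-≤-trans hi (^-monoʳ-≤ 2 hi′)

-- With u the integer part of t / (2 e) and D ≤ u, the base is at most D (u + 1) ≤ 2 ^ u * 2 ^ u,
-- and its e-th power is at most 2 ^ t since 2 u e ≤ t.
poly≤2^ : ∀ {R} → Poly R → ∃[ t₀ ] (∀ t → t₀ ≤ t → R t ≤ 2 ^ t)
poly≤2^ {R} (c , zero  , le) = 0 , λ t _ → ≤-trans (le t) (1≤2^ t)
poly≤2^ {R} (c , e@(suc e′) , le) = 2 * e * D , λ t t₀≤t → large t (t / (2 * e)) refl t₀≤t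
  where
  D = 2 + c + 2 * e
  large : ∀ t u → t / (2 * e) ≡ u → 2 * e * D ≤ t → R t ≤ 2 ^ t
  large t u t/≡u t₀≤t = begin
    R t ≤⟨ le t ⟩
    (2 + c + t) ^ e ≤⟨ ^-monoˡ-≤ e (≤-trans base≤ (*-mono-≤ (≤-trans (<⇒≤ (n<2^n D)) (^-monoʳ-≤ 2 D≤u)) (n<2^n u))) ⟩
    (2 ^ u * 2 ^ u) ^ e ≡⟨ cong (_^ e) (2^-* u u) ⟩
    (2 ^ (u + u)) ^ e ≡⟨ ^-*-assoc 2 (u + u) e ⟩
    2 ^ ((u + u) * e) ≤⟨ ^-monoʳ-≤ 2 (≤-trans (≤-reflexive (rearr u e)) (≤-trans (m≤n+m (u * (2 * e)) _) (≤-reflexive (sym t≡)))) ⟩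
    2 ^ t ∎
    where
    open ≤-Reasoning
    rearr : ∀ u e → (u + u) * e ≡ u * (2 * e)
    rearr = solve-∀
    t≡ : t ≡ t % (2 * e) + u * (2 * e)
    t≡ = trans (m≡m%n+[m/n]*n t (2 * e)) (cong (λ z → t % (2 * e) + z * (2 * e)) t/≡u)
    D≤u : D ≤ u
    D≤u = subst (D ≤_) t/≡u (subst (_≤ t / (2 * e)) (m*n/n≡m D (2 * e)) (/-monoˡ-≤ (2 * e) (subst (_≤ t) (*-comm (2 * e) D) t₀≤t)))
    base≤ : 2 + c + t ≤ D * suc u
    base≤ = begin
      2 + c + t ≡⟨ cong (2 + c +_) t≡ ⟩
      2 + c + (t % (2 * e) + u * (2 * e)) ≤⟨ +-monoʳ-≤ (2 + c) (+-monoˡ-≤ (u * (2 * e)) (<⇒≤ (m%n<n t (2 * e)))) ⟩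
      2 + c + (2 * e + u * (2 * e)) ≤⟨ m≤m+n _ (u * (2 + c)) ⟩
      2 + c + (2 * e + u * (2 * e)) + u * (2 + c) ≡⟨ rearr′ c e u ⟩
      D * suc u ∎
      where
      rearr′ : ∀ c e u → 2 + c + (2 * e + u * (2 * e)) + u * (2 + c) ≡ (2 + c + 2 * e) * suc u
      rearr′ = solve-∀

-- The parameter t of `Encoding` becomes 2 + s: values up to y 2 ^ (j t) are below 2 ^ k with k = 2
-- ^ (s + 1) + j t, and 2 + k ≤ 2 ^ (2 + s) once s is large.
record SparseExceptions (g : ℕ) .{{_ : NonZero g}} (F : ℕ → ℕ) (P : Word {g} → Set) (A : ℕ) : Set where
  field
    s₀ : ℕ
    sparse : ∀ s y → s₀ ≤ s → 2 ^ (2 ^ s) ≤ y → y < 2 ^ (2 ^ suc s) →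
      ∃[ bad ] length bad * 2 ^ (A * (2 + s)) ≤ 2 * y ×
        (∀ {n} → 1 ≤ n → n ≤ y → length (digits g (F n)) ≤ 2 ^ (2 + s) × (n ∈ bad ⊎ ¬ P (digits g (F n))))

sparse-exceptions : ∀ {g} .{{_ : NonZero g}} → 2 ≤ g → ∀ {F j A} → Encoding F j A → ∀ {P : Pred (Word {g}) 0ℓ} (P? : Decidable P) {q C} → 1 ≤ q →
  (∀ ℓ → length (filter P? (strings ℓ)) * 2 ^ (ℓ ÷ q) ≤ C * g ^ ℓ) → SparseExceptions g F P A
sparse-exceptions {g} 2≤g {F} {j} {A} E {P} P? {q} {C} 1≤q few = record { s₀ = t₀ ; sparse = sparse }
  where
  module E = Encoding E
  -- The exponent that the power saving 2 ^ (l ÷ q) has to supply: E.M t for the n sharing a value,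
  -- suc t for the number of lengths, j * t for X against y, C * g for the constants and A * t for
  -- the claim.
  savings : ℕ → ℕ
  savings t = E.M t + (suc t + (j * t + (C * g + A * t)))
  -- R₁ t ≤ 2 ^ t gives savings t ≤ l ÷ q, because 2 ^ t = 4 * 2 ^ s and 2 ^ s ≤ g * l; R₂ t ≤ 2 ^ t
  -- gives 2 + k ≤ 2 ^ t.
  R₁ R₂ : ℕ → ℕ
  R₁ t = 4 * (g * (q * savings t))
  R₂ t = 2 * (j * t + 2)
  linear-poly : ∀ c → Poly (c *_)
  linear-poly c = poly-* (poly-const c) poly-id
  R₁-poly : Poly R₁
  R₁-poly = poly-* (poly-const 4) (poly-* (poly-const g) (poly-* (poly-const q) (poly-+ E.M-poly
    (poly-+ (poly-+ (poly-const 1) poly-id) (poly-+ (linear-poly j) (poly-+ (poly-const (C * g)) (linear-poly A)))))))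
  R₂-poly : Poly R₂
  R₂-poly = poly-* (poly-const 2) (poly-+ (linear-poly j) (poly-const 2))
  R₁≤2^ = poly≤2^ R₁-poly
  R₂≤2^ = poly≤2^ R₂-poly
  t₀ : ℕ
  t₀ = proj₁ R₁≤2^ + proj₁ R₂≤2^
  sparse : ∀ s y → t₀ ≤ s → 2 ^ (2 ^ s) ≤ y → y < 2 ^ (2 ^ suc s) →
    ∃[ bad ] length bad * 2 ^ (A * (2 + s)) ≤ 2 * y ×
      (∀ {n} → 1 ≤ n → n ≤ y → length (digits g (F n)) ≤ 2 ^ (2 + s) × (n ∈ bad ⊎ ¬ P (digits g (F n))))
  sparse s y t₀≤s y≥ y< = combine (E.encode t k y k< X≤2^k)
    where
    t = 2 + s
    k = 2 ^ suc s + j * t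
    X = y * 2 ^ (j * t)
    s≤t : s ≤ t
    s≤t = m≤n+m s 2
    k< : 2 + k ≤ 2 ^ t
    k< = begin
      2 + (2 ^ suc s + j * t) ≡⟨ rearr (2 ^ suc s) (j * t) ⟩
      2 ^ suc s + (j * t + 2) ≤⟨ +-monoʳ-≤ (2 ^ suc s) (*-cancelˡ-≤ 2 (proj₂ R₂≤2^ t (≤-trans (m≤n+m _ (proj₁ R₁≤2^)) (≤-trans t₀≤s s≤t)))) ⟩
      2 ^ suc s + 2 ^ suc s ≡⟨ cong (2 ^ suc s +_) (+-identityʳ (2 ^ suc s)) ⟨
      2 ^ t ∎
      where
      open ≤-Reasoning
      rearr : ∀ x y → 2 + (x + y) ≡ x + (y + 2)
      rearr = solve-∀
    X≤2^k : X ≤ 2 ^ k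
    X≤2^k = ≤-trans (*-monoˡ-≤ (2 ^ (j * t)) (<⇒≤ y<)) (≤-reflexive (2^-* (2 ^ suc s) (j * t)))
    1≤y : 1 ≤ y
    1≤y = ≤-trans (1≤2^ (2 ^ s)) y≥
    combine : (Σ (List ℕ) λ bad → Σ (ℕ → List ℕ) λ pre →
        length bad * 2 ^ (A * t) ≤ y × (∀ m → length (pre m) ≤ 2 ^ E.M t) ×
        (∀ {n} → 1 ≤ n → n ≤ y → 1 ≤ F n × F n ≤ X × (n ∈ bad ⊎ (τ (F n) ≤ 2 ^ E.T t × n ∈ pre (F n))))) →
      ∃[ bad ] length bad * 2 ^ (A * t) ≤ 2 * y ×
        (∀ {n} → 1 ≤ n → n ≤ y → length (digits g (F n)) ≤ 2 ^ t × (n ∈ bad ⊎ ¬ P (digits g (F n))))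
    combine (bad , pre , bad-small , pre-small , spec) with log 2≤g X (1≤* 1≤y (1≤2^ (j * t)))
    ... | e , g^e≤X , X<g^l = bad ++ concatMap pre S , total , λ 1≤n n≤y → classify 1≤n n≤y (spec 1≤n n≤y)
      where
      l = suc e
      S = valuesWhere P? l
      l≤ : suc l ≤ 2 ^ t
      l≤ = ≤-trans (+-monoʳ-≤ 2 (2^-cancel-≤ e k (≤-trans (^-monoˡ-≤ e 2≤g) (≤-trans g^e≤X X≤2^k)))) k<
      classify : ∀ {n} → 1 ≤ n → n ≤ y → (1 ≤ F n × F n ≤ X × (n ∈ bad ⊎ (τ (F n) ≤ 2 ^ E.T t × n ∈ pre (F n)))) →
        length (digits g (F n)) ≤ 2 ^ t × (n ∈ bad ++ concatMap pre S ⊎ ¬ P (digits g (F n)))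
      classify {n} 1≤n n≤y (_ , Fn≤X , d) = ≤-trans (length-digits≤ (F n) l Fn<) (<⇒≤ l≤) , split d
        where
        Fn< : F n < g ^ l
        Fn< = ≤-<-trans Fn≤X X<g^l
        split : (n ∈ bad ⊎ (τ (F n) ≤ 2 ^ E.T t × n ∈ pre (F n))) → n ∈ bad ++ concatMap pre S ⊎ ¬ P (digits g (F n))
        split (inj₁ n∈) = inj₁ (∈-++⁺ˡ n∈)
        split (inj₂ (_ , n∈)) with P? (digits g (F n))
        ... | yes p = inj₁ (∈-++⁺ʳ bad (∈-concatMap pre {S} (∈-valuesWhere 2≤g P? {l} Fn< p) n∈))
        ... | no ¬p = inj₂ ¬p
      open ≤-Reasoning
      savings≤ : savings t ≤ l ÷ q
      savings≤ = ÷-greatest 1≤q (*-cancelˡ-≤ g (*-cancelˡ-≤ 4 (begin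
        4 * (g * (savings t * q)) ≡⟨ cong (λ z → 4 * (g * z)) (*-comm (savings t) q) ⟩
        R₁ t ≤⟨ proj₂ R₁≤2^ t (≤-trans (m≤m+n _ (proj₁ R₂≤2^)) (≤-trans t₀≤s s≤t)) ⟩
        2 * (2 * 2 ^ s) ≡⟨ *-assoc 2 2 (2 ^ s) ⟨
        4 * 2 ^ s ≤⟨ *-monoʳ-≤ 4 (2^-cancel-≤ (2 ^ s) (g * l) (begin
          2 ^ (2 ^ s) ≤⟨ y≥ ⟩
          y ≤⟨ m≤m*n y (2 ^ (j * t)) {{m^n≢0 2 (j * t)}} ⟩
          X ≤⟨ <⇒≤ X<g^l ⟩
          g ^ l ≤⟨ ^-monoˡ-≤ l (<⇒≤ (n<2^n g)) ⟩
          (2 ^ g) ^ l ≡⟨ ^-*-assoc 2 g l ⟩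
          2 ^ (g * l) ∎)) ⟩
        4 * (g * l) ∎)))
      c′ = suc t + (j * t + C * g)
      S-small : length S * 2 ^ (E.M t + A * t) ≤ y
      S-small = *-cancelʳ-≤ _ _ (2 ^ c′) {{m^n≢0 2 c′}} (begin
        length S * 2 ^ (E.M t + A * t) * 2 ^ c′ ≡⟨ *-assoc (length S) _ _ ⟩
        length S * (2 ^ (E.M t + A * t) * 2 ^ c′) ≡⟨ cong (length S *_) (2^-* (E.M t + A * t) c′) ⟩
        length S * 2 ^ (E.M t + A * t + c′) ≡⟨ cong (λ z → length S * 2 ^ z) (rearr (E.M t) (A * t) (suc t) (j * t) (C * g)) ⟩
        length S * 2 ^ savings t ≤⟨ *-monoʳ-≤ (length S) (^-monoʳ-≤ 2 savings≤) ⟩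
        length S * 2 ^ (l ÷ q) ≤⟨ length-valuesWhere 2≤g P? {q} {C} 1≤q few l ⟩
        suc l * (C * g ^ l) ≤⟨ *-mono-≤ l≤ (*-monoʳ-≤ C (*-monoʳ-≤ g g^e≤X)) ⟩
        2 ^ t * (C * (g * (y * 2 ^ (j * t)))) ≤⟨ m≤n*m _ 2 ⟩
        2 * (2 ^ t * (C * (g * (y * 2 ^ (j * t))))) ≡⟨ rearr′ (2 ^ t) C g y (2 ^ (j * t)) ⟩
        y * (2 ^ suc t * (2 ^ (j * t) * (C * g))) ≤⟨ *-monoʳ-≤ y (*-monoʳ-≤ (2 ^ suc t) (*-monoʳ-≤ (2 ^ (j * t)) (<⇒≤ (n<2^n (C * g))))) ⟩
        y * (2 ^ suc t * (2 ^ (j * t) * 2 ^ (C * g))) ≡⟨ cong (y *_) (trans (cong (2 ^ suc t *_) (2^-* (j * t) (C * g))) (2^-* (suc t) (j * t + C * g))) ⟩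
        y * 2 ^ c′ ∎)
        where
        rearr : ∀ m a t j c → m + a + (t + (j + c)) ≡ m + (t + (j + (c + a)))
        rearr = solve-∀
        rearr′ : ∀ z c g y w → 2 * (z * (c * (g * (y * w)))) ≡ y * ((2 * z) * (w * (c * g)))
        rearr′ = solve-∀
      total : length (bad ++ concatMap pre S) * 2 ^ (A * t) ≤ 2 * y
      total = begin
        length (bad ++ concatMap pre S) * 2 ^ (A * t)
          ≡⟨ trans (cong (_* 2 ^ (A * t)) (length-++ bad)) (*-distribʳ-+ (2 ^ (A * t)) (length bad) _) ⟩
        length bad * 2 ^ (A * t) + length (concatMap pre S) * 2 ^ (A * t)
          ≤⟨ +-mono-≤ bad-small (*-monoˡ-≤ (2 ^ (A * t)) (≤-trans (≤-reflexive (length-concatMap pre S)) (∑-bound S (λ {m} _ → pre-small m)))) ⟩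
        y + length S * 2 ^ E.M t * 2 ^ (A * t)
          ≡⟨ cong (y +_) (trans (*-assoc (length S) _ _) (cong (length S *_) (2^-* (E.M t) (A * t)))) ⟩
        y + length S * 2 ^ (E.M t + A * t)
          ≤⟨ +-monoʳ-≤ y S-small ⟩
        y + y
          ≡⟨ cong (y +_) (+-identityʳ y) ⟨
        2 * y ∎

-- Frequencies in a concatenation

starts-mono-++ : ∀ {g} (w s t : Word {g}) → starts w s ≤ starts w (s ++ t)
starts-mono-++ [] s t = ≤-refl
starts-mono-++ (a ∷ w) [] t = z≤n
starts-mono-++ (a ∷ w) (x ∷ s) t with does (a Fin.≟ x)
... | true  = starts-mono-++ w s t
... | false = z≤n

occ-mono-++ : ∀ {g} (w s t : Word {g}) → occ w s ≤ occ w (s ++ t)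
occ-mono-++ w [] t = z≤n
occ-mono-++ w (x ∷ s) t = +-mono-≤ (starts-mono-++ w (x ∷ s) t) (occ-mono-++ w s t)

occ-take≤ : ∀ {g} (w : Word {g}) M s → occ w (take M s) ≤ occ w s
occ-take≤ w M s = subst (occ w (take M s) ≤_) (cong (occ w) (take++drop≡id M s)) (occ-mono-++ w (take M s) (drop M s))

occ≤length : ∀ {g} (w s : Word {g}) → occ w s ≤ length s
occ≤length w []  = z≤n
occ≤length w (x ∷ s) = +-mono-≤ (starts≤1 w (x ∷ s)) (occ≤length w s)

occ-++-length : ∀ {g} (w s t : Word {g}) → occ w (s ++ t) ≤ length s + occ w t
occ-++-length w [] t = ≤-refl
occ-++-length w (x ∷ s) t = +-mono-≤ (starts≤1 w (x ∷ s ++ t)) (occ-++-length w s t)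

-- At most |w| occurrences straddle the boundary.
occ-++≤ : ∀ {g} (w s t : Word {g}) → occ w (s ++ t) ≤ occ w s + length w + occ w t
occ-++≤ w [] t = m≤n+m (occ w t) (length w)
occ-++≤ w (x ∷ s) t with length w ≤? length (x ∷ s)
... | no  |w|> = ≤-trans (occ-++-length w (x ∷ s) t) (+-monoˡ-≤ (occ w t) (≤-trans (<⇒≤ (≰⇒> |w|>)) (m≤n+m (length w) (occ w (x ∷ s)))))
... | yes |w|≤ = ≤-trans (+-mono-≤ (≤-reflexive (starts-++ w (x ∷ s) t |w|≤)) (occ-++≤ w s t))
    (≤-reflexive (rearrange (starts w (x ∷ s)) (occ w s) (length w) (occ w t)))
  where
  rearrange : ∀ a b c d → a + (b + c + d) ≡ a + b + c + d
  rearrange = solve-∀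

occ-concat≤ : ∀ {g} (w : Word {g}) {a} {A : Set a} (f : A → Word {g}) xs → occ w (concat (map f xs)) ≤ ∑ xs (λ x → occ w (f x) + length w)
occ-concat≤ w f []  = z≤n
occ-concat≤ w f (x ∷ xs) = ≤-trans (occ-++≤ w (f x) (concat (map f xs))) (+-monoʳ-≤ (occ w (f x) + length w) (occ-concat≤ w f xs))

length-concat : ∀ {a b} {A : Set a} {B : Set b} (f : A → List B) xs → length (concat (map f xs)) ≡ ∑ xs (length ∘ f)
length-concat = length-concatMap

take-≤-++ : ∀ {a} {A : Set a} M (s t : List A) → M ≤ length s → take M (s ++ t) ≡ take M s
take-≤-++ zero s t _  = refl
take-≤-++ (suc M) (x ∷ s) t (s≤s le) = cong (x ∷_) (take-≤-++ M s t le)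

-- R counts the earlier blocks. One half of R pays for the overshoot of the last block, the other
-- for B exceptional blocks at cost c T each: B T ^ 3 ≤ 2 y ≤ 2 (3 + 2 T R) ≤ 10 T R, and 20 c ≤ T.
dominated : ∀ {T B c m R k y} → 1 ≤ T → k ≤ T → y ≤ 3 + 2 * (k * R) → B * (T * (T * T)) ≤ 2 * y → 20 * c ≤ T → 3 + 4 * (suc m * (T * T)) ≤ y →
  suc m * T + B * (c * T) ≤ R
dominated {T} {B} {c} {m} {R} {k} {y} 1≤T k≤T y≤ B≤ c≤ y≥ = *-cancelˡ-≤ 2 (begin
  2 * (suc m * T + B * (c * T)) ≡⟨ *-distribˡ-+ 2 (suc m * T) (B * (c * T)) ⟩
  2 * (suc m * T) + 2 * (B * (c * T)) ≤⟨ +-mono-≤ boundary exceptional ⟩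
  R + R ≡⟨ cong (R +_) (+-identityʳ R) ⟨
  2 * R ∎)
  where
  open ≤-Reasoning
  instance
    T≢0 : NonZero T
    T≢0 = >-nonZero 1≤T
  y≤′ : y ≤ 3 + 2 * (T * R)
  y≤′ = ≤-trans y≤ (+-monoʳ-≤ 3 (*-monoʳ-≤ 2 (*-monoˡ-≤ R k≤T)))
  boundary : 2 * (suc m * T) ≤ R
  boundary = *-cancelˡ-≤ T (*-cancelˡ-≤ 2 (+-cancelˡ-≤ 3 _ _ (begin
    3 + 2 * (T * (2 * (suc m * T))) ≡⟨ cong (3 +_) (rearr T (suc m)) ⟩
    3 + 4 * (suc m * (T * T)) ≤⟨ ≤-trans y≥ y≤′ ⟩
    3 + 2 * (T * R) ∎)))
    where
    rearr : ∀ T n → 2 * (T * (2 * (n * T))) ≡ 4 * (n * (T * T))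
    rearr = solve-∀
  1≤TR : 1 ≤ T * R
  1≤TR = 1≤* 1≤T (≤-trans (1≤* {2} (s≤s z≤n) (1≤* {suc m} (s≤s z≤n) 1≤T)) boundary)
  exceptional : 2 * (B * (c * T)) ≤ R
  exceptional = *-cancelˡ-≤ 10 (*-cancelˡ-≤ T (begin
    T * (10 * (2 * (B * (c * T)))) ≡⟨ rearr₁ T B c ⟩
    B * (T * (20 * c * T)) ≤⟨ *-monoʳ-≤ B (*-monoʳ-≤ T (*-monoˡ-≤ T c≤)) ⟩
    B * (T * (T * T)) ≤⟨ B≤ ⟩
    2 * y ≤⟨ *-monoʳ-≤ 2 y≤′ ⟩
    2 * (3 + 2 * (T * R)) ≤⟨ *-monoʳ-≤ 2 (+-monoˡ-≤ (2 * (T * R)) (*-monoʳ-≤ 3 1≤TR)) ⟩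
    2 * (3 * (T * R) + 2 * (T * R)) ≡⟨ rearr₂ T R ⟩
    T * (10 * R) ∎))
    where
    rearr₁ : ∀ T B c → T * (10 * (2 * (B * (c * T)))) ≡ B * (T * (20 * c * T))
    rearr₁ = solve-∀
    rearr₂ : ∀ T R → 2 * (3 * (T * R) + 2 * (T * R)) ≡ T * (10 * R)
    rearr₂ = solve-∀

-- Blocks D n for n in the set U, which has at least y / (2 log₂ y) elements below y, up to constants.
module _ {g : ℕ} .{{_ : NonZero g}} (2≤g : 2 ≤ g) {F : ℕ → ℕ} (F≥1 : ∀ {n} → 1 ≤ n → 1 ≤ F n) {U : Pred ℕ 0ℓ} (U? : Decidable U)
  (dense : ∀ y k → y ≤ 2 ^ k → y ≤ 3 + 2 * (k * length (filter U? (range1 (y ∸ 1))))) where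

  private
    D : ℕ → Word {g}
    D n = digits g (F n)

    members : ℕ → List ℕ
    members N = filter U? (range1 N)

    members-unique : ∀ N → Unique (members N)
    members-unique N = Unique.filter⁺ U? (range1-unique N)

    members⁻ : ∀ {N n} → n ∈ members N → 1 ≤ n × n ≤ N
    members⁻ {N} n∈ = ∈-range1⁻ (proj₁ (∈-filter⁻ U? {xs = range1 N} n∈))

  prefix : ℕ → Word {g}
  prefix N = concat (map D (members N))

  private
    block : ℕ → Word {g}
    block n = concat (map D (filter U? [ n ]))

    prefix-suc : ∀ N → prefix (suc N) ≡ prefix N ++ block (suc N)
    prefix-suc N = begin
      concat (map D (filter U? (range1 (suc N)))) ≡⟨ cong (concat ∘ map D ∘ filter U?) (range1-suc N) ⟩
      concat (map D (filter U? (range1 N ++ [ suc N ]))) ≡⟨ cong (concat ∘ map D) (filter-++ U? (range1 N) [ suc N ]) ⟩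
      concat (map D (members N ++ filter U? [ suc N ])) ≡⟨ cong concat (map-++ D (members N) (filter U? [ suc N ])) ⟩
      concat (map D (members N) ++ map D (filter U? [ suc N ])) ≡⟨ concat-++ (map D (members N)) (map D (filter U? [ suc N ])) ⟨
      prefix N ++ block (suc N) ∎
      where open ≡-Reasoning

    length-prefix-mono : ∀ {N N′} → N ≤ N′ → length (prefix N) ≤ length (prefix N′)
    length-prefix-mono {N} le with m≤n⇒∃[o]m+o≡n le
    ... | d , refl = go d
      where
      go : ∀ d → length (prefix N) ≤ length (prefix (N + d))
      go zero  = ≤-reflexive (cong (length ∘ prefix) (sym (+-identityʳ N)))
      go (suc d) = ≤-trans (go d) (≤-trans (m≤m+n _ _) (≤-reflexive (sym (trans (cong (length ∘ prefix) (+-suc N d))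
        (trans (cong length (prefix-suc (N + d))) (length-++ (prefix (N + d))))))))

    -- Reduces an arbitrary cut to a block boundary: the M-th digit lies in the block of z + 1, so
    -- the prefix ending there exceeds M by less than that block.
    locate : ∀ M N → 1 ≤ M → M ≤ length (prefix N) →
      ∃[ z ] length (prefix z) < M × M ≤ length (prefix (suc z)) × take M (prefix N) ≡ take M (prefix (suc z))
    locate M zero 1≤M M≤ = contradiction (≤-trans 1≤M M≤) λ ()
    locate M (suc N) 1≤M M≤ with M ≤? length (prefix N)
    ... | no  M≰ = N , ≰⇒> M≰ , M≤ , refl
    ... | yes M≤N with locate M N 1≤M M≤N
    ... | z , lo , hi , eq = z , lo , hi , trans (cong (take M) (prefix-suc N)) (trans (take-≤-++ M (prefix N) (block (suc N)) M≤N) eq)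

    length-block≤ : ∀ n {c} → length (D n) ≤ c → length (block n) ≤ c
    length-block≤ n le with does (U? n)
    ... | true  = ≤-trans (≤-reflexive (trans (length-++ (D n)) (+-identityʳ _))) le
    ... | false = z≤n

    -- One digit per member: the lower bound on the number of digits against which the exceptional
    -- blocks are weighed.
    count≤length : ∀ N → length (members N) ≤ length (prefix N)
    count≤length N = begin
      length (members N) ≡⟨ length≡∑1 (members N) ⟩
      ∑ (members N) (λ _ → 1) ≤⟨ ∑-mono (members N) (λ n∈ → length-digits≥1 (F≥1 (proj₁ (members⁻ {N} n∈)))) ⟩
      ∑ (members N) (length ∘ D) ≡⟨ length-concat D (members N) ⟨
      length (prefix N) ∎
      where open ≤-Reasoning

  module _ (w : Word {g}) (k′ : ℕ) (|w|≡ : length w ≡ suc k′) (m : ℕ) (1≤m : 1 ≤ m)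
    (exceptions : SparseExceptions g F (Bad w k′ |w|≡ m 1≤m) 3) where

    private
      module X = SparseExceptions exceptions
      k = suc k′
      n = g ^ k * m
      c = n * suc k
      -- R t ≤ 2 ^ t supplies the numerical hypotheses of `dominated`: 20 * c ≤ T, and 2 * t + (m +
      -- 3) ≤ 2 ^ s, whence y ≥ 2 ^ (2 * t + (m + 3)) ≥ 8 (m + 1) T ^ 2.
      R : ℕ → ℕ
      R t = 20 * c + 4 * (2 * t + (m + 3))
      R-poly : Poly R
      R-poly = poly-+ (poly-const (20 * c)) (poly-* (poly-const 4) (poly-+ (poly-* (poly-const 2) poly-id) (poly-const (m + 3))))
      R≤2^ = poly≤2^ R-poly
      s₁ = X.s₀ + proj₁ R≤2^
      -- If M exceeds the length of `prefix y₀`, the block reached has an index beyond y₀, and the s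
      -- belonging to that index is at least s₁.
      y₀ = 2 ^ (2 ^ s₁)
      M₀ = suc (length (prefix y₀))

      -- An unexceptional block contributes at most m + 1 times its length, its boundary being
      -- covered by the allowance in `Bad`. The overshoot and the exceptional blocks together cost
      -- at most the number of earlier blocks, hence at most M, which turns m + 1 into m + 2.
      bound-at : ∀ M z s → s₁ ≤ s → 2 ^ (2 ^ s) ≤ suc z → suc z < 2 ^ (2 ^ suc s) →
        length (prefix z) < M → n * occ w (prefix (suc z)) ≤ (2 + m) * M
      bound-at M z s s₁≤s y≥ y< |z|<M with X.sparse s (suc z) (≤-trans (m≤m+n X.s₀ _) s₁≤s) y≥ y<
      ... | bad , bad-small , spec = begin
        n * occ w (prefix y) ≤⟨ *-monoʳ-≤ n (occ-concat≤ w D (members y)) ⟩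
        n * ∑ (members y) (λ i → occ w (D i) + length w) ≡⟨ ∑-*ˡ (members y) n (λ i → occ w (D i) + length w) ⟨
        ∑ (members y) (λ i → n * (occ w (D i) + length w)) ≤⟨ ∑-exceptional {bad = bad} (members-unique y) classify ⟩
        ∑ (members y) (λ i → suc m * length (D i)) + length bad * (c * T) ≡⟨ cong (_+ length bad * (c * T)) (trans (∑-*ˡ (members y) (suc m) (length ∘ D)) (cong (suc m *_) (sym (length-concat D (members y))))) ⟩
        suc m * length (prefix y) + length bad * (c * T) ≤⟨ +-monoˡ-≤ (length bad * (c * T)) (*-monoʳ-≤ (suc m) |y|≤) ⟩
        suc m * (M + T) + length bad * (c * T) ≡⟨ trans (cong (_+ length bad * (c * T)) (*-distribˡ-+ (suc m) M T)) (+-assoc (suc m * M) _ _) ⟩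
        suc m * M + (suc m * T + length bad * (c * T)) ≤⟨ +-monoʳ-≤ (suc m * M) (≤-trans small (≤-trans (count≤length z) (<⇒≤ |z|<M))) ⟩
        suc m * M + M ≡⟨ +-comm (suc m * M) M ⟩
        (2 + m) * M ∎
        where
        open ≤-Reasoning
        y = suc z
        t = 2 + s
        T = 2 ^ t
        1≤T : 1 ≤ T
        1≤T = 1≤2^ t
        R≤T : R t ≤ T
        R≤T = proj₂ R≤2^ t (≤-trans (m≤n+m _ X.s₀) (≤-trans s₁≤s (m≤n+m s 2)))
        classify : ∀ {i} → i ∈ members y → n * (occ w (D i) + length w) ≤ suc m * length (D i) ⊎ (i ∈ bad × n * (occ w (D i) + length w) ≤ c * T)
        classify {i} i∈ with spec (proj₁ (members⁻ {y} i∈)) (proj₂ (members⁻ {y} i∈))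
        ... | short , inj₂ ¬bad = inj₁ (subst (λ l → n * (occ w (D i) + l) ≤ suc m * length (D i)) (sym |w|≡) (≮⇒≥ ¬bad))
        ... | short , inj₁ i∈bad = inj₂ (i∈bad , (begin
          n * (occ w (D i) + length w) ≤⟨ *-monoʳ-≤ n (+-mono-≤ (≤-trans (occ≤length w (D i)) short) (≤-trans (≤-reflexive |w|≡) (m≤m*n k T {{m^n≢0 2 t}}))) ⟩
          n * (T + k * T) ≡⟨ *-assoc n (suc k) T ⟨
          c * T ∎))
        |y|≤ : length (prefix y) ≤ M + T
        |y|≤ = begin
          length (prefix y) ≡⟨ trans (cong length (prefix-suc z)) (length-++ (prefix z)) ⟩
          length (prefix z) + length (block y) ≤⟨ +-mono-≤ (<⇒≤ |z|<M) (length-block≤ y (proj₁ (spec (s≤s z≤n) ≤-refl))) ⟩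
          M + T ∎
        T³ : 2 ^ (3 * t) ≡ T * (T * T)
        T³ = trans (cong (λ e → 2 ^ (t + (t + e))) (+-identityʳ t)) (trans (sym (2^-* t (t + t))) (cong (T *_) (sym (2^-* t t))))
        small : suc m * T + length bad * (c * T) ≤ length (members z)
        small = dominated {T} {length bad} {c} {m} {length (members z)} {2 ^ suc s} {y} 1≤T (^-monoʳ-≤ 2 (n≤1+n (suc s))) (dense y (2 ^ suc s) (<⇒≤ y<))
          (subst (λ e → length bad * e ≤ 2 * y) T³ bad-small) (≤-trans (m≤m+n (20 * c) _) R≤T) (begin
          3 + 4 * (suc m * (T * T)) ≤⟨ +-monoˡ-≤ _ (*-monoʳ-≤ 3 (1≤* {suc m} (s≤s z≤n) (1≤* 1≤T 1≤T))) ⟩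
          3 * (suc m * (T * T)) + 4 * (suc m * (T * T))  ≤⟨ m≤m+n _ (suc m * (T * T)) ⟩
          3 * (suc m * (T * T)) + 4 * (suc m * (T * T)) + suc m * (T * T)  ≡⟨ eight (suc m) (T * T) ⟩
          T * T * (suc m * 8) ≤⟨ *-monoʳ-≤ (T * T) (*-monoˡ-≤ 8 (n<2^n m)) ⟩
          T * T * (2 ^ m * 2 ^ 3) ≡⟨ cong₂ _*_ (2^-* t t) (2^-* m 3) ⟩
          2 ^ (t + t) * 2 ^ (m + 3) ≡⟨ 2^-* (t + t) (m + 3) ⟩
          2 ^ (t + t + (m + 3)) ≤⟨ ^-monoʳ-≤ 2 {t + t + (m + 3)} {2 ^ s} (*-cancelˡ-≤ {t + t + (m + 3)} {2 ^ s} 4 (begin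
            4 * (t + t + (m + 3)) ≡⟨ cong (λ e → 4 * (t + e + (m + 3))) (+-identityʳ t) ⟨
            4 * (2 * t + (m + 3)) ≤⟨ m≤n+m _ (20 * c) ⟩
            R t ≤⟨ R≤T ⟩
            2 * (2 * 2 ^ s) ≡⟨ *-assoc 2 2 (2 ^ s) ⟨
            4 * 2 ^ s ∎)) ⟩
          2 ^ (2 ^ s) ≤⟨ y≥ ⟩
          y ∎)
          where
          eight : ∀ a x → 3 * (a * x) + 4 * (a * x) + a * x ≡ x * (a * 8)
          eight = solve-∀

    upper-frequency : ∃[ M₀ ] (∀ M → M₀ ≤ M → ∀ N → M ≤ length (prefix N) → n * occ w (take M (prefix N)) ≤ (2 + m) * M)
    upper-frequency = M₀ , bound
      where
      bound : ∀ M → M₀ ≤ M → ∀ N → M ≤ length (prefix N) → n * occ w (take M (prefix N)) ≤ (2 + m) * M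
      bound M M₀≤M N M≤ with locate M N (≤-trans (s≤s z≤n) M₀≤M) M≤
      ... | z , lo , hi , eq = ≤-trans (*-monoʳ-≤ n (≤-trans (≤-reflexive (cong (occ w) eq)) (occ-take≤ w M (prefix (suc z)))))
          (case loglog (suc z) (≤-trans 2≤y₀ (<⇒≤ y₀<)) of λ { (s , y≥ , y<) → bound-at M z s (s₁≤ s y<) y≥ y< lo })
        where
        2≤y₀ : 2 ≤ y₀
        2≤y₀ = ^-monoʳ-≤ 2 (1≤2^ s₁)
        y₀< : y₀ < suc z
        y₀< with suc z ≤? y₀
        ... | yes le = contradiction (≤-trans M₀≤M (≤-trans hi (length-prefix-mono le))) (<-irrefl refl)
        ... | no  ≰  = ≰⇒> ≰
        s₁≤ : ∀ s → suc z < 2 ^ (2 ^ suc s) → s₁ ≤ s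
        s₁≤ s y< with s₁ ≤? s
        ... | yes le = le
        ... | no  ≰  = contradiction (<-trans y₀< y<) (≤⇒≯ (^-monoʳ-≤ 2 (^-monoʳ-≤ 2 (≰⇒> ≰))))

-- Normality

eventually-all : ∀ {a} {A : Set a} {Q : A → ℕ → Set} (xs : List A) → (∀ {x} → x ∈ xs → ∃[ M₀ ] (∀ M → M₀ ≤ M → Q x M)) →
  ∃[ M₀ ] (∀ M → M₀ ≤ M → ∀ {x} → x ∈ xs → Q x M)
eventually-all [] ev = 0 , λ _ _ ()
eventually-all (x ∷ xs) ev =
  let M₁ , q₁ = ev (here refl) ; M₂ , q₂ = eventually-all xs (ev ∘ there)
  in M₁ + M₂ , λ { M le (here refl) → q₁ M (≤-trans (m≤m+n M₁ M₂) le) ; M le (there x∈) → q₂ M (≤-trans (m≤n+m M₂ M₁) le) x∈ }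

-- Upper bounds for the frequencies of all words of a given length imply lower bounds, as the frequencies add up to 1.
lower-frequency : ∀ {g} k m M (s : Word {g}) → length s ≡ M → m * k ≤ M → (∀ {v : Word {g}} → v ∈ strings k → g ^ k * m * occ v s ≤ (2 + m) * M) →
  ∀ {w : Word {g}} → w ∈ strings k → m * M ≤ g ^ k * m * occ w s + 3 * (g ^ k * M)
lower-frequency {g} k m M s |s|≡M mk≤M upper {w} w∈ with extract w∈
... | rest , perm = ≤-trans (m≤n+m (m * M) (2 * M)) (≤-trans (≤-reflexive (sym (*-distribʳ-+ M 2 m))) (+-cancelʳ-≤ (n * M) _ _ (begin
  (2 + m) * M + n * M
    ≡⟨ cong (λ z → (2 + m) * M + n * z) |s|≡M ⟨
  (2 + m) * M + n * length s
    ≤⟨ +-monoʳ-≤ ((2 + m) * M) (*-monoʳ-≤ n (∑-words-occ k s)) ⟩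
  (2 + m) * M + n * (∑ (strings k) (λ v → occ v s) + k)
    ≡⟨ cong ((2 + m) * M +_) (trans (*-distribˡ-+ n _ k) (cong₂ _+_ (sym (∑-*ˡ (strings k) n (λ v → occ v s))) (*-assoc b m k))) ⟩
  (2 + m) * M + (∑ (strings k) (λ v → n * occ v s) + b * (m * k))
    ≡⟨ cong (λ z → (2 + m) * M + (z + b * (m * k))) (∑-↭ (λ v → n * occ v s) perm) ⟩
  (2 + m) * M + (n * occ w s + ∑ rest (λ v → n * occ v s) + b * (m * k))
    ≤⟨ +-monoʳ-≤ ((2 + m) * M) (+-mono-≤ (+-monoʳ-≤ (n * occ w s) (∑-bound rest (λ v∈ → upper (∈-resp-↭ (↭-sym perm) (there v∈))))) (*-monoʳ-≤ b mk≤M)) ⟩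
  (2 + m) * M + (n * occ w s + length rest * ((2 + m) * M) + b * M)
    ≡⟨ rearr₁ ((2 + m) * M) (n * occ w s) (length rest) (b * M) ⟩
  n * occ w s + suc (length rest) * ((2 + m) * M) + b * M
    ≡⟨ cong (λ z → n * occ w s + z * ((2 + m) * M) + b * M) (trans (sym (↭-length perm)) (length-strings k)) ⟩
  n * occ w s + b * ((2 + m) * M) + b * M
    ≡⟨ rearr₂ (n * occ w s) b m M ⟩
  n * occ w s + 3 * (b * M) + n * M ∎)))
  where
  open ≤-Reasoning
  b = g ^ k
  n = b * m
  rearr₁ : ∀ x y r z → x + (y + r * x + z) ≡ y + suc r * x + z
  rearr₁ = solve-∀
  rearr₂ : ∀ x b m M → x + b * ((2 + m) * M) + b * M ≡ x + 3 * (b * M) + b * m * M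
  rearr₂ = solve-∀

-- ∣o/M − 1/b∣ ≤ 3/m < 1/d
ratio-close : ∀ o M b d m → 1 ≤ M → 1 ≤ b → m ≡ suc (3 * d) →
  b * m * o ≤ (2 + m) * M → m * M ≤ b * m * o + 3 * (b * M) → ℤ.∣ (o * b) ℤ.⊖ M ∣ * d < b * M
ratio-close o M b d m 1≤M 1≤b m≡ upper lower = scaled δ refl
  where
  open ≤-Reasoning
  δ = ℤ.∣ (o * b) ℤ.⊖ M ∣
  1≤bM : 1 ≤ b * M
  1≤bM = 1≤* 1≤b 1≤M
  swap-mul : ∀ b m o → b * m * o ≡ m * (o * b)
  swap-mul = solve-∀
  δ≤ : m * δ ≤ 3 * (b * M)
  δ≤ with ≤-total (o * b) M
  ... | inj₁ le = begin
    m * δ ≡⟨ cong (m *_) (ℤ.∣⊖∣-≤ le) ⟩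
    m * (M ∸ o * b) ≡⟨ *-distribˡ-∸ m M (o * b) ⟩
    m * M ∸ m * (o * b) ≤⟨ m≤n+o⇒m∸n≤o (m * M) (m * (o * b)) (subst (λ z → m * M ≤ z + 3 * (b * M)) (swap-mul b m o) lower) ⟩
    3 * (b * M) ∎
  ... | inj₂ le = begin
    m * δ ≡⟨ cong (m *_) (trans (ℤ.∣m⊖n∣≡∣n⊖m∣ (o * b) M) (ℤ.∣⊖∣-≤ le)) ⟩
    m * (o * b ∸ M) ≡⟨ *-distribˡ-∸ m (o * b) M ⟩
    m * (o * b) ∸ m * M ≤⟨ m≤n+o⇒m∸n≤o (m * (o * b)) (m * M) (begin
      m * (o * b) ≡⟨ swap-mul b m o ⟨
      b * m * o ≤⟨ upper ⟩
      (2 + m) * M ≡⟨ trans (*-distribʳ-+ M 2 m) (+-comm (2 * M) (m * M)) ⟩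
      m * M + 2 * M ≤⟨ +-monoʳ-≤ (m * M) (*-mono-≤ (s≤s (s≤s (z≤n {1}))) (m≤n*m M b {{>-nonZero 1≤b}})) ⟩
      m * M + 3 * (b * M) ∎) ⟩
    3 * (b * M) ∎
  -- For δ > 0 the strictness comes from m = 3 * d + 1 > 3 * d, for δ = 0 from the positivity of b *
  -- M.
  scaled : ∀ e → δ ≡ e → δ * d < b * M
  scaled zero eq = subst (λ z → z * d < b * M) (sym eq) 1≤bM
  scaled (suc e) eq = *-cancelˡ-< 3 (δ * d) (b * M) (begin-strict
    3 * (δ * d) ≡⟨ rearr δ d ⟩
    3 * d * δ <⟨ m<n+m (3 * d * δ) (subst (0 <_) (sym eq) (s≤s z≤n)) ⟩
    suc (3 * d) * δ ≡⟨ cong (_* δ) m≡ ⟨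
    m * δ ≤⟨ δ≤ ⟩
    3 * (b * M) ∎)
    where
    rearr : ∀ x d → 3 * (x * d) ≡ 3 * d * x
    rearr = solve-∀

ratio-toℚᵘ : ∀ o M → ℚ.toℚᵘ (ratio o (suc M)) ℚᵘ.≃ ℚᵘ.mkℚᵘ (ℤ.+ o) M
ratio-toℚᵘ o M = ℚ.toℚᵘ-fromℚᵘ (ℚᵘ.mkℚᵘ (ℤ.+ o) M)

ratio-distance : ∀ o M b → ℚ.toℚᵘ (ℚ.∣ ratio o (suc M) ℚ.- ratio 1 (suc b) ∣) ℚᵘ.≃ ℚᵘ.∣ ℚᵘ.mkℚᵘ (ℤ.+ o) M ℚᵘ.- ℚᵘ.mkℚᵘ (ℤ.+ 1) b ∣
ratio-distance o M b = ℚᵘ.≃-trans (ℚ.toℚᵘ-homo-∣-∣ (ratio o (suc M) ℚ.- ratio 1 (suc b))) (ℚᵘ.∣-∣-cong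
  (ℚᵘ.≃-trans (ℚ.toℚᵘ-homo-+ (ratio o (suc M)) (ℚ.- ratio 1 (suc b)))
    (ℚᵘ.+-cong (ratio-toℚᵘ o M) (ℚᵘ.≃-trans (ℚ.toℚᵘ-homo‿- (ratio 1 (suc b))) (ℚᵘ.-‿cong (ratio-toℚᵘ 1 b))))))

ratio-< : ∀ o M b (ε : ℚ.ℚ) → .{{ℚ.Positive ε}} → 1 ≤ M → 1 ≤ b → ℤ.∣ (o * b) ℤ.⊖ M ∣ * ℚ.↧ₙ ε < b * M →
  ℚ.∣ ratio o M ℚ.- ratio 1 b ∣ ℚ.< ε
ratio-< o (suc M) (suc b) ε@(ℚ.mkℚ (ℤ.+ suc e) d-1 _) _ _ lt = ℚ.toℚᵘ-cancel-< (ℚᵘ.<-respˡ-≃ (ℚᵘ.≃-sym (ratio-distance o M b))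
  (ℚᵘ.*<* (subst₂ ℤ._<_ (trans (ℤ.pos-* δ (suc d-1)) (cong (λ z → ℤ.+ z ℤ.* ℤ.+ suc d-1) (cong ℤ.∣_∣ (sym numerator)))) (ℤ.pos-* (suc e) (suc M * suc b))
    (ℤ.+<+ (<-≤-trans lt (≤-trans (≤-reflexive (*-comm (suc b) (suc M))) (m≤n*m (suc M * suc b) (suc e))))))))
  where
  δ = ℤ.∣ (o * suc b) ℤ.⊖ suc M ∣
  numerator : ℤ.+ o ℤ.* ℤ.+ suc b ℤ.+ (ℤ.- (ℤ.+ 1)) ℤ.* ℤ.+ suc M ≡ (o * suc b) ℤ.⊖ suc M
  numerator = trans (cong₂ ℤ._+_ (sym (ℤ.pos-* o (suc b))) (ℤ.-1*i≡-i (ℤ.+ suc M))) (ℤ.m-n≡m⊖n (o * suc b) (suc M))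

module _ {g : ℕ} .{{_ : NonZero g}} (2≤g : 2 ≤ g) {F : ℕ → ℕ} (F≥1 : ∀ {n} → 1 ≤ n → 1 ≤ F n) {U : Pred ℕ 0ℓ} (U? : Decidable U)
  (dense : ∀ y k → y ≤ 2 ^ k → y ≤ 3 + 2 * (k * length (filter U? (range1 (y ∸ 1)))))
  (encoding : ∃[ j ] Encoding F j 3) where

  concatenated : ℕ → Word {g}
  concatenated = prefix 2≤g {F} F≥1 {U} U? dense

  private
    L = concatenated

    module _ (k′ m : ℕ) where

      k = suc k′

      upper : 1 ≤ m → ∀ {v} → v ∈ strings k →
        ∃[ M₀ ] (∀ M → M₀ ≤ M → ∀ N → M ≤ length (L N) → g ^ k * m * occ v (take M (L N)) ≤ (2 + m) * M)
      upper 1≤m {v} v∈ =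
        let |v|≡ = ∈-strings⁻ k v∈
            q , 1≤q , C , few = chernoff v k′ |v|≡ m 1≤m
        in upper-frequency 2≤g F≥1 U? dense v k′ |v|≡ m 1≤m
             (sparse-exceptions 2≤g (proj₂ encoding) (bad? v k′ |v|≡ m 1≤m) {q} {C} 1≤q few)

      Uppers : ℕ → Set
      Uppers M = ∀ {v} → v ∈ strings k → ∀ N → M ≤ length (L N) → g ^ k * m * occ v (take M (L N)) ≤ (2 + m) * M

      uppers : 1 ≤ m → ∃[ M₀ ] (∀ M → M₀ ≤ M → Uppers M)
      uppers 1≤m = eventually-all (strings k) (upper 1≤m)

      close : ∀ {w} ε → .{{_ : ℚ.Positive ε}} → w ∈ strings k → m ≡ suc (3 * ℚ.↧ₙ ε) → ∀ {M} → 1 ≤ M → m * k ≤ M → Uppers M →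
        ∀ N → M ≤ length (L N) → ℚ.∣ ratio (occ w (take M (L N))) M ℚ.- ratio 1 (g ^ k) ∣ ℚ.< ε
      close {w} ε w∈ m≡ {M} 1≤M mk≤M up N M≤ = ratio-< (occ w s) M (g ^ k) ε 1≤M (m^n>0 g k)
        (ratio-close (occ w s) M (g ^ k) (ℚ.↧ₙ ε) m 1≤M (m^n>0 g k) m≡ (up w∈ N M≤)
          (lower-frequency k m M s |s|≡ mk≤M (λ v∈ → up v∈ N M≤) w∈))
        where
        s = take M (L N)
        |s|≡ : length s ≡ M
        |s|≡ = trans (length-take M (L N)) (m≤n⇒m⊓n≡m M≤)

    normal-length : ∀ n w → length w ≡ n → 1 ≤ n → (ε : ℚ.ℚ) → .{{_ : ℚ.Positive ε}} →
      ∃[ M₀ ] (∀ M → M₀ ≤ M → ∀ N → M ≤ length (L N) → ℚ.∣ ratio (occ w (take M (L N))) M ℚ.- ratio 1 (g ^ n) ∣ ℚ.< ε)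
    normal-length (suc k′) w |w|≡ _ ε =
      let m = suc (3 * ℚ.↧ₙ ε)
          M₀ , up = uppers k′ m (s≤s z≤n)
      in suc (m * suc k′ + M₀) , λ M le → close k′ m ε (subst (λ n → w ∈ strings n) |w|≡ (∈-strings w)) refl
           (≤-trans (s≤s z≤n) le) (≤-trans (m≤m+n (m * suc k′) M₀) (≤-trans (n≤1+n _) le))
           (up M (≤-trans (m≤n+m M₀ (suc (m * suc k′))) le))

  normal : Normal g concatenated
  normal w 1≤|w| ε ε>0 = normal-length (length w) w refl 1≤|w| ε {{ε>0}}

composeL≥1 : ∀ fs {n} → 1 ≤ n → 1 ≤ composeL fs n
composeL≥1 [] 1≤n = 1≤n
composeL≥1 (f ∷ fs) 1≤n = ⟦f⟧≥1 f (composeL≥1 fs 1≤n)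

filter-everything : ∀ (xs : List ℕ) → filter (λ _ → yes tt) xs ≡ xs
filter-everything []  = refl
filter-everything (x ∷ xs) = cong (x ∷_) (filter-everything xs)

-- Puts all positive integers into the same interface as the primes. For y ≥ 2 the hypothesis forces
-- k ≥ 1, so the factor k only helps.
naturals-dense : ∀ y k → y ≤ 2 ^ k → y ≤ 3 + 2 * (k * length (filter (λ _ → yes tt) (range1 (y ∸ 1))))
naturals-dense zero k _ = z≤n
naturals-dense (suc zero) k _ = s≤s z≤n
naturals-dense (suc (suc y)) zero (s≤s ())
naturals-dense (suc y) (suc k) _ = begin
  suc y ≤⟨ m≤n+m (suc y) 2 ⟩
  3 + y ≡⟨ cong (3 +_) (trans (sym (length-range1 y)) (cong length (sym (filter-everything (range1 y))))) ⟩
  3 + length (filter (λ _ → yes tt) (range1 y)) ≤⟨ +-monoʳ-≤ 3 (≤-trans (m≤n*m _ (suc k)) (m≤n*m _ 2)) ⟩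
  3 + 2 * (suc k * length (filter (λ _ → yes tt) (range1 y))) ∎
  where open ≤-Reasoning

normal-cong : ∀ {g L L′} → (∀ N → L N ≡ L′ N) → Normal g L → Normal g L′
normal-cong {L = L} {L′} eq nrm w 1≤ ε ε>0 with nrm w 1≤ ε ε>0
... | M₀ , close = M₀ , λ M M₀≤ N M≤ → subst (λ s → ℚ.∣ ratio (occ w (take M s)) M ℚ.- ratio 1 (_ ^ length w) ∣ ℚ.< ε) (eq N)
        (close M M₀≤ N (subst (λ s → M ≤ length s) (sym (eq N)) M≤))

theorem1p2 : (g : ℕ) → .{{_ : NonZero g}} → 2 ≤ g → (fs : List⁺ Basic) →
    Normal g (champAll g (compose fs)) × Normal g (champPrime g (compose fs))
theorem1p2 g 2≤g (f ∷ fs) =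
  normal-cong (λ N → cong (concat ∘ map (λ n → digits g (compose (f ∷ fs) n))) (filter-everything (range1 N)))
    (normal 2≤g {composeL (f ∷ fs)} (composeL≥1 (f ∷ fs)) (λ _ → yes tt) naturals-dense encoding) ,
  normal 2≤g {composeL (f ∷ fs)} (composeL≥1 (f ∷ fs)) prime? primes-dense encoding
  where
  encoding : ∃[ j ] Encoding (composeL (f ∷ fs)) j 3
  encoding = length (f ∷ fs) , encode-composeL (f ∷ fs) 3
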